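{- There exists an absolute constant $C>0$ such that for every integer $k\ge 2$ and every integer $n\ge 2^{Ck}$ we have $$r(nK_k)=(2k-1)n+r(K_{k-1})-2.$$
   Context: $K_k$ is the complete graph on $k$ vertices, and $nK_k$ denotes the graph consisting of $n$ vertex-disjoint copies of $K_k$. For a graph $G$, the Ramsey number $r(G)$ is the smallest integer $N$ such that every $2$-colouring of the edges of the complete graph on $N$ vertices contains a monochromatic copy of $G$ (as a not necessarily induced subgraph). -}

module Defs where

open import Data.Nat using (ℕ; zero; suc; _+_; _*_; _^_; _≤_; _<_)
open import Data.Nat.Properties
  using (≤-reflexive; ≤-trans; ≤-antisym; ≮⇒≥; +-mono-≤; +-suc; +-identityʳ;
         anyUpTo?; 1+n≰n; m^n>0)
  renaming (_<?_ to _ℕ<?_)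
open import Data.Nat.Induction using (<-rec)
open import Data.Fin using (Fin; zero; suc; quotient; remainder; finToFun; funToFin)
open import Data.Fin.Properties using (_≟_; all?; any?; finToFun-funToFin)
open import Data.List using (List; []; _∷_; length; filter; lookup; allFin)
open import Data.List.Properties using (length-tabulate)
open import Data.List.Relation.Unary.All as All using (All; []; _∷_)
open import Data.List.Relation.Unary.All.Properties as AllP using (all-filter)
open import Data.List.Relation.Unary.AllPairs using (AllPairs; []; _∷_)
import Data.List.Relation.Unary.AllPairs.Properties as APP
open import Data.List.Relation.Unary.Unique.Propositional using (Unique)
open import Data.List.Relation.Unary.Unique.Propositional.Properties using (allFin⁺)
open import Data.List.Membership.Propositional.Properties using (∈-lookup)
open import Data.Product using (∃; ∃-syntax; _×_; _,_; proj₁; proj₂)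
open import Data.Sum using (_⊎_; inj₁; inj₂)
open import Data.Unit using (⊤; tt)
open import Function using (id; _∘_)
open import Function.Definitions using (Injective)
open import Relation.Binary.PropositionalEquality
  using (_≡_; _≢_; refl; sym; trans; cong; cong₂; subst; ≢-sym)
open import Relation.Nullary using (¬_; Dec; yes; no; contradiction; ¬?)
open import Relation.Nullary.Decidable using (_×-dec_; _→-dec_; map′; decidable-stable)

record Graph : Set₁ where
  field
    order      : ℕ
    Adj        : Fin order → Fin order → Set
    adj?       : ∀ u v → Dec (Adj u v)
    adj-sym    : ∀ {u v} → Adj u v → Adj v u
    adj-irrefl : ∀ {u} → ¬ Adj u u

open Graph public

K : ℕ → Graph
K k = record
  { order      = k
  ; Adj        = _≢_
  ; adj?       = λ u v → ¬? (u ≟ v)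
  ; adj-sym    = ≢-sym
  ; adj-irrefl = λ u≢u → u≢u refl
  }

infixr 8 _·_

-- Vertex  i  of  n · G  is the vertex  remainder i  of the copy numbered  quotient i.
_·_ : ℕ → Graph → Graph
n · G = record
  { order      = n * v
  ; Adj        = λ i j → copy i ≡ copy j × Adj G (vertex i) (vertex j)
  ; adj?       = λ i j → (copy i ≟ copy j) ×-dec adj? G (vertex i) (vertex j)
  ; adj-sym    = λ (p , a) → sym p , adj-sym G a
  ; adj-irrefl = λ (_ , a) → adj-irrefl G a
  }
  where
  v = order G
  copy : Fin (n * v) → Fin n
  copy = quotient v
  vertex : Fin (n * v) → Fin v
  vertex = remainder {n} v

-- A 2-colouring of the edges of the complete graph on Fin N.  The values on the
-- diagonal play no role: they are never inspected by a copy of a loopless graph.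
record Colouring (N : ℕ) : Set where
  field
    colour    : Fin N → Fin N → Fin 2
    symmetric : ∀ u v → colour u v ≡ colour v u

open Colouring public

record MonochromaticCopy (G : Graph) {N : ℕ} (c : Colouring N) : Set where
  field
    embed         : Fin (order G) → Fin N
    injective     : Injective _≡_ _≡_ embed
    hue           : Fin 2
    monochromatic : ∀ {u v} → Adj G u v → colour c (embed u) (embed v) ≡ hue

Arrows : ℕ → Graph → Set
Arrows N G = (c : Colouring N) → MonochromaticCopy G c

record IsRamseyNumber (G : Graph) (N : ℕ) : Set where
  field
    arrows  : Arrows N G
    minimal : ∀ {M} → Arrows M G → N ≤ M

isRamseyNumber-unique : ∀ {G M N} → IsRamseyNumber G M → IsRamseyNumber G N → M ≡ N
isRamseyNumber-unique p q = ≤-antisym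
  (minimal p (arrows q)) (minimal q (arrows p))
  where
  open IsRamseyNumber

-- Existence of Ramsey numbers, so that r below is a total function: a colouring of
-- 2 ^ (v + v) vertices contains a monochromatic clique on v vertices, and Arrows is
-- decidable, so a least N with Arrows N G can be searched for.

module _ {N : ℕ} (c : Colouring N) where

  Joined : Fin 2 → Fin N → Fin N → Set
  Joined b x y = x ≢ y × colour c x y ≡ b

  joined-sym : ∀ {b x y} → Joined b x y → Joined b y x
  joined-sym (x≢y , e) = ≢-sym x≢y , trans (symmetric c _ _) e

  Clique : Fin 2 → ℕ → (Fin N → Set) → Set
  Clique b s P = ∃[ ys ] length ys ≡ s × AllPairs (Joined b) ys × All P ys

  private
    isZero? : ∀ x y → Dec (colour c x y ≡ zero)
    isZero? x y = colour c x y ≟ zero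

    isOne? : ∀ x y → Dec (colour c x y ≡ suc zero)
    isOne? x y = colour c x y ≟ suc zero

    length-split : ∀ x ys →
      length ys ≡ length (filter (isZero? x) ys) + length (filter (isOne? x) ys)
    length-split x []       = refl
    length-split x (y ∷ ys) with colour c x y
    ... | zero     = cong suc (length-split x ys)
    ... | suc zero = trans (cong suc (length-split x ys)) (sym (+-suc (length (filter (isZero? x) ys)) _))

    half : ∀ {a b m l} → 2 ^ suc m ≤ suc l → l ≡ a + b → 2 ^ m ≤ a ⊎ 2 ^ m ≤ b
    half {a} {b} {m} le refl with a ℕ<? 2 ^ m | b ℕ<? 2 ^ m
    ... | no a≮   | _       = inj₁ (≮⇒≥ a≮)
    ... | yes _   | no b≮   = inj₂ (≮⇒≥ b≮)
    ... | yes a<  | yes b<  = contradiction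
      (≤-trans (≤-reflexive (cong suc (sym (+-suc a b))))
        (≤-trans (+-mono-≤ a< b<)
          (≤-trans (≤-reflexive (cong (2 ^ m +_) (sym (+-identityʳ (2 ^ m))))) le)))
      1+n≰n

    extend : ∀ {b s P x} → P x →
      Clique b s (λ y → P y × Joined b x y) → Clique b (suc s) P
    extend px (ys , refl , js , ps) =
      _ ∷ ys , refl , All.map proj₂ ps ∷ js , px ∷ All.map proj₁ ps

    weaken : ∀ {b s} {P Q : Fin N → Set} → (∀ {x} → P x → Q x) → Clique b s P → Clique b s Q
    weaken f (ys , l , js , ps) = ys , l , js , All.map f ps

    neighbours : ∀ {P : Fin N → Set} {x xs b} → All P xs → All (x ≢_) xs →
      All (λ y → P y × Joined b x y) (filter (λ y → colour c x y ≟ b) xs)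
    neighbours {x = x} {xs} {b} ps ns =
      All.zip (AllP.filter⁺ f? ps , All.zip (AllP.filter⁺ f? ns , all-filter f? xs))
      where f? = λ y → colour c x y ≟ b

  findClique : ∀ s t {P : Fin N → Set} xs → Unique xs → All P xs →
    2 ^ (s + t) ≤ length xs → Clique zero s P ⊎ Clique (suc zero) t P
  findClique zero    t       xs us ps le = inj₁ ([] , refl , [] , [])
  findClique (suc s) zero    xs us ps le = inj₂ ([] , refl , [] , [])
  findClique (suc s) (suc t) [] us ps le =
    contradiction (≤-trans (m^n>0 2 (suc s + suc t)) le) λ ()
  findClique (suc s) (suc t) (x ∷ xs) (n ∷ us) (p ∷ ps) le
    with half {m = s + suc t} le (length-split x xs)
  ... | inj₁ le′ with findClique s (suc t) _ (APP.filter⁺ (isZero? x) us)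
                      (neighbours ps n) le′
  ...   | inj₁ q = inj₁ (extend p q)
  ...   | inj₂ q = inj₂ (weaken proj₁ q)
  findClique (suc s) (suc t) (x ∷ xs) (n ∷ us) (p ∷ ps) le
      | inj₂ le′ with findClique (suc s) t _ (APP.filter⁺ (isOne? x) us)
                      (neighbours ps n)
                      (≤-trans (≤-reflexive (cong (2 ^_) (sym (+-suc s t)))) le′)
  ...   | inj₁ q = inj₁ (weaken proj₁ q)
  ...   | inj₂ q = inj₂ (extend p q)

  joined-lookup : ∀ {b ys} → AllPairs (Joined b) ys →
    ∀ {i j} → i ≢ j → Joined b (lookup ys i) (lookup ys j)
  joined-lookup (_ ∷ _)  {zero}  {zero}  i≢j = contradiction refl i≢j
  joined-lookup {ys = _ ∷ ys} (js ∷ _) {zero}  {suc j} _ = All.lookup js (∈-lookup j)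
  joined-lookup {ys = _ ∷ ys} (js ∷ _) {suc i} {zero}  _ =
    joined-sym (All.lookup js (∈-lookup i))
  joined-lookup (_ ∷ js) {suc i} {suc j} i≢j = joined-lookup js (i≢j ∘ cong suc)

  clique⇒copy : ∀ {b P} G → Clique b (order G) P → MonochromaticCopy G c
  clique⇒copy {b} G@record { order = .(length ys) } (ys , refl , js , _) = record
    { embed         = lookup ys
    ; injective     = λ {i} {j} eq → decidable-stable (i ≟ j)
                        λ i≢j → proj₁ (joined-lookup js i≢j) eq
    ; hue           = b
    ; monochromatic = λ a → proj₂ (joined-lookup js λ { refl → adj-irrefl G a })
    }

arrows-bound : ∀ G → Arrows (2 ^ (order G + order G)) G
arrows-bound G c with findClique c (order G) (order G) {λ _ → ⊤} (allFin _) (allFin⁺ _)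
                        (All.universal (λ _ → tt) _)
                        (≤-reflexive (sym (length-tabulate id)))
... | inj₁ q = clique⇒copy c G q
... | inj₂ q = clique⇒copy c G q

-- Functions between finite sets are enumerated through finToFun, which is surjective
-- only up to pointwise equality; hence the transport along pointwise equality below.

copy? : ∀ G {N} (c : Colouring N) → Dec (MonochromaticCopy G c)
copy? G {N} c = map′ to from (any? λ b → any? (λ e → good? b (finToFun e)))
  where
  v = order G
  Good : Fin 2 → (Fin v → Fin N) → Set
  Good b f = (∀ i j → f i ≡ f j → i ≡ j) × (∀ i j → Adj G i j → colour c (f i) (f j) ≡ b)
  good? : ∀ b f → Dec (Good b f)
  good? b f = (all? λ i → all? λ j → (f i ≟ f j) →-dec (i ≟ j)) ×-dec
              (all? λ i → all? λ j → adj? G i j →-dec (colour c (f i) (f j) ≟ b))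
  to : (∃[ b ] ∃[ e ] Good b (finToFun e)) → MonochromaticCopy G c
  to (b , e , inj , mono) = record
    { embed = finToFun e ; injective = inj _ _ ; hue = b ; monochromatic = mono _ _ }
  from : MonochromaticCopy G c → ∃[ b ] ∃[ e ] Good b (finToFun e)
  from m = hue , funToFin embed ,
    (λ i j eq → injective (trans (sym (≗f i)) (trans eq (≗f j)))) ,
    (λ i j a → trans (cong₂ (colour c) (≗f i) (≗f j)) (monochromatic a))
    where
    open MonochromaticCopy m
    ≗f = finToFun-funToFin embed

arrows? : ∀ N G → Dec (Arrows N G)
arrows? N G = map′ to from (all? λ e → good? (decode e))
  where
  decode : Fin ((2 ^ N) ^ N) → Fin N → Fin N → Fin 2
  decode e u v = finToFun (finToFun e u) v
  encode : (Fin N → Fin N → Fin 2) → Fin ((2 ^ N) ^ N)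
  encode f = funToFin (λ u → funToFin (f u))
  decode-encode : ∀ f u v → decode (encode f) u v ≡ f u v
  decode-encode f u v =
    trans (cong (λ w → finToFun w v) (finToFun-funToFin (λ u → funToFin (f u)) u))
          (finToFun-funToFin (f u) v)
  Good : (Fin N → Fin N → Fin 2) → Set
  Good f = (s : ∀ u v → f u v ≡ f v u) →
           MonochromaticCopy G (record { colour = f ; symmetric = s })
  good? : ∀ f → Dec (Good f)
  good? f with all? (λ u → all? λ v → f u v ≟ f v u)
  ... | no ¬s = yes λ s → contradiction s ¬s
  ... | yes s with copy? G (record { colour = f ; symmetric = s })
  ...   | no ¬m = no λ g → ¬m (g s)
  ...   | yes m = yes λ _ → record
          { embed = embed ; injective = injective ; hue = hue ; monochromatic = monochromatic }
          where open MonochromaticCopy m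
  to : (∀ e → Good (decode e)) → Arrows N G
  to g c = record
    { embed = embed ; injective = injective ; hue = hue
    ; monochromatic = λ a → trans (sym (decode-encode (colour c) _ _)) (monochromatic a) }
    where
    open MonochromaticCopy (g (encode (colour c)) λ u v →
      trans (decode-encode _ u v) (trans (symmetric c u v) (sym (decode-encode _ v u))))
  from : Arrows N G → ∀ e → Good (decode e)
  from a e s = a record { colour = decode e ; symmetric = s }

abstract
  ramseyNumber-exists : ∀ G → ∃ (IsRamseyNumber G)
  ramseyNumber-exists G = <-rec _ search _ (arrows-bound G)
    where
    search : ∀ N → (∀ {M} → M < N → Arrows M G → ∃ (IsRamseyNumber G)) →
             Arrows N G → ∃ (IsRamseyNumber G)
    search N rec a with anyUpTo? (λ M → arrows? M G) N
    ... | yes (M , M<N , b) = rec M<N b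
    ... | no none = N , record
      { arrows = a ; minimal = λ {M} b → ≮⇒≥ λ M<N → none (M , M<N , b) }

r : Graph → ℕ
r G = proj₁ (ramseyNumber-exists G)

r-isRamseyNumber : ∀ G → IsRamseyNumber G (r G)
r-isRamseyNumber G = proj₂ (ramseyNumber-exists G)

{-# OPTIONS --safe #-}

-- Upper bound.  Call a set of fewer than (2k − 1) s vertices that contains s disjoint k-cliques of each colour a
-- gadget.  Removing a gadget gains a vertex, and a surplus of 2^O(k) vertices suffices because a red and a blue
-- clique sharing a vertex can then be removed repeatedly; so one may assume that there are no gadgets.  If there
-- is no monochromatic n K_k, there are large disjoint sets A without blue k-cliques and B without red ones.  In
-- the absence of gadgets almost all edges between them have one colour, say blue, and A contains a large red
-- clique X.  The set Q of the vertices with many red neighbours in X contains no blue k-clique, and X completes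
-- any greedy red tiling of Q, so |Q| < k n.  The set P of the remaining vertices contains no red k-clique and has
-- at least (k − 1) n + r(K_(k−1)) − 1 vertices.  It therefore contains n disjoint blue (k − 1)-cliques, and these
-- receive apexes in Q.
--
-- To find these (k − 1)-cliques one needs absorbers of size 2^O(k).  They live in a set S ⊆ P in which every
-- large subset contains a red clique of more than half of the size possible in S: two large subsets of S are then
-- never joined entirely in red, so that any two large blue neighbourhoods can be linked.

module Submission where

open import Defs
open import Data.Nat
  using (ℕ; zero; suc; _+_; _*_; _∸_; _^_; _≤_; _<_; z≤n; s≤s; s≤s⁻¹; _≤?_; _<?_;
         NonZero; >-nonZero)
open import Data.Nat.Properties
  using (≤-refl; ≤-reflexive; ≤-trans; <⇒≤; ≰⇒>; ≮⇒≥; n≤1+n; m≤m+n; m≤n+m; 1+n≰n; +-mono-≤;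
         +-monoʳ-≤; +-monoˡ-≤; *-mono-≤; *-monoʳ-≤; *-monoˡ-≤; +-cancelʳ-≤; +-cancelˡ-≤; *-cancelʳ-≤;
         *-cancelʳ-≡; +-comm; +-assoc; *-comm; *-assoc; +-identityʳ; *-identityʳ; *-identityˡ; +-suc;
         *-suc; *-distribʳ-+; ^-distribˡ-+-*; ^-monoʳ-≤; ^-monoˡ-≤; m^n>0; ^-*-assoc; suc-injective;
         m≤n⇒m⊓n≡m; m+n∸m≡n; m+[n∸m]≡n; module ≤-Reasoning)
open import Data.Nat.DivMod using (_/_; _%_; m≡m%n+[m/n]*n; m%n<n)
open import Data.Nat.Tactic.RingSolver using (solve-∀)
open import Data.Fin
  using (Fin; zero; suc; quotient; remainder; combine; inject≤; punchIn; splitAt; join)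
open import Data.Fin.Properties
  using (_≟_; any?; inject≤-injective; combine-remQuot; combine-injective; remQuot-combine;
         join-splitAt; punchInᵢ≢i; punchIn-injective; injective⇒≤)
open import Data.List
  using (List; []; _∷_; _++_; [_]; length; filter; concat; concatMap; map; lookup; allFin; take;
         drop; tabulate)
open import Data.List.Properties
  using (length-++; length-tabulate; length-take; length-drop; take++drop≡id; ++-assoc; concat-++;
         ++-identityʳ)
open import Data.List.Membership.Propositional using (_∈_; _∉_; find; lose)
open import Data.List.Membership.Propositional.Properties
  using (∈-filter⁺; ∈-filter⁻; ∈-++⁺ˡ; ∈-++⁺ʳ; ∈-++⁻; ∈-concat⁺′; ∈-concat⁻′; ∈-map⁺; ∈-lookup;
         ∈-∃++; ∈-tabulate⁻)
import Data.List.Membership.DecPropositional as DecMembership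
open import Data.List.Relation.Unary.Any as Any using (Any; here; there)
open import Data.List.Relation.Unary.All as All using (All; []; _∷_)
import Data.List.Relation.Unary.All.Properties as AllP
open import Data.List.Relation.Unary.AllPairs as AllPairs using (AllPairs; []; _∷_)
import Data.List.Relation.Unary.AllPairs.Properties as APP
open import Data.List.Relation.Unary.Unique.Propositional using (Unique)
import Data.List.Relation.Unary.Unique.Propositional.Properties as UP
open import Data.List.Relation.Binary.Subset.Propositional using (_⊆_)
open import Data.List.Relation.Binary.Permutation.Propositional
  using (_↭_; ↭-refl; ↭-sym; ↭-trans; ↭-reflexive; prep; ↭⇒↭ₛ)
import Data.List.Relation.Binary.Permutation.Setoid.Properties as SetoidP
open import Data.List.Relation.Binary.Permutation.Propositional.Properties
  using (↭-length; shift; shifts; ∈-resp-↭; ++-commutativeMonoid)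
  renaming (++⁺ to ↭-++⁺; ++⁺ˡ to ↭-++⁺ˡ; ++⁺ʳ to ↭-++⁺ʳ)
open import Data.Product using (∃-syntax; Σ-syntax; _×_; _,_; proj₁; proj₂)
open import Data.Sum using (_⊎_; inj₁; inj₂; [_,_]′; map₂)
open import Data.Empty using (⊥; ⊥-elim)
open import Function using (id)
open import Relation.Binary.PropositionalEquality
  using (_≡_; _≢_; refl; sym; trans; cong; cong₂; subst; ≢-sym)
open import Relation.Binary.PropositionalEquality.Properties using (setoid)
open import Relation.Nullary using (¬_; Dec; yes; no; contradiction; ¬?)
open import Relation.Nullary.Decidable using (_×-dec_; decidable-stable)
open import Relation.Unary using (Decidable)
open import Algebra.Bundles using (CommutativeMonoid)
import Algebra.Properties.CommutativeSemigroup as CommutativeSemigroup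

-- The bound leaves no slack, and two devices make the estimates exact. Lowering `n` by the number
-- `s` of cliques of each colour in a gadget lowers the required number of vertices by
-- `(2 k − 1) s`, which is more than the gadget occupies. So the missing surplus can serve as
-- induction variable, and few removals suffice. In `P` there may be only
-- `n (k − 1) + r(K_(k−1)) − 1` vertices, while a greedy choice of blue `(k − 1)`-cliques stalls
-- with 2^O(k) vertices left, hence the absorbers. The Ramsey number enters through leftover
-- vertices with few blue neighbours in a reserved set: `r(K_(k−1))` of them span a monochromatic
-- `(k − 1)`-clique, and a red one would have a common red neighbour in the reserve, giving a red
-- `k`-clique in `P`. Conventions: `k = 2 + h`, `j = 1 + h`, `R = r(K_(k−1)) − 1`, so that the bound
-- reads `n k + n j + R ≤ |xs| + 1`. Colours are variables `b ≢ d`: in `Seed`, `Core` and `Endgame`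
-- red is `b` and blue is `d`, whereas in `Absorbers`, `NearTiling` and `Descent` the colour of the
-- tiles is `b`.

-- Linear inequalities; finite sets as lists without repetition.

-- A certificate for linear arithmetic: `a ≤ b` is a sum of hypotheses, added up by `_⊕_`, `s` is
-- the slack, and the equation is left to the ring solver. With `z≤n {0}` for the sum, the slack
-- alone proves the inequality.
lin : ∀ {A B a b} s → a ≤ b → A + b + s ≡ B + a → A ≤ B
lin {A} {B} {a} {b} s p e = +-cancelʳ-≤ a A B (begin
  A + a     ≤⟨ +-monoʳ-≤ A p ⟩
  A + b     ≤⟨ m≤m+n (A + b) s ⟩
  A + b + s ≡⟨ e ⟩
  B + a     ∎)
  where open ≤-Reasoning

infixr 5 _⊕_
_⊕_ : ∀ {a b c d} → a ≤ b → c ≤ d → a + c ≤ b + d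
_⊕_ = +-mono-≤

module _ {A : Set} where

  ⊆-++ˡ : ∀ {xs ys : List A} → xs ⊆ xs ++ ys
  ⊆-++ˡ v = ∈-++⁺ˡ v

  ⊆-++ʳ : ∀ xs {ys : List A} → ys ⊆ xs ++ ys
  ⊆-++ʳ xs v = ∈-++⁺ʳ xs v

  ++-⊆ : ∀ {xs ys zs : List A} → xs ⊆ zs → ys ⊆ zs → xs ++ ys ⊆ zs
  ++-⊆ {xs} f g v = [ f , g ]′ (∈-++⁻ xs v)

  ∷-⊆ : ∀ {x} {ys zs : List A} → x ∈ zs → ys ⊆ zs → x ∷ ys ⊆ zs
  ∷-⊆ p g (here refl) = p
  ∷-⊆ p g (there v)   = g v

  []-⊆ : {zs : List A} → [] ⊆ zs
  []-⊆ ()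

  filter-⊆ : ∀ {P : A → Set} (P? : Decidable P) xs → filter P? xs ⊆ xs
  filter-⊆ P? xs v = proj₁ (∈-filter⁻ P? {xs = xs} v)

  take-⊆ : ∀ n {xs : List A} → take n xs ⊆ xs
  take-⊆ n {xs} v = subst (_ ∈_) (take++drop≡id n xs) (∈-++⁺ˡ v)

  drop-⊆ : ∀ n {xs : List A} → drop n xs ⊆ xs
  drop-⊆ n {xs} v = subst (_ ∈_) (take++drop≡id n xs) (∈-++⁺ʳ (take n xs) v)

  length-take-≤ : ∀ n {xs : List A} → n ≤ length xs → length (take n xs) ≡ n
  length-take-≤ n {xs} le = trans (length-take n xs) (m≤n⇒m⊓n≡m le)

  AllPairs-resp-↭ : ∀ {R : A → A → Set} → (∀ {x y} → R x y → R y x) →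
                    ∀ {xs ys : List A} → xs ↭ ys → AllPairs R xs → AllPairs R ys
  AllPairs-resp-↭ {R} R-sym σ =
    SetoidP.AllPairs-resp-↭ (setoid A) R-sym
      ((λ e → subst (R _) e) , (λ e → subst (λ z → R z _) e)) (↭⇒↭ₛ σ)

  Unique-resp-↭ : ∀ {xs ys : List A} → xs ↭ ys → Unique xs → Unique ys
  Unique-resp-↭ = AllPairs-resp-↭ ≢-sym

  ∉⇒All≢ : ∀ {x} {xs : List A} → x ∉ xs → All (x ≢_) xs
  ∉⇒All≢ x∉ = All.tabulate λ v e → x∉ (subst (_∈ _) (sym e) v)

  All≢⇒∉ : ∀ {x} {xs : List A} → All (x ≢_) xs → x ∉ xs
  All≢⇒∉ ps v = All.lookup ps v refl

  ∷-unique : ∀ {x} {xs : List A} → x ∉ xs → Unique xs → Unique (x ∷ xs)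
  ∷-unique x∉ u = ∉⇒All≢ x∉ ∷ u

  ++-unique : ∀ {xs ys : List A} → Unique xs → Unique ys →
              (∀ {x} → x ∈ xs → x ∉ ys) → Unique (xs ++ ys)
  ++-unique u v d = UP.++⁺ u v λ (p , q) → d p q

  unique-++⁻ : ∀ xs {ys : List A} → Unique (xs ++ ys) →
               Unique xs × Unique ys × (∀ {x} → x ∈ xs → x ∉ ys)
  unique-++⁻ [] u = [] , u , λ ()
  unique-++⁻ (x ∷ xs) (p ∷ u) with unique-++⁻ xs u
  ... | ux , uy , d = AllP.++⁻ˡ xs p ∷ ux , uy ,
    λ { (here refl) v → All≢⇒∉ (AllP.++⁻ʳ xs p) v ; (there w) → d w }

  unique-⊆-length : ∀ {xs ys : List A} → Unique xs → xs ⊆ ys → length xs ≤ length ys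
  unique-⊆-length {[]} u s = z≤n
  unique-⊆-length {x ∷ xs} (p ∷ u) s with ∈-∃++ (s (here refl))
  ... | as , bs , refl = ≤-trans (s≤s (unique-⊆-length u sub))
          (≤-reflexive (sym (↭-length (shift x as bs))))
    where
    sub : xs ⊆ as ++ bs
    sub v with ∈-resp-↭ (shift x as bs) (s (there v))
    ... | here refl = contradiction v (All≢⇒∉ p)
    ... | there w   = w

  unique-↭ : ∀ {xs ys : List A} → Unique xs → Unique ys → xs ⊆ ys → ys ⊆ xs → xs ↭ ys
  unique-↭ {[]} {[]} u v s t = ↭-refl
  unique-↭ {[]} {y ∷ ys} u v s t = contradiction (t (here refl)) λ ()
  unique-↭ {x ∷ xs} {ys} (p ∷ u) v s t with ∈-∃++ (s (here refl))
  ... | as , bs , refl = ↭-trans (prep x (unique-↭ u (AllPairs.tail v′) s′ t′)) (↭-sym σ)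
    where
    σ : as ++ [ x ] ++ bs ↭ x ∷ as ++ bs
    σ = shift x as bs
    v′ : Unique (x ∷ as ++ bs)
    v′ = Unique-resp-↭ σ v
    s′ : xs ⊆ as ++ bs
    s′ w with ∈-resp-↭ σ (s (there w))
    ... | here refl = contradiction w (All≢⇒∉ p)
    ... | there w′  = w′
    t′ : as ++ bs ⊆ xs
    t′ w with t (∈-resp-↭ (↭-sym σ) (there w))
    ... | here refl = contradiction w (All≢⇒∉ (AllPairs.head v′))
    ... | there w′  = w′

module _ {N : ℕ} where

  open DecMembership (_≟_ {N}) using (_∈?_)

  infixl 6 _∖_

  abstract

    _∖_ : List (Fin N) → List (Fin N) → List (Fin N)
    xs ∖ us = filter (λ x → ¬? (x ∈? us)) xs

    ∖-unique : ∀ {xs} us → Unique xs → Unique (xs ∖ us)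
    ∖-unique us = UP.filter⁺ (λ x → ¬? (x ∈? us))

    ∖-⊆ : ∀ xs us → xs ∖ us ⊆ xs
    ∖-⊆ xs us = filter-⊆ (λ x → ¬? (x ∈? us)) xs

    ∖-∉ : ∀ xs us {x} → x ∈ xs ∖ us → x ∉ us
    ∖-∉ xs us v = proj₂ (∈-filter⁻ (λ x → ¬? (x ∈? us)) {xs = xs} v)

    ∈-∖ : ∀ {xs} us {x} → x ∈ xs → x ∉ us → x ∈ xs ∖ us
    ∈-∖ us p q = ∈-filter⁺ (λ x → ¬? (x ∈? us)) p q

    ∖-length : ∀ {xs} us → Unique xs → length xs ≤ length us + length (xs ∖ us)
    ∖-length {xs} us u = ≤-trans (unique-⊆-length u sub) (≤-reflexive (length-++ us))
      where
      sub : xs ⊆ us ++ (xs ∖ us)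
      sub {x} v with x ∈? us
      ... | yes w = ∈-++⁺ˡ w
      ... | no w  = ∈-++⁺ʳ us (∈-∖ us v w)

    ∖-split : ∀ {xs us} → Unique xs → Unique us → us ⊆ xs → xs ↭ us ++ (xs ∖ us)
    ∖-split {xs} {us} u v s =
      unique-↭ u (++-unique v (∖-unique us u) λ p q → ∖-∉ xs us q p) sub (++-⊆ s (∖-⊆ xs us))
      where
      sub : xs ⊆ us ++ (xs ∖ us)
      sub {x} p with x ∈? us
      ... | yes q = ∈-++⁺ˡ q
      ... | no q  = ∈-++⁺ʳ us (∈-∖ us p q)

    ∖-large : ∀ {xs} us {m n} → Unique xs → length us ≤ n → m + n ≤ length xs → m ≤ length (xs ∖ us)
    ∖-large {xs} us {m} {n} u p q = +-cancelˡ-≤ n m _ (begin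
      n + m                         ≡⟨ +-comm n m ⟩
      m + n                         ≤⟨ q ⟩
      length xs                     ≤⟨ ∖-length us u ⟩
      length us + length (xs ∖ us)  ≤⟨ +-monoˡ-≤ _ p ⟩
      n + length (xs ∖ us)          ∎)
      where open ≤-Reasoning

-- Cliques, Ramsey's theorem and neighbourhoods.

module Cliques {N : ℕ} (c : Colouring N) where

  joined? : ∀ b x y → Dec (Joined c b x y)
  joined? b x y = ¬? (x ≟ y) ×-dec (colour c x y ≟ b)

  joined-comm : ∀ {b x y} → Joined c b x y → Joined c b y x
  joined-comm = joined-sym c

  other-colour : ∀ {b d x y} → b ≢ d → x ≢ y → ¬ Joined c d x y → Joined c b x y
  other-colour {b} {d} {x} {y} b≢d x≢y n = x≢y , lemma b d (colour c x y) b≢d (λ e → n (x≢y , e))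
    where
    lemma : ∀ (b d e : Fin 2) → b ≢ d → e ≢ d → e ≡ b
    lemma zero       _          zero       _ _ = refl
    lemma (suc zero) _          (suc zero) _ _ = refl
    lemma zero       zero       (suc zero) p _ = contradiction refl p
    lemma zero       (suc zero) (suc zero) _ q = contradiction refl q
    lemma (suc zero) zero       zero       _ q = contradiction refl q
    lemma (suc zero) (suc zero) zero       p _ = contradiction refl p

  IsClique : Fin 2 → ℕ → List (Fin N) → Set
  IsClique b s ys = length ys ≡ s × AllPairs (Joined c b) ys

  NoClique : Fin 2 → ℕ → List (Fin N) → Set
  NoClique b s xs = ∀ {ys} → IsClique b s ys → ys ⊆ xs → ⊥

  -- The form in which Ramsey's theorem is applied: by `noClique⇒rich`, a set without `d`-cliques of
  -- size `k` has this property for the other colour with `θ = 2 ^ (s + k)`. Being hereditary, it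
  -- yields cliques that avoid vertices already in use.
  Rich : Fin 2 → ℕ → ℕ → List (Fin N) → Set
  Rich b s θ xs = ∀ {zs} → Unique zs → zs ⊆ xs → θ ≤ length zs → ∃[ ys ] IsClique b s ys × ys ⊆ zs

  Complete : Fin 2 → List (Fin N) → Set
  Complete b xs = ∀ {x y} → x ∈ xs → y ∈ xs → x ≢ y → Joined c b x y

  clique-unique : ∀ {b s ys} → IsClique b s ys → Unique ys
  clique-unique (_ , js) = AllPairs.map proj₁ js

  clique⇒complete : ∀ {b ys} → AllPairs (Joined c b) ys → Complete b ys
  clique⇒complete (p ∷ js) (here refl) (here refl) n = contradiction refl n
  clique⇒complete (p ∷ js) (here refl) (there w) n = All.lookup p w
  clique⇒complete (p ∷ js) (there v) (here refl) n = joined-comm (All.lookup p v)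
  clique⇒complete (p ∷ js) (there v) (there w) n = clique⇒complete js v w n

  complete⇒clique : ∀ {b xs ys} → Complete b xs → Unique ys → ys ⊆ xs → AllPairs (Joined c b) ys
  complete⇒clique {ys = []} k u s = []
  complete⇒clique {ys = y ∷ ys} k (p ∷ u) s =
    All.tabulate (λ v → k (s (here refl)) (s (there v)) (All.lookup p v)) ∷
    complete⇒clique k u (λ v → s (there v))

  ∷-clique : ∀ {b s x ys} → IsClique b s ys → (∀ {y} → y ∈ ys → Joined c b x y) → IsClique b (suc s) (x ∷ ys)
  ∷-clique (l , js) h = cong suc l , All.tabulate h ∷ js

  take-clique : ∀ {b s ys} r → r ≤ s → IsClique b s ys → IsClique b r (take r ys)
  take-clique r le (refl , js) = length-take-≤ r le , APP.take⁺ r js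

  clique-of : ∀ {b xs ys} s → Complete b xs → Unique ys → ys ⊆ xs → s ≤ length ys → IsClique b s (take s ys)
  clique-of s k u sub le = take-clique s le (refl , complete⇒clique k u sub)

  clique-↭ : ∀ {b s xs ys} → xs ↭ ys → IsClique b s xs → IsClique b s ys
  clique-↭ σ (l , js) = trans (sym (↭-length σ)) l , AllPairs-resp-↭ joined-comm σ js

  NoClique-⊆ : ∀ {b s xs ys} → ys ⊆ xs → NoClique b s xs → NoClique b s ys
  NoClique-⊆ sub n q t = n q λ v → sub (t v)

  Rich-⊆ : ∀ {b s θ xs ys} → ys ⊆ xs → Rich b s θ xs → Rich b s θ ys
  Rich-⊆ sub r u t = r u λ v → sub (t v)

  ramsey : ∀ {b d} → b ≢ d → ∀ s k {xs} → Unique xs → 2 ^ (s + k) ≤ length xs →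
           (∃[ ys ] IsClique b s ys × ys ⊆ xs) ⊎ (∃[ ys ] IsClique d k ys × ys ⊆ xs)
  ramsey {zero} {zero} b≢d _ _ _ _ = contradiction refl b≢d
  ramsey {suc zero} {suc zero} b≢d _ _ _ _ = contradiction refl b≢d
  ramsey {zero} {suc zero} _ s k {xs} u le with findClique c s k {_∈ xs} xs u (All.tabulate id) le
  ... | inj₁ (ys , l , js , m) = inj₁ (ys , (l , js) , All.lookup m)
  ... | inj₂ (ys , l , js , m) = inj₂ (ys , (l , js) , All.lookup m)
  ramsey {suc zero} {zero} _ s k {xs} u le
    with findClique c k s {_∈ xs} xs u (All.tabulate id) (subst (λ e → 2 ^ e ≤ length xs) (+-comm s k) le)
  ... | inj₁ (ys , l , js , m) = inj₂ (ys , (l , js) , All.lookup m)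
  ... | inj₂ (ys , l , js , m) = inj₁ (ys , (l , js) , All.lookup m)

  noClique⇒rich : ∀ {b d} → b ≢ d → ∀ {s k θ xs} → NoClique d k xs → 2 ^ (s + k) ≤ θ → Rich b s θ xs
  noClique⇒rich b≢d {s} {k} n le u sub le′ with ramsey b≢d s k u (≤-trans le le′)
  ... | inj₁ r = r
  ... | inj₂ (ys , q , t) = contradiction (λ {x} v → sub (t {x} v)) (n q)

  grab : ∀ {b s θ xs} → Rich b s θ xs → Unique xs → ∀ us {m} → length us ≤ m → θ + m ≤ length xs →
         ∃[ ys ] IsClique b s ys × ys ⊆ xs × (∀ {x} → x ∈ ys → x ∉ us)
  grab {xs = xs} r u us le le′ with r (∖-unique us u) (∖-⊆ xs us) (∖-large us u le le′)
  ... | ys , q , sub = ys , q , (λ v → ∖-⊆ xs us (sub v)) , λ v → ∖-∉ xs us (sub v)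

  abstract

    nbrs : Fin 2 → Fin N → List (Fin N) → List (Fin N)
    nbrs b x xs = filter (joined? b x) xs

    nbrs-⊆ : ∀ b x xs → nbrs b x xs ⊆ xs
    nbrs-⊆ b x xs = filter-⊆ (joined? b x) xs

    nbrs-joined : ∀ {b x xs y} → y ∈ nbrs b x xs → Joined c b x y
    nbrs-joined {b} {x} {xs} v = proj₂ (∈-filter⁻ (joined? b x) {xs = xs} v)

    ∈-nbrs : ∀ {b x xs y} → y ∈ xs → Joined c b x y → y ∈ nbrs b x xs
    ∈-nbrs {b} {x} = ∈-filter⁺ (joined? b x)

    nbrs-unique : ∀ b x {xs} → Unique xs → Unique (nbrs b x xs)
    nbrs-unique b x = UP.filter⁺ (joined? b x)

    ∉nbrs⇒joined : ∀ {b d} → b ≢ d → ∀ {x xs y} → y ∈ xs → y ∉ nbrs d x xs → x ≢ y → Joined c b x y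
    ∉nbrs⇒joined b≢d v n x≢y = other-colour b≢d x≢y λ j → n (∈-nbrs v j)

    allNbrs : Fin 2 → List (Fin N) → List (Fin N) → List (Fin N)
    allNbrs b ys xs = concatMap (λ y → nbrs b y xs) ys

    allNbrs-length : ∀ {b xs t} ys → (∀ {y} → y ∈ ys → length (nbrs b y xs) ≤ t) →
                     length (allNbrs b ys xs) ≤ length ys * t
    allNbrs-length [] h = z≤n
    allNbrs-length {b} {xs} (y ∷ ys) h =
      ≤-trans (≤-reflexive (length-++ (nbrs b y xs))) (h (here refl) ⊕ allNbrs-length {b} {xs} ys λ v → h (there v))

    ∉allNbrs⇒joined : ∀ {b d} → b ≢ d → ∀ {xs ys x y} → x ∈ xs → x ∉ allNbrs d ys xs → y ∈ ys → y ≢ x → Joined c b y x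
    ∉allNbrs⇒joined {d = d} b≢d {xs} v n w = ∉nbrs⇒joined b≢d v
      λ p → n (∈-concat⁺′ p (∈-map⁺ (λ y → nbrs d y xs) w))

    -- Here `d` is the colour that is excluded: the vertices that remain are joined to all of `ys`
    -- in the other colour. Each vertex of `ys` excludes itself and its `d`-neighbours, whence
    -- `suc t` in `commons-large`.
    commons : Fin 2 → List (Fin N) → List (Fin N) → List (Fin N)
    commons d ys xs = xs ∖ (ys ++ allNbrs d ys xs)

    commons-⊆ : ∀ d ys xs → commons d ys xs ⊆ xs
    commons-⊆ d ys xs = ∖-⊆ xs (ys ++ allNbrs d ys xs)

    commons-unique : ∀ d ys {xs} → Unique xs → Unique (commons d ys xs)
    commons-unique d ys {xs} = ∖-unique (ys ++ allNbrs d ys xs)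

    commons-joined : ∀ {b d} → b ≢ d → ∀ {ys xs x y} → x ∈ commons d ys xs → y ∈ ys → Joined c b y x
    commons-joined {d = d} b≢d {ys} {xs} v w =
      ∉allNbrs⇒joined b≢d (∖-⊆ xs (ys ++ allNbrs d ys xs) v)
        (λ p → ∖-∉ xs (ys ++ allNbrs d ys xs) v (∈-++⁺ʳ ys p)) w
        λ { refl → ∖-∉ xs (ys ++ allNbrs d ys xs) v (∈-++⁺ˡ w) }

    commons-large : ∀ {d} ys {xs t m} → Unique xs → (∀ {y} → y ∈ ys → length (nbrs d y xs) ≤ t) →
                    m + length ys * suc t ≤ length xs → m ≤ length (commons d ys xs)
    commons-large {d} ys {xs} {t} u h le = ∖-large (ys ++ allNbrs d ys xs) u (begin
      length (ys ++ allNbrs d ys xs)          ≡⟨ length-++ ys ⟩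
      length ys + length (allNbrs d ys xs)    ≤⟨ +-monoʳ-≤ (length ys) (allNbrs-length {d} {xs} ys h) ⟩
      length ys + length ys * t               ≡⟨ *-suc (length ys) t ⟨
      length ys * suc t                       ∎) le
      where open ≤-Reasoning

  join-cliques : ∀ {b r s ys zs} → IsClique b r ys → IsClique b s zs →
                 (∀ {y z} → y ∈ ys → z ∈ zs → Joined c b y z) → IsClique b (r + s) (ys ++ zs)
  join-cliques {ys = ys} (p , js) (q , ks) h = trans (length-++ ys) (cong₂ _+_ p q) ,
    APP.++⁺ js ks (All.tabulate λ v → All.tabulate λ w → h v w)

quotient-≤ : ∀ i {m n} → n * suc i ≤ m * suc i + i → n ≤ m
quotient-≤ i {m} {n} le = ≮⇒≥ λ m<n → 1+n≰n (≤-trans (≤-reflexive (cong suc (+-comm (m * suc i) i)))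
  (≤-trans (*-monoˡ-≤ (suc i) m<n) le))

-- Disjoint cliques: tilings and packings.

module Tilings {N : ℕ} (c : Colouring N) where

  open Cliques c

  Tiled : Fin 2 → ℕ → List (Fin N) → Set
  Tiled b j xs = ∃[ tss ] All (IsClique b j) tss × concat tss ↭ xs

  tiled-[] : ∀ {b j} → Tiled b j []
  tiled-[] = [] , [] , ↭-refl

  tiled-clique : ∀ {b j ys} → IsClique b j ys → Tiled b j ys
  tiled-clique {ys = ys} q = [ ys ] , q ∷ [] , ↭-reflexive (++-identityʳ ys)

  tiled-++ : ∀ {b j xs ys} → Tiled b j xs → Tiled b j ys → Tiled b j (xs ++ ys)
  tiled-++ (ss , ps , σ) (ts , qs , ρ) = ss ++ ts , AllP.++⁺ ps qs ,
    ↭-trans (↭-reflexive (sym (concat-++ ss ts))) (↭-++⁺ σ ρ)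

  tiled-↭ : ∀ {b j xs ys} → xs ↭ ys → Tiled b j xs → Tiled b j ys
  tiled-↭ σ (ts , qs , ρ) = ts , qs , ↭-trans ρ σ

  concat-length : ∀ {b j} tss → All (IsClique b j) tss → length (concat tss) ≡ length tss * j
  concat-length [] [] = refl
  concat-length (ts ∷ tss) ((l , _) ∷ qs) =
    trans (length-++ ts) (cong₂ _+_ l (concat-length tss qs))

  -- `size` counts vertices instead of tiles, so packings add up without reference to their lists of
  -- tiles; for positive `j` it determines the number of tiles.
  record Packing (b : Fin 2) (j n : ℕ) (xs : List (Fin N)) : Set where
    constructor packing
    field
      {tiles} : List (Fin N)
      tiled   : Tiled b j tiles
      unique  : Unique tiles
      inside  : tiles ⊆ xs
      size    : length tiles ≡ n * j

  open Packing public

  pack-⊆ : ∀ {b j n xs ys} → xs ⊆ ys → Packing b j n xs → Packing b j n ys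
  pack-⊆ sub p = packing (tiled p) (unique p) (λ v → sub (inside p v)) (size p)

  pack-++ : ∀ {b j m n zs} (p : Packing b j m zs) (q : Packing b j n zs) →
            (∀ {x} → x ∈ tiles p → x ∉ tiles q) → Packing b j (m + n) zs
  pack-++ {j = j} {m} {n} p q d = packing (tiled-++ (tiled p) (tiled q))
    (++-unique (unique p) (unique q) d) (++-⊆ (inside p) (inside q))
    (trans (length-++ (tiles p)) (trans (cong₂ _+_ (size p) (size q)) (sym (*-distribʳ-+ j m n))))

  pack-join : ∀ {b j m n xs zs} → zs ⊆ xs → Packing b j m zs → Packing b j n (xs ∖ zs) → Packing b j (m + n) xs
  pack-join {xs = xs} {zs} sub p q = pack-++ (pack-⊆ sub p) (pack-⊆ (∖-⊆ xs zs) q)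
    λ v w → ∖-∉ xs zs (inside q w) (inside p v)

  pack-0 : ∀ {b j xs} → Packing b j 0 xs
  pack-0 = packing tiled-[] [] []-⊆ refl

  pack-tiles : ∀ {b j n xs tss} → length tss ≡ n → All (IsClique b j) tss → Unique (concat tss) →
               concat tss ⊆ xs → Packing b j n xs
  pack-tiles {tss = tss} refl qs u sub = packing (tss , qs , ↭-refl) u sub (concat-length tss qs)

  concat-take-⊆ : ∀ n (tss : List (List (Fin N))) → concat (take n tss) ⊆ concat tss
  concat-take-⊆ n tss {x} v with ∈-concat⁻′ (take n tss) v
  ... | ts , p , q = ∈-concat⁺′ p (take-⊆ n {tss} q)

  concat-take-unique : ∀ n (tss : List (List (Fin N))) → Unique (concat tss) → Unique (concat (take n tss))
  concat-take-unique n tss u = proj₁ (unique-++⁻ (concat (take n tss))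
    (subst Unique (trans (cong concat (sym (take++drop≡id n tss))) (sym (concat-++ (take n tss) (drop n tss)))) u))

  pack-from : ∀ {b j n xs ys} → Tiled b (suc j) ys → Unique ys → ys ⊆ xs → n * suc j ≤ length ys →
              Packing b (suc j) n xs
  pack-from {j = j} {n} {xs} (tss , qs , σ) u sub le =
    pack-tiles (length-take-≤ n {tss} n≤) (AllP.take⁺ n qs)
      (concat-take-unique n tss (Unique-resp-↭ (↭-sym σ) u))
      λ v → sub (∈-resp-↭ σ (concat-take-⊆ n tss v))
    where
    n≤ : n ≤ length tss
    n≤ = *-cancelʳ-≤ n (length tss) (suc j)
      (≤-trans le (≤-reflexive (trans (sym (↭-length σ)) (concat-length tss qs))))

  Rich-mono : ∀ {b s θ θ′ xs} → θ ≤ θ′ → Rich b s θ xs → Rich b s θ′ xs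
  Rich-mono le r u sub le′ = r u sub (≤-trans le le′)

  -- The size bound on the pool is only fuel: every tile removed shrinks it.
  greedy-fuel : ∀ {b j θ} m {xs} → length xs ≤ m → Rich b (suc j) (suc θ) xs → Unique xs →
                ∃[ ys ] ∃[ us ] Tiled b (suc j) ys × xs ↭ ys ++ us × length us ≤ θ
  greedy-fuel zero {[]} le r u = [] , [] , tiled-[] , ↭-refl , z≤n
  greedy-fuel {b} {j} {θ} (suc m) {xs} le r u with suc θ ≤? length xs
  ... | no θ≰ = [] , xs , tiled-[] , ↭-refl , ≮⇒≥ θ≰
  ... | yes θ≤ with r u id θ≤
  ...   | ys , q , sub with greedy-fuel m smaller (Rich-⊆ (∖-⊆ xs ys) r) (∖-unique ys u)
    where
    total : length xs ≡ suc j + length (xs ∖ ys)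
    total = trans (↭-length (∖-split u (clique-unique q) sub))
              (trans (length-++ ys) (cong (_+ length (xs ∖ ys)) (proj₁ q)))
    eq : ∀ j m z → z + suc m + j ≡ m + suc (j + z)
    eq = solve-∀
    smaller : length (xs ∖ ys) ≤ m
    smaller = lin j (≤-trans (≤-reflexive (sym total)) le) (eq j m _)
  ...     | zs , us , t , ρ , le′ = ys ++ zs , us , tiled-++ (tiled-clique q) t ,
    ↭-trans (∖-split u (clique-unique q) sub)
      (↭-trans (↭-++⁺ˡ ys ρ) (↭-reflexive (sym (++-assoc ys zs us)))) , le′

  greedy : ∀ {b j θ xs} → Rich b (suc j) (suc θ) xs → Unique xs →
           ∃[ ys ] ∃[ us ] Tiled b (suc j) ys × xs ↭ ys ++ us × length us ≤ θ
  greedy = greedy-fuel _ ≤-refl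

  pack-greedy : ∀ {b j θ n xs} → Rich b (suc j) θ xs → Unique xs → n * suc j + θ ≤ length xs →
                Packing b (suc j) n xs
  pack-greedy {b} {j} {θ} {n} {xs} r u le with greedy (Rich-mono (n≤1+n θ) r) u
  ... | ys , us , t , σ , l = pack-from t (proj₁ (unique-++⁻ ys (Unique-resp-↭ σ u)))
    (λ v → ∈-resp-↭ (↭-sym σ) (∈-++⁺ˡ v)) (+-cancelʳ-≤ θ _ _ (begin
      n * suc j + θ          ≤⟨ le ⟩
      length xs              ≡⟨ ↭-length σ ⟩
      length (ys ++ us)      ≡⟨ length-++ ys ⟩
      length ys + length us  ≤⟨ +-monoʳ-≤ (length ys) l ⟩
      length ys + θ          ∎))
    where open ≤-Reasoning

  pack-clique : ∀ {b k ys xs} → IsClique b k ys → ys ⊆ xs → Packing b k 1 xs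
  pack-clique {k = k} q sub = packing (tiled-clique q) (clique-unique q) sub (trans (proj₁ q) (sym (*-identityˡ k)))

  -- The length of a tiled set is a multiple of `suc i`, so a deficit smaller than one tile is none.
  -- This removes the vertices lost to divisibility from the exact counts.
  tiled-whole : ∀ {b i n T} → Tiled b (suc i) T → n * suc i ≤ length T + i → n * suc i ≤ length T
  tiled-whole {i = i} {n} {T} (tss , qs , ρ) le =
    subst (n * suc i ≤_) (sym len) (*-monoˡ-≤ (suc i) (quotient-≤ i {length tss} {n}
        (subst (λ l → n * suc i ≤ l + i) len le)))
    where
    len : length T ≡ length tss * suc i
    len = trans (sym (↭-length ρ)) (concat-length tss qs)

  -- Cliques are removed until none is left, which happens before the `n`-th. Instead of deciding
  -- whether a further clique exists, the current set is passed to the continuation, and the clique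
  -- that would refute it triggers the next removal.
  extract : ∀ {k} b n {ys} → Unique ys → ¬ Packing b k n ys →
            (∀ {zs} → Unique zs → zs ⊆ ys → NoClique b k zs → length ys ≤ length zs + n * k → ⊥) → ⊥
  extract b zero u none κ = none pack-0
  extract {k} b (suc n) {ys} u none κ = κ u id no-clique (m≤m+n (length ys) _)
    where
    no-clique : NoClique b k ys
    no-clique {ts} q sub = extract b n (∖-unique ts u)
      (λ p → none (pack-join {m = 1} sub (pack-clique q id) p))
      λ {zs} uz zs⊆ free le → κ uz (λ v → ∖-⊆ ys ts (zs⊆ v)) free (≤-trans (∖-length ts u)
        (lin 0 (≤-reflexive (proj₁ q) ⊕ le) (eq (length ts) (length (ys ∖ ts)) (length zs) k (n * k))))
      where
      eq : ∀ a b z k x → a + b + (k + (z + x)) + 0 ≡ z + (k + x) + (a + b)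
      eq = solve-∀

-- Gadgets.

Disj : ∀ {A : Set} → List A → List A → Set
Disj xs ys = ∀ {x} → x ∈ xs → x ∉ ys

module _ {A : Set} where

  disj-∷ˡ : ∀ {x} {xs ys : List A} → x ∉ ys → Disj xs ys → Disj (x ∷ xs) ys
  disj-∷ˡ p d (here refl) = p
  disj-∷ˡ p d (there v)   = d v

  disj-sym : ∀ {xs ys : List A} → Disj xs ys → Disj ys xs
  disj-sym d v w = d w v

  disj-⊆ : ∀ {xs xs′ ys ys′ : List A} → xs′ ⊆ xs → ys′ ⊆ ys → Disj xs ys → Disj xs′ ys′
  disj-⊆ s t d v w = d (s v) (t w)

module Gadgets {N : ℕ} (c : Colouring N) where

  open Cliques c
  open Tilings c

  both : ∀ {b d k n xs} → b ≢ d → Packing b k n xs → Packing d k n xs → ∀ b′ → Packing b′ k n xs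
  both {zero}     {zero}     b≢d p q _          = contradiction refl b≢d
  both {suc zero} {suc zero} b≢d p q _          = contradiction refl b≢d
  both {zero}     {suc zero} b≢d p q zero       = p
  both {zero}     {suc zero} b≢d p q (suc zero) = q
  both {suc zero} {zero}     b≢d p q zero       = q
  both {suc zero} {zero}     b≢d p q (suc zero) = p

  -- The last field says that the support has at most (2 k − 1) s − gain vertices, stated without subtraction.
  record Gadget (k s gain : ℕ) (xs : List (Fin N)) : Set where
    constructor gadget
    field
      {support} : List (Fin N)
      support-⊆ : support ⊆ xs
      packs     : ∀ b → Packing b k s support
      economy   : length support + (gain + s) ≤ 2 * k * s

  pack₂ : ∀ {b k rs ss xs} → IsClique b k rs → IsClique b k ss → Disj rs ss →
          rs ⊆ xs → ss ⊆ xs → Packing b k 2 xs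
  pack₂ p q d s t = pack-++ (pack-clique p s) (pack-clique q t) d

  pack₃ : ∀ {b k qs rs ss xs} → IsClique b k qs → IsClique b k rs → IsClique b k ss →
          Disj qs rs → Disj qs ss → Disj rs ss → qs ⊆ xs → rs ⊆ xs → ss ⊆ xs → Packing b k 3 xs
  pack₃ p q r d e f s t u = pack-++ (pack-clique p s) (pack₂ q r f t u)
    λ v w → [ d v , e v ]′ (∈-++⁻ _ w)

  -- The shared vertex `v` leaves exactly `2 k − 1` vertices, so the gain is 0. Such a gadget
  -- preserves a surplus that is already there.
  bowtie : ∀ {b d h v ys zs xs} → b ≢ d → IsClique b (suc h) (v ∷ ys) → IsClique d (suc h) (v ∷ zs) →
           v ∷ ys ⊆ xs → zs ⊆ xs → Gadget (suc h) 1 0 xs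
  bowtie {h = h} {v} {ys} {zs} b≢d p q s t = gadget {support = v ∷ ys ++ zs}
    (++-⊆ {xs = v ∷ ys} s t)
    (both b≢d (pack-clique p ⊆-++ˡ) (pack-clique q (∷-⊆ (here refl) (⊆-++ʳ (v ∷ ys)))))
    (≤-reflexive (trans (cong (_+ 1) (trans (cong suc (length-++ ys))
      (cong₂ (λ l m → suc (l + m)) (suc-injective (proj₁ p)) (suc-injective (proj₁ q))))) (eq h)))
    where
    eq : ∀ h → suc (h + h) + 1 ≡ 2 * suc h * 1
    eq = solve-∀

  -- The cliques of different colours share v₁, v₂ and a, which leaves 4 k − 3 vertices.
  gadget₂ : ∀ {b d h v₁ v₂ a vs rs ss ts xs} → b ≢ d →
    IsClique b (2 + h) (v₁ ∷ v₂ ∷ vs) → IsClique d (2 + h) (v₁ ∷ a ∷ rs) →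
    IsClique d (2 + h) (v₂ ∷ ss) → IsClique b (2 + h) (a ∷ ts) →
    Disj (v₁ ∷ v₂ ∷ vs) (a ∷ ts) → Disj (v₁ ∷ a ∷ rs) (v₂ ∷ ss) →
    v₁ ∷ v₂ ∷ vs ⊆ xs → a ∷ rs ⊆ xs → ss ⊆ xs → ts ⊆ xs → Gadget (2 + h) 2 1 xs
  gadget₂ {b} {d} {h} {v₁} {v₂} {a} {vs} {rs} {ss} {ts} b≢d p q r s dᵇ e i₁ i₂ i₃ i₄ =
    gadget {support = V ++ R ++ ss ++ ts}
      (++-⊆ {xs = V} i₁ (++-⊆ {xs = R} i₂ (++-⊆ {xs = ss} i₃ i₄)))
      (both b≢d (pack₂ p s dᵇ ⊆-++ˡ (∷-⊆ (inR (here refl)) λ v → inRest (∈-++⁺ʳ R (∈-++⁺ʳ ss v))))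
            (pack₂ q r e (∷-⊆ (here refl) inR) (∷-⊆ (there (here refl)) λ v → inRest (∈-++⁺ʳ R (∈-++⁺ˡ v)))))
      (≤-reflexive (trans (cong (_+ 3) len) (eq h)))
    where
    V R : List (Fin N)
    V = v₁ ∷ v₂ ∷ vs
    R = a ∷ rs
    inRest : ∀ {x} → x ∈ R ++ ss ++ ts → x ∈ V ++ R ++ ss ++ ts
    inRest = ∈-++⁺ʳ V
    inR : R ⊆ V ++ R ++ ss ++ ts
    inR v = inRest (∈-++⁺ˡ v)
    len : length (V ++ R ++ ss ++ ts) ≡ (2 + h) + ((1 + h) + ((1 + h) + (1 + h)))
    len = trans (length-++ V) (cong₂ _+_ (proj₁ p) (trans (length-++ R)
      (cong₂ _+_ (suc-injective (proj₁ q)) (trans (length-++ ss)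
        (cong₂ _+_ (suc-injective (proj₁ r)) (suc-injective (proj₁ s)))))))
    eq : ∀ h → (2 + h) + ((1 + h) + ((1 + h) + (1 + h))) + 3 ≡ 2 * (2 + h) * 2
    eq = solve-∀

  record Star (b : Fin 2) (s : ℕ) (y : Fin N) (xs us : List (Fin N)) : Set where
    field
      {leaves} : List (Fin N)
      isClique : IsClique b s leaves
      leaves-⊆ : leaves ⊆ xs
      avoids   : Disj leaves us
      centre   : ∀ {x} → x ∈ leaves → Joined c b y x

    centred : IsClique b (suc s) (y ∷ leaves)
    centred = ∷-clique isClique centre

  open Star public

  star : ∀ {b s θ xs m} y us → Rich b s θ xs → Unique xs → length us ≤ m → θ + m ≤ length (nbrs b y xs) →
         Star b s y xs us
  star {b} {xs = xs} y us r u le le′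
    with grab (Rich-⊆ (nbrs-⊆ b y xs) r) (nbrs-unique b y u) us le le′
  ... | ys , q , sub , d = record
    { isClique = q ; leaves-⊆ = λ v → nbrs-⊆ b y xs (sub v) ; avoids = d ; centre = λ v → nbrs-joined {b} {y}
        {xs} (sub v) }

  private
    -- One colour of `gadget₃`: a clique and two stars whose centres belong to the clique of the
    -- other colour.
    stars-pack : ∀ {b h y₁ y₂ xs as zs us} → IsClique b (2 + h) xs → y₁ ≢ y₂ → y₁ ∉ xs → y₂ ∉ xs →
      xs ⊆ us → y₁ ∈ us → y₂ ∈ us → (S : Star b (1 + h) y₁ as us) (T : Star b (1 + h) y₂ as us) →
      Disj (leaves S) (leaves T) → xs ⊆ zs → y₁ ∷ leaves S ⊆ zs → y₂ ∷ leaves T ⊆ zs → Packing b (2 + h) 3 zs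
    stars-pack q y₁≢y₂ n₁ n₂ sub e₁ e₂ S T d =
      pack₃ q (centred S) (centred T)
        (disj-sym (disj-∷ˡ n₁ λ v w → avoids S v (sub w)))
        (disj-sym (disj-∷ˡ n₂ λ v w → avoids T v (sub w)))
        (disj-∷ˡ (λ { (here e) → y₁≢y₂ e ; (there w) → avoids T w e₁ })
          (disj-sym (disj-∷ˡ (λ w → avoids S w e₂) (disj-sym d))))

  -- The cliques of different colours share x₁, x₂, y₁ and y₂, which leaves 6 k − 4 vertices.
  gadget₃ : ∀ {b d h x₁ x₂ y₁ y₂ xs ys as bs zs us} → b ≢ d →
    let X = x₁ ∷ x₂ ∷ xs ; Y = y₁ ∷ y₂ ∷ ys in
    IsClique b (2 + h) X → IsClique d (2 + h) Y → Disj X Y → X ⊆ us → Y ⊆ us →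
    (S₁ : Star b (1 + h) y₁ as us) (S₂ : Star b (1 + h) y₂ as us) → Disj (leaves S₁) (leaves S₂) →
    (T₁ : Star d (1 + h) x₁ bs us) (T₂ : Star d (1 + h) x₂ bs us) →
    Disj (leaves T₁) (leaves T₂) →
    X ⊆ zs → Y ⊆ zs → as ⊆ zs → bs ⊆ zs → Gadget (2 + h) 3 1 zs
  gadget₃ {b} {d} {h} {x₁} {x₂} {y₁} {y₂} {xs} {ys} b≢d p q e iX iY S₁ S₂ dS T₁ T₂ dT sX sY sA sB =
    gadget {support = X ++ Y ++ s₁ ++ s₂ ++ t₁ ++ t₂}
      (++-⊆ {xs = X} sX (++-⊆ {xs = Y} sY (++-⊆ {xs = s₁} (λ v → sA (leaves-⊆ S₁ v))
        (++-⊆ {xs = s₂} (λ v → sA (leaves-⊆ S₂ v)) (++-⊆ {xs = t₁} (λ v → sB (leaves-⊆ T₁ v))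
            (λ v → sB (leaves-⊆ T₂ v)))))))
      (both b≢d
        (stars-pack p (distinct q) (disj-sym e (here refl)) (disj-sym e (there (here refl)))
          iX (iY (here refl)) (iY (there (here refl))) S₁ S₂ dS ⊆-++ˡ
          (∷-⊆ (in₁ (here refl)) λ v → in₂ (∈-++⁺ˡ v))
          (∷-⊆ (in₁ (there (here refl))) λ v → in₂ (∈-++⁺ʳ s₁ (∈-++⁺ˡ v))))
        (stars-pack q (distinct p) (e (here refl)) (e (there (here refl)))
          iY (iX (here refl)) (iX (there (here refl))) T₁ T₂ dT in₁
          (∷-⊆ (here refl) λ v → in₂ (∈-++⁺ʳ s₁ (∈-++⁺ʳ s₂ (∈-++⁺ˡ v))))
          (∷-⊆ (there (here refl)) λ v → in₂ (∈-++⁺ʳ s₁ (∈-++⁺ʳ s₂ (∈-++⁺ʳ t₁ v))))))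
      (≤-reflexive (trans (cong (_+ 4) len) (eq h)))
    where
    X Y s₁ s₂ t₁ t₂ : List (Fin N)
    X = x₁ ∷ x₂ ∷ xs
    Y = y₁ ∷ y₂ ∷ ys
    s₁ = leaves S₁
    s₂ = leaves S₂
    t₁ = leaves T₁
    t₂ = leaves T₂
    distinct : ∀ {b s u v ws} → IsClique b s (u ∷ v ∷ ws) → u ≢ v
    distinct (_ , ((u≢v , _) ∷ _) ∷ _) = u≢v
    in₁ : Y ⊆ X ++ Y ++ s₁ ++ s₂ ++ t₁ ++ t₂
    in₁ v = ∈-++⁺ʳ X (∈-++⁺ˡ v)
    in₂ : s₁ ++ s₂ ++ t₁ ++ t₂ ⊆ X ++ Y ++ s₁ ++ s₂ ++ t₁ ++ t₂
    in₂ v = ∈-++⁺ʳ X (∈-++⁺ʳ Y v)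
    len : length (X ++ Y ++ s₁ ++ s₂ ++ t₁ ++ t₂) ≡
          (2 + h) + ((2 + h) + ((1 + h) + ((1 + h) + ((1 + h) + (1 + h)))))
    len = trans (length-++ X) (cong₂ _+_ (proj₁ p) (trans (length-++ Y) (cong₂ _+_ (proj₁ q)
      (trans (length-++ s₁) (cong₂ _+_ (proj₁ (isClique S₁)) (trans (length-++ s₂) (cong₂ _+_ (proj₁ (isClique S₂))
        (trans (length-++ t₁) (cong₂ _+_ (proj₁ (isClique T₁)) (proj₁ (isClique T₂)))))))))))
    eq : ∀ h → (2 + h) + ((2 + h) + ((1 + h) + ((1 + h) + ((1 + h) + (1 + h))))) + 4 ≡ 2 * (2 + h) * 3
    eq = solve-∀

-- Absorbers.

↭-interchange : ∀ {A : Set} (as bs cs ds : List A) → (as ++ bs) ++ (cs ++ ds) ↭ (as ++ cs) ++ (bs ++ ds)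
↭-interchange {A} = CommutativeSemigroup.interchange (CommutativeMonoid.commutativeSemigroup
    (++-commutativeMonoid {A = A}))

nonempty : ∀ {A : Set} {xs : List A} → 1 ≤ length xs → ∃[ x ] x ∈ xs
nonempty {xs = x ∷ _} _ = x , here refl

-- `few` will bound the exceptional sets `Low` and `Bad v`, `deg` and `many` are lower bounds for a
-- neighbourhood and for a common neighbourhood, and `used` bounds all the vertices that the
-- construction ever has to avoid.
module Absorbers {N : ℕ} (c : Colouring N) {b : Fin 2} {i τ : ℕ}
  {S : List (Fin N)} (S-unique : Unique S) (rich : ∀ s → s ≤ suc i → Cliques.Rich c b s τ S)
  {few deg many used : ℕ} (wide : 1 + (few + (few + few) + used) ≤ length S)
  (enough : τ + (few + used) ≤ many) (deg-enough : τ + used ≤ deg) (room : τ + (few + used) ≤ length S)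
  where

  open Cliques c
  open Tilings c

  private
    j = suc i

  Low : List (Fin N)
  Low = filter (λ y → length (nbrs b y S) <? deg) S

  Good : Fin N → Set
  Good v = deg ≤ length (nbrs b v S)

  Bad : Fin N → List (Fin N)
  Bad v = filter (λ y → length (nbrs b y (nbrs b v S)) <? many) S

  ∉Low⇒Good : ∀ {v} → v ∈ S → v ∉ Low → Good v
  ∉Low⇒Good v∈ v∉ = ≮⇒≥ λ lt → v∉ (∈-filter⁺ (λ y → length (nbrs b y S) <? deg) v∈ lt)

  ∉Bad⇒many : ∀ {v y} → y ∈ S → y ∉ Bad v → many ≤ length (nbrs b y (nbrs b v S))
  ∉Bad⇒many {v} y∈ y∉ = ≮⇒≥ λ lt → y∉ (∈-filter⁺ (λ y → length (nbrs b y (nbrs b v S)) <? many) y∈ lt)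

  module Build (low-few : length Low ≤ few) (bad-few : ∀ {v} → Good v → length (Bad v) ≤ few) where

    -- Absorbs exactly one vertex of `vs`, whichever it will be: the body is one vertex short of a
    -- multiple of `j`.
    record Connector (vs us : List (Fin N)) : Set where
      constructor connector
      field
        {body} : List (Fin N)
        unique : Unique body
        body-⊆ : body ⊆ S
        avoids : Disj body us
        accept : ∀ {v} → v ∈ vs → Tiled b j (v ∷ body)
        small  : length body ≤ length vs * (j + j)

    open Connector

    private
      link : ∀ {v y} → many ≤ length (nbrs b y (nbrs b v S)) → ∀ s → s ≤ j → ∀ us {m} → length us ≤ m → τ + m ≤ many →
             ∃[ ws ] IsClique b s ws × ws ⊆ S × Disj ws us ×
               (∀ {w} → w ∈ ws → Joined c b v w) × (∀ {w} → w ∈ ws → Joined c b y w)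
      link {v} {y} le s s≤ us l l′
        with grab (Rich-⊆ (λ z → nbrs-⊆ b v S (nbrs-⊆ b y (nbrs b v S) z)) (rich s s≤))
               (nbrs-unique b y (nbrs-unique b v S-unique)) us l (≤-trans l′ le)
      ... | ws , q , sub , d = ws , q , (λ z → nbrs-⊆ b v S (nbrs-⊆ b y (nbrs b v S) (sub z))) , d ,
        (λ z → nbrs-joined (nbrs-⊆ b y (nbrs b v S) (sub z))) , λ z → nbrs-joined (sub z)

      spent : ∀ {x l u} → x + suc (suc l) * (j + j) ≤ u → suc (i + x) ≤ u
      spent {x} {l} {u} le = lin (suc i + suc i + suc i + l * (suc i + suc i)) le (eq x l u i)
        where
        eq : ∀ x l u i → suc (i + x) + u + (suc i + suc i + suc i + l * (suc i + suc i)) ≡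
                         u + (x + suc (suc l) * (suc i + suc i))
        eq = solve-∀

      budget : ∀ {x y l} → y ≡ j + (j + x) → x + suc (suc l) * (j + j) ≤ used → y + suc l * (j + j) ≤ used
      budget {x} {_} {l} refl le = ≤-trans (≤-reflexive (eq x l i)) le
        where
        eq : ∀ x l i → (suc i + (suc i + x)) + suc l * (suc i + suc i) ≡ x + suc (suc l) * (suc i + suc i)
        eq = solve-∀

      Tiled-∷ : ∀ {s y ws zs} → IsClique b j (y ∷ ws) → Tiled b j (s ∷ zs) → Tiled b j (s ∷ y ∷ ws ++ zs)
      Tiled-∷ {s} {y} {ws} {zs} q t = tiled-↭ (shift s (y ∷ ws) zs) (tiled-++ (tiled-clique q) t)

      Tiled-swap : ∀ {s y ws zs} → IsClique b j (s ∷ ws) → Tiled b j (y ∷ zs) → Tiled b j (s ∷ y ∷ ws ++ zs)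
      Tiled-swap {s} {y} {ws} {zs} q t = tiled-↭ (prep s (shift y ws zs)) (tiled-++ (tiled-clique q) t)

    -- The hub y is linked to v and to v′, and the vertex y′ hands the task over to the rest of the list.
    connect : ∀ v vs us → (∀ {w} → w ∈ v ∷ vs → Good w) → length us + length (v ∷ vs) * (j + j) ≤ used →
              Connector (v ∷ vs) us
    connect v [] us good le
      with grab (Rich-⊆ (nbrs-⊆ b v S) (rich i (n≤1+n i))) (nbrs-unique b v S-unique) us ≤-refl
             (≤-trans (+-monoʳ-≤ τ (≤-trans (m≤m+n (length us) _) le)) (≤-trans deg-enough (good (here refl))))
    ... | ws , q , sub , d = connector (clique-unique q) (λ z → nbrs-⊆ b v S (sub z)) d
      (λ { (here refl) → tiled-clique (∷-clique q λ z → nbrs-joined (sub z)) })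
      (≤-trans (≤-reflexive (proj₁ q)) (lin (2 + i) (z≤n {0}) (eq i)))
      where
      eq : ∀ i → i + 0 + (2 + i) ≡ 1 * (suc i + suc i) + 0
      eq = solve-∀
    connect v (v′ ∷ vs) us good le
      with nonempty (∖-large (Low ++ (Bad v ++ Bad v′) ++ us) S-unique (≤-trans (≤-reflexive
             (trans (length-++ Low) (cong (length Low +_) (trans (length-++ (Bad v ++ Bad v′))
                 (cong (_+ length us) (length-++ (Bad v)))))))
             (≤-trans (low-few ⊕ (bad-few (good (here refl)) ⊕ bad-few (good (there (here refl)))) ⊕ ≤-trans
                 (m≤m+n _ _) le)
               (≤-reflexive (sym (+-assoc few (few + few) used))))) wide)
    ... | y , y∈
      with ∖-⊆ S _ y∈ | ∖-∉ S _ y∈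
    ... | y∈S | y∉
      with ∉Bad⇒many {v} y∈S (λ z → y∉ (∈-++⁺ʳ Low (∈-++⁺ˡ (∈-++⁺ˡ z))))
         | ∉Bad⇒many {v′} y∈S (λ z → y∉ (∈-++⁺ʳ Low (∈-++⁺ˡ (∈-++⁺ʳ (Bad v) z))))
    ... | manyᵥ | manyᵥ′
      with link manyᵥ i (n≤1+n i) (y ∷ us) {few + used}
             (≤-trans (≤-trans (s≤s (m≤n+m (length us) i)) (spent {length us} {length vs} le)) (m≤n+m used few))
                 enough
    ... | ws , qw , ws⊆ , wsd , vw , yw
      -- A clique of size `j`, not `i`: one vertex more than completes a tile, for `y′`. Avoiding
      -- `Low` makes `y′` good, as the recursive call requires.
      with link manyᵥ′ j ≤-refl (Low ++ ws ++ y ∷ us) {few + used}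
             (≤-trans (≤-reflexive (trans (length-++ Low) (cong (length Low +_)
               (trans (length-++ ws) (trans (cong (_+ suc (length us)) (proj₁ qw)) (+-suc i (length us)))))))
               (low-few ⊕ spent {length us} {length vs} le)) enough
    ... | y′ ∷ ws′ , qw′ , ws′⊆ , ws′d , v′w , yw′
      with connect y′ vs ((y′ ∷ ws′) ++ (y ∷ ws) ++ us)
             (λ { (here refl) → ∉Low⇒Good (ws′⊆ (here refl)) (λ z → ws′d (here refl) (∈-++⁺ˡ z))
                ; (there z) → good (there (there z)) })
             (budget {length us} {_} {length vs} (trans (length-++ (y′ ∷ ws′)) (cong₂ _+_ (proj₁ qw′)
               (trans (length-++ (y ∷ ws)) (cong (λ l → suc l + length us) (proj₁ qw))))) le)
    ... | connector {C} uC C⊆ Cd acc sm = connector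
      (++-unique {xs = y ∷ ws} (∷-unique (λ z → wsd z (here refl)) (clique-unique qw))
        (++-unique (clique-unique qw′) uC λ z z′ → Cd z′ (∈-++⁺ˡ z))
        (disj-sym λ z z′ → [ (λ p → ws′d p (∈-++⁺ʳ Low (lemma z′)))
                           , (λ p → Cd p (∈-++⁺ʳ (y′ ∷ ws′) (∈-++⁺ˡ z′))) ]′ (∈-++⁻ (y′ ∷ ws′) z)))
      (++-⊆ {xs = y ∷ ws} (∷-⊆ y∈S ws⊆) (++-⊆ {xs = y′ ∷ ws′} ws′⊆ C⊆))
      (λ z z′ → [ (λ { (here refl) → y∉ (∈-++⁺ʳ Low (∈-++⁺ʳ (Bad v ++ Bad v′) z′)) ; (there p) → wsd p (there z′) })
                , (λ w → [ (λ p → ws′d p (∈-++⁺ʳ Low (∈-++⁺ʳ ws (there z′))))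
                         , (λ p → Cd p (∈-++⁺ʳ (y′ ∷ ws′) (∈-++⁺ʳ (y ∷ ws) z′))) ]′ (∈-++⁻ (y′ ∷ ws′) w)) ]′
                (∈-++⁻ (y ∷ ws) z))
      -- Three ways to group the same body. For `v`: tiles `v ∷ ws` and `y ∷ ws′`, and `y′` goes to
      -- the rest `C`. For `v′`: tiles `y ∷ ws` and `v′ ∷ ws′`, and again `y′` goes to `C`. For a
      -- later vertex: tiles `y ∷ ws` and `y′ ∷ ws′`, and the vertex itself goes to `C`.
      (λ { (here refl) → Tiled-swap (∷-clique qw vw) (Tiled-swap
          (∷-clique (tail-clique qw′) (λ z → yw′ (there z))) (acc (here refl)))
         ; (there (here refl)) → Tiled-∷ (∷-clique qw yw) (Tiled-swap
             (∷-clique (tail-clique qw′) (λ z → v′w (there z))) (acc (here refl)))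
         ; (there (there z)) → Tiled-∷ (∷-clique qw yw) (Tiled-∷ qw′ (acc (there z))) })
      (≤-trans (≤-reflexive (trans (length-++ (y ∷ ws)) (trans
          (cong₂ (λ p q → suc p + q) (proj₁ qw) (length-++ (y′ ∷ ws′)))
        (cong (λ p → suc (i + (p + length C))) (proj₁ qw′)))))
        (lin 0 sm (eq i (length C) (length vs))))
      where
      tail-clique : ∀ {s y ws} → IsClique b (suc s) (y ∷ ws) → IsClique b s ws
      tail-clique (l , _ ∷ js) = suc-injective l , js
      lemma : ∀ {z} → z ∈ y ∷ ws → z ∈ ws ++ y ∷ us
      lemma (here refl) = ∈-++⁺ʳ ws (here refl)
      lemma (there z)   = ∈-++⁺ˡ z
      eq : ∀ i x l → suc (i + (suc i + x)) + suc l * (suc i + suc i) + 0 ≡ suc (suc l) * (suc i + suc i) + x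
      eq = solve-∀

    record Group (L us : List (Fin N)) (n : ℕ) : Set where
      constructor group
      field
        {body} : List (Fin N)
        unique : Unique body
        body-⊆ : body ⊆ S
        avoids : Disj body us
        accept : ∀ {es} → es ⊆ L → length es ≡ n → Tiled b j (es ++ body)

    abstract

      line-cost : List (Fin N) → ℕ
      line-cost L = suc (length L) * (j + j)

      group-cost : List (Fin N) → ℕ
      group-cost L = j + j * line-cost L

      line-cost-≡ : ∀ {L} → line-cost L ≡ suc (length L) * (j + j)
      line-cost-≡ = refl

      group-cost-≡ : ∀ {L} → group-cost L ≡ j + j * line-cost L
      group-cost-≡ = refl

    -- Each `z` in `zs` receives a connector for `z ∷ L`. Either every connector takes its own `z`,
    -- or the connectors take the vertices of `es` instead and `zs` stays free.
    connect-all : ∀ zs L us → (∀ {w} → w ∈ zs → Good w) → (∀ {w} → w ∈ L → Good w) →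
                  length us + length zs * line-cost L ≤ used →
                  Σ[ G ∈ Group L us (length zs) ] Tiled b j (zs ++ Group.body G) × length (Group.body G) ≤
                      length zs * line-cost L
    connect-all [] L us gz gL le = group [] []-⊆ (λ ()) (λ { {[]} _ _ → tiled-[] }) , tiled-[] , z≤n
    connect-all (z ∷ zs) L us gz gL le = extend
      (connect z L us (λ { (here refl) → gz (here refl) ; (there p) → gL p })
        (subst (λ m → length us + m ≤ used) line-cost-≡ (≤-trans (+-monoʳ-≤ (length us) (m≤m+n _ _)) le)))
      where
      eq : ∀ x m l u → m + x + l * m + u + 0 ≡ u + (x + suc l * m)
      eq = solve-∀
      extend : Connector (z ∷ L) us →
               Σ[ G ∈ Group L us (suc (length zs)) ] Tiled b j (z ∷ zs ++ Group.body G) × length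
                   (Group.body G) ≤ suc (length zs) * line-cost L
      extend (connector {cs} uC C⊆ Cd acc sm) = finish
        (connect-all zs L (cs ++ us) (λ p → gz (there p)) gL
            (≤-trans (≤-reflexive (cong (_+ length zs * line-cost L) (length-++ cs)))
          (≤-trans (+-monoˡ-≤ (length zs * line-cost L) (+-monoˡ-≤ (length us) sm′))
            (lin 0 le (eq (length us) (line-cost L) (length zs) used)))))
        where
        sm′ : length cs ≤ line-cost L
        sm′ = subst (length cs ≤_) (sym line-cost-≡) sm
        interchange : ∀ {e es gs} → Tiled b j (e ∷ cs) → Tiled b j (es ++ gs) → Tiled b j (e ∷ es ++ cs ++ gs)
        interchange {e} {es} s t = tiled-↭ (prep e (shifts cs es)) (tiled-++ s t)
        finish : Σ[ G ∈ Group L (cs ++ us) (length zs) ] Tiled b j (zs ++ Group.body G) × length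
            (Group.body G) ≤ length zs * line-cost L →
                 Σ[ G ∈ Group L us (suc (length zs)) ] Tiled b j (z ∷ zs ++ Group.body G) × length
                     (Group.body G) ≤ suc (length zs) * line-cost L
        finish (group {gs} uG G⊆ Gd accG , t , smG) = group
          (++-unique uC uG λ p q → Gd q (∈-++⁺ˡ p))
          (++-⊆ C⊆ G⊆)
          (λ p q → [ (λ w → Cd w q) , (λ w → Gd w (∈-++⁺ʳ cs q)) ]′ (∈-++⁻ cs p))
          (λ { {e ∷ es} sub l → interchange {es = es} (acc (there (sub (here refl))))
              (accG (λ p → sub (there p)) (suc-injective l)) })
          , interchange {es = zs} (acc (here refl)) t
          , ≤-trans (≤-reflexive (length-++ cs)) (sm′ ⊕ smG)

    -- For `zs` a clique of size `j`, the two states of `connect-all` are those of an absorber: the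
    -- connectors use up the clique and nothing is absorbed, or the clique is a tile of its own and
    -- the connectors take `j` vertices of `L`.
    make-group : ∀ L us → (∀ {w} → w ∈ L → Good w) → length us + group-cost L ≤ used →
                 Σ[ G ∈ Group L us j ] Tiled b j (Group.body G) × length (Group.body G) ≤ group-cost L
    make-group L us gL le = finish (grab (rich j ≤-refl) S-unique (Low ++ us)
        (≤-trans (≤-reflexive (length-++ Low)) (low-few ⊕ ≤-trans (m≤m+n (length us) _) le)) room)
      where
      eq : ∀ j x y → j + x + y ≡ x + (j + y)
      eq = solve-∀
      le′ : length us + (j + j * line-cost L) ≤ used
      le′ = subst (λ m → length us + m ≤ used) group-cost-≡ le
      finish : (∃[ zs ] IsClique b j zs × zs ⊆ S × Disj zs (Low ++ us)) →
               Σ[ G ∈ Group L us j ] Tiled b j (Group.body G) × length (Group.body G) ≤ group-cost L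
      finish (zs , qz , zs⊆ , zsd) = complete′
        (connect-all zs L (zs ++ us) (λ p → ∉Low⇒Good (zs⊆ p) (λ w → zsd p (∈-++⁺ˡ w))) gL
          (≤-trans (≤-reflexive (trans (cong₂ (λ x y → x + y * line-cost L) (length-++ zs) (proj₁ qz))
            (trans (cong (λ x → x + length us + j * line-cost L) (proj₁ qz))
                (eq j (length us) (j * line-cost L))))) le′))
        where
        complete′ : Σ[ G ∈ Group L (zs ++ us) (length zs) ] Tiled b j (zs ++ Group.body G) × length
            (Group.body G) ≤ length zs * line-cost L →
                    Σ[ G ∈ Group L us j ] Tiled b j (Group.body G) × length (Group.body G) ≤ group-cost L
        complete′ (group {gs} uG G⊆ Gd accG , t , smG) = group
          (++-unique (clique-unique qz) uG λ p q → Gd q (∈-++⁺ˡ p))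
          (++-⊆ zs⊆ G⊆)
          (λ p q → [ (λ w → zsd w (∈-++⁺ʳ Low q)) , (λ w → Gd w (∈-++⁺ʳ zs q)) ]′ (∈-++⁻ zs p))
          (λ {es} sub l → tiled-↭ (shifts zs es)
             (tiled-++ (tiled-clique qz) (accG sub (trans l (sym (proj₁ qz))))))
          , t
          , ≤-trans (≤-reflexive (length-++ zs)) (subst (length zs + length gs ≤_) (sym group-cost-≡)
              (≤-reflexive (proj₁ qz) ⊕ subst (λ n → length gs ≤ n * line-cost L) (proj₁ qz) smG))

    -- A union of `n` groups, each of which takes either `j` vertices or none; hence all multiples
    -- of `j` up to `n * j`.
    record Absorber (L : List (Fin N)) (n : ℕ) : Set where
      constructor absorber
      field
        {body} : List (Fin N)
        unique : Unique body
        body-⊆ : body ⊆ S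
        avoids : Disj body L
        accept : ∀ m es → m ≤ n → es ⊆ L → length es ≡ m * j → Tiled b j (es ++ body)
        small  : length body ≤ n * group-cost L

    absorb-more : ∀ {L n} (A : Absorber L n) →
                  (Σ[ G ∈ Group L (Absorber.body A ++ L) j ] Tiled b j (Group.body G) × length (Group.body G) ≤
                      group-cost L) →
                  Absorber L (suc n)
    absorb-more {L} {n} (absorber {as} uA A⊆ Ad accA smA) (group {gs} uG G⊆ Gd accG , t , smG) = absorber
      (++-unique uG uA λ p q → Gd p (∈-++⁺ˡ q))
      (++-⊆ G⊆ A⊆)
      (λ p q → [ (λ w → Gd w (∈-++⁺ʳ as q)) , (λ w → Ad w q) ]′ (∈-++⁻ gs p))
      accept′
      (≤-trans (≤-reflexive (length-++ gs)) (smG ⊕ smA))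
      where
      accept-++ : ∀ m es fs → m ≤ n → es ++ fs ⊆ L → length es ≡ j → length fs ≡ m * j → Tiled b j
          ((es ++ fs) ++ gs ++ as)
      accept-++ m es fs m≤n sub l l′ = tiled-↭ (↭-interchange es gs fs as)
        (tiled-++ (accG {es} (λ p → sub (∈-++⁺ˡ p)) l) (accA m fs m≤n (λ p → sub (∈-++⁺ʳ es p)) l′))
      accept′ : ∀ m es → m ≤ suc n → es ⊆ L → length es ≡ m * j → Tiled b j (es ++ gs ++ as)
      accept′ zero [] _ _ _ = tiled-++ t (accA zero [] z≤n []-⊆ refl)
      accept′ (suc m) es (s≤s m≤n) sub l = subst (λ fs → Tiled b j (fs ++ gs ++ as)) (take++drop≡id j es)
        (accept-++ m (take j es) (drop j es) m≤n (λ {x} p → sub (subst (x ∈_) (take++drop≡id j es) p))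
          (length-take-≤ j {es} (≤-trans (m≤m+n j (m * j)) (≤-reflexive (sym l))))
          (trans (length-drop j es) (trans (cong (_∸ j) l) (m+n∸m≡n j (m * j)))))

    absorb : ∀ L n → (∀ {w} → w ∈ L → Good w) → length L + n * group-cost L ≤ used → Absorber L n
    absorb L zero gL le = absorber [] []-⊆ (λ ()) (λ { zero [] _ _ _ → tiled-[] }) z≤n
    absorb L (suc n) gL le = more (absorb L n gL (≤-trans (+-monoʳ-≤ (length L) (m≤n+m _ _)) le))
      where
      eq : ∀ l x y → x + l + y ≡ l + (y + x)
      eq = solve-∀
      more : Absorber L n → Absorber L (suc n)
      more A@(absorber {as} uA A⊆ Ad accA smA) = absorb-more A (make-group L (as ++ L) gL
        (≤-trans (+-monoˡ-≤ (group-cost L) (≤-trans (≤-reflexive (length-++ as)) (+-monoˡ-≤ (length L) smA)))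
          (≤-trans (≤-reflexive (eq (length L) (n * group-cost L) (group-cost L))) le)))

-- Tiling a set up to `R` vertices with a reserve and an absorber.

module PermSolver {A : Set} where
  open import Algebra.Solver.CommutativeMonoid (++-commutativeMonoid {A = A}) public
    using (_⊜_) renaming (solve to perm; _⊕_ to _⊎⁺_)

filter-split : ∀ {A : Set} {P : A → Set} (P? : Decidable P) xs →
               xs ↭ filter P? xs ++ filter (λ x → ¬? (P? x)) xs
filter-split P? [] = ↭-refl
filter-split P? (x ∷ xs) with P? x
... | yes _ = prep x (filter-split P? xs)
... | no _  = ↭-trans (prep x (filter-split P? xs)) (↭-sym (shift x (filter P? xs) _))

divide : ∀ i x → ∃[ m ] ∃[ r ] x ≡ m * suc i + r × r ≤ i
divide i x = x / suc i , x % suc i , trans (m≡m%n+[m/n]*n x (suc i)) (+-comm (x % suc i) _) , s≤s⁻¹ (m%n<n x (suc i))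

module Covering {N : ℕ} (c : Colouring N) {b : Fin 2} {i τ t : ℕ} {L : List (Fin N)}
  (L-unique : Unique L) (rich : Cliques.Rich c b i τ L) where

  open Cliques c
  open Tilings c

  record Cover (es used : List (Fin N)) : Set where
    constructor cover
    field
      {body} : List (Fin N)
      unique : Unique body
      body-⊆ : body ⊆ L
      avoids : Disj body used
      tiling : Tiled b (suc i) (es ++ body)

  cover-all : ∀ es used → (∀ {e} → e ∈ es → t ≤ length (nbrs b e L)) → τ + (length used + length es * i) ≤ t →
      Cover es used
  cover-all [] used h le = cover [] []-⊆ (λ ()) tiled-[]
  cover-all (e ∷ es) used h le =
    first (grab (Rich-⊆ (λ v → nbrs-⊆ b e L v) rich) (nbrs-unique b e L-unique) used {length used} ≤-refl
      (≤-trans (≤-trans (+-monoʳ-≤ τ (m≤m+n (length used) _)) le) (h (here refl))))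
    where
    first : (∃[ ws ] IsClique b i ws × ws ⊆ nbrs b e L × Disj ws used) → Cover (e ∷ es) used
    first (ws , q , ws⊆ , wsd) = more (cover-all es (ws ++ used) (λ v → h (there v))
      (≤-trans (+-monoʳ-≤ τ (≤-reflexive (trans (cong (_+ length es * i)
          (trans (length-++ ws) (cong (_+ length used) (proj₁ q))))
        (eq i (length used) (length es * i))))) le))
      where
      eq : ∀ i x y → i + x + y ≡ x + (i + y)
      eq = solve-∀
      more : Cover es (ws ++ used) → Cover (e ∷ es) used
      more (cover {vs} u s a t) = cover
        (++-unique (clique-unique q) u λ p r → a r (∈-++⁺ˡ p))
        (++-⊆ (λ v → nbrs-⊆ b e L (ws⊆ v)) s)
        (λ v w → [ (λ p → wsd p w) , (λ p → a p (∈-++⁺ʳ ws w)) ]′ (∈-++⁻ ws v))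
        (tiled-↭ (prep e (shifts ws es)) (tiled-++ (tiled-clique (∷-clique q λ v → nbrs-joined (ws⊆ v))) t))

-- Everything outside a reserved set L is tiled greedily; the uncovered vertices either have many
-- neighbours in L, and are covered using L, or they are few.  The vertices of L left over are absorbed.
module NearTiling {N : ℕ} (c : Colouring N) {b d : Fin 2} (b≢d : b ≢ d) {i τ R t : ℕ}
  {P : List (Fin N)} (P-unique : Unique P) (P-free : Cliques.NoClique c d (2 + i) P)
  (rich : ∀ s → s ≤ suc i → Cliques.Rich c b s τ P)
  (mono : ∀ {zs} → Unique zs → suc R ≤ length zs →
          (∃[ ys ] Cliques.IsClique c b (suc i) ys × ys ⊆ zs) ⊎ (∃[ ys ] Cliques.IsClique c d (suc i) ys × ys ⊆ zs))
  {L A : List (Fin N)} (L-unique : Unique L) (L⊆P : L ⊆ P) (A-unique : Unique A) (A⊆P : A ⊆ P) (A-avoids : Disj A L)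
  (absorbs : ∀ m es → m ≤ τ → es ⊆ L → length es ≡ m * suc i → Tilings.Tiled c b (suc i) (es ++ A))
  (cover-room : τ + τ * i ≤ t) (common-room : 1 + suc i * suc t ≤ length L)
  where

  open Cliques c
  open Tilings c

  open Covering c {t = t} L-unique (Rich-⊆ L⊆P (rich i (n≤1+n i)))

  private
    j = suc i

    heavy? : Decidable (λ u → t ≤ length (nbrs b u L))
    heavy? u = t ≤? length (nbrs b u L)

    -- `suc R` vertices contain a monochromatic clique of size `j`. If it had colour `d`, then, its
    -- vertices having few `b`-neighbours in `L`, some vertex of `L` would be joined to all of it in
    -- `d` and complete a `d`-clique of size `k` in `P`. So greedy tiling of the light vertices
    -- stops only at `R`.
    light-rich : ∀ us → Unique us → us ⊆ P → Rich b j (suc R) (filter (λ u → ¬? (heavy? u)) us)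
    light-rich us u us⊆ {zs} uz zs⊆ le = [ id , (λ r → contradiction r red-clique) ]′ (mono uz le)
      where
      light : ∀ {z} → z ∈ zs → length (nbrs b z L) ≤ t
      light v = <⇒≤ (≰⇒> (proj₂ (∈-filter⁻ (λ u → ¬? (heavy? u)) {xs = us} (zs⊆ v))))
      red-clique : ¬ (∃[ ys ] IsClique d j ys × ys ⊆ zs)
      red-clique (ys , q , ys⊆) = absurd (nonempty (commons-large ys L-unique (λ v → light (ys⊆ v))
          (subst (λ l → 1 + l * suc t ≤ length L) (sym (proj₁ q)) common-room)))
        where
        absurd : ¬ (∃[ y ] y ∈ commons b ys L)
        absurd (y , y∈) = P-free (∷-clique q λ v → joined-comm (commons-joined (≢-sym b≢d) y∈ v))
          (∷-⊆ (L⊆P (commons-⊆ b ys L y∈)) λ v → us⊆ (filter-⊆ (λ u → ¬? (heavy? u)) us (zs⊆ (ys⊆ v))))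

    record Split (xs : List (Fin N)) (θ : ℕ) : Set where
      constructor split
      field
        {tiles left} : List (Fin N)
        tiling : Tiled b j tiles
        perm   : xs ↭ tiles ++ left
        few    : length left ≤ θ

    greedy-split : ∀ {θ xs} → Rich b j (suc θ) xs → Unique xs → Split xs θ
    greedy-split r u = convert (greedy r u)
      where
      convert : ∀ {θ xs} → (∃[ ys ] ∃[ us ] Tiled b j ys × xs ↭ ys ++ us × length us ≤ θ) → Split xs θ
      convert (_ , _ , t , σ , le) = split t σ le

    tidy : ∀ (ws ys′ es rem A ys E D₁ D₂ : List (Fin N)) →
           ((ws ++ (ys′ ++ (es ++ rem))) ++ A) ++ (ys ++ (E ++ (D₁ ++ D₂))) ↭
           ((es ++ A) ++ (ys′ ++ ((E ++ ws) ++ (D₁ ++ ys)))) ++ (rem ++ D₂)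
    tidy = perm 9 (λ ws ys′ es rem A ys E D₁ D₂ →
      (((ws ⊎⁺ (ys′ ⊎⁺ (es ⊎⁺ rem))) ⊎⁺ A) ⊎⁺ (ys ⊎⁺ (E ⊎⁺ (D₁ ⊎⁺ D₂)))) ⊜
      (((es ⊎⁺ A) ⊎⁺ (ys′ ⊎⁺ ((E ⊎⁺ ws) ⊎⁺ (D₁ ⊎⁺ ys)))) ⊎⁺ (rem ⊎⁺ D₂))) ↭-refl
      where open PermSolver

    rest : List (Fin N)
    rest = P ∖ (L ++ A)

    P-split : P ↭ (L ++ A) ++ rest
    P-split = ∖-split P-unique (++-unique L-unique A-unique (disj-sym A-avoids)) (++-⊆ L⊆P A⊆P)

    heavy-part light-part : List (Fin N) → List (Fin N)
    heavy-part = filter heavy?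
    light-part = filter (λ u → ¬? (heavy? u))

    finish : ∀ {n ys us D₁ D₂ ws ys′ us′} → n * j + R ≤ length P →
      Tiled b j ys → rest ↭ ys ++ us →
      Tiled b j D₁ → light-part us ↭ D₁ ++ D₂ → length D₂ ≤ R →
      Tiled b j (heavy-part us ++ ws) → L ↭ ws ++ (L ∖ ws) →
      Tiled b j ys′ → L ∖ ws ↭ ys′ ++ us′ → length us′ ≤ τ → Packing b j n P
    finish {n} {ys} {us} {D₁} {D₂} {ws} {ys′} {us′} size tys σ₁ tD σ₂ leD tE σ₃ tys′ σ₄ le′ =
      -- `us′` is what greedy tiling leaves of the reserve; all of it but fewer than `j` vertices
      -- can be absorbed.
      conclude (divide i (length us′))
      where
      conclude : (∃[ m ] ∃[ r ] length us′ ≡ m * j + r × r ≤ i) → Packing b j n P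
      conclude (m , r , l , r≤) = pack-from {ys = T} tT
          (proj₁ (unique-++⁻ T (Unique-resp-↭ σ P-unique)))
          (λ v → ∈-resp-↭ (↭-sym σ) (∈-++⁺ˡ v))
          enough
        where
        es rem T : List (Fin N)
        es  = take (m * j) us′
        rem = drop (m * j) us′
        T   = (es ++ A) ++ (ys′ ++ ((heavy-part us ++ ws) ++ (D₁ ++ ys)))
        m≤τ : m ≤ τ
        m≤τ = ≤-trans (≤-trans (≤-trans (≤-reflexive (sym (*-identityʳ m))) (*-monoʳ-≤ m (s≤s z≤n)))
                (≤-trans (m≤m+n (m * j) r) (≤-reflexive (sym l)))) le′
        tT : Tiled b j T
        tT = tiled-++ (absorbs m es m≤τ
               (λ v → ∖-⊆ L ws (∈-resp-↭ (↭-sym σ₄) (∈-++⁺ʳ ys′ (take-⊆ (m * j) v))))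
               (length-take-≤ (m * j) (≤-trans (m≤m+n (m * j) r) (≤-reflexive (sym l)))))
               (tiled-++ tys′ (tiled-++ tE (tiled-++ tD tys)))
        σ : P ↭ T ++ (rem ++ D₂)
        σ = ↭-trans P-split (↭-trans
          (↭-++⁺ (↭-++⁺ʳ A (↭-trans σ₃ (↭-++⁺ˡ ws (↭-trans σ₄
              (↭-++⁺ˡ ys′ (↭-reflexive (sym (take++drop≡id (m * j) us′))))))))
                 (↭-trans σ₁ (↭-++⁺ˡ ys (↭-trans (filter-split heavy? us) (↭-++⁺ˡ (heavy-part us) σ₂)))))
          (tidy ws ys′ es rem A ys (heavy-part us) D₁ D₂))
        rem≤ : length rem ≤ i
        rem≤ = ≤-trans (≤-reflexive (trans (length-drop (m * j) us′)
            (trans (cong (_∸ m * j) l) (m+n∸m≡n (m * j) r)))) r≤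
        total : n * j + R ≤ length T + (i + R)
        total = ≤-trans size (≤-trans (≤-reflexive (trans (↭-length σ)
            (trans (length-++ T) (cong (length T +_) (length-++ rem)))))
          (+-monoʳ-≤ (length T) (rem≤ ⊕ leD)))
        -- The uncovered vertices are `D₂`, at most `R`, which the hypothesis provides for, and
        -- `rem`, at most `i`, which divisibility makes up for.
        enough : n * j ≤ length T
        enough = tiled-whole {n = n} tT (+-cancelʳ-≤ R _ _ (≤-trans total
            (≤-reflexive (sym (+-assoc (length T) i R)))))

  near-tiling : ∀ {n} → n * suc i + R ≤ length P → Packing b (suc i) n P
  near-tiling {n} size = step₁ (greedy-split (Rich-⊆ rest⊆ (Rich-mono (n≤1+n τ) (rich j ≤-refl))) rest-unique)
    where
    rest⊆ : rest ⊆ P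
    rest⊆ = ∖-⊆ P (L ++ A)
    rest-unique : Unique rest
    rest-unique = ∖-unique (L ++ A) P-unique
    step₁ : Split rest τ → Packing b j n P
    step₁ (split {ys} {us} tys σ₁ le) =
      step₂ (greedy-split (light-rich us us-unique us⊆) (UP.filter⁺ (λ u → ¬? (heavy? u)) us-unique))
      where
      us-unique : Unique us
      us-unique = proj₁ (proj₂ (unique-++⁻ ys (Unique-resp-↭ σ₁ rest-unique)))
      us⊆ : us ⊆ P
      us⊆ v = rest⊆ (∈-resp-↭ (↭-sym σ₁) (∈-++⁺ʳ ys v))
      heavy≤ : length (heavy-part us) ≤ τ
      heavy≤ = ≤-trans (unique-⊆-length (UP.filter⁺ heavy? us-unique) (λ v → filter-⊆ heavy? us v)) le
      step₂ : Split (light-part us) R → Packing b j n P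
      step₂ (split tD σ₂ leD) = step₃ (cover-all (heavy-part us) []
          (λ v → proj₂ (∈-filter⁻ heavy? {xs = us} v)) (≤-trans (+-monoʳ-≤ τ (*-monoˡ-≤ i heavy≤)) cover-room))
        where
        step₃ : Cover (heavy-part us) [] → Packing b j n P
        step₃ (cover {ws} uw ws⊆ _ tE) = step₄ (greedy-split
            (Rich-⊆ (λ v → L⊆P (∖-⊆ L ws v)) (Rich-mono (n≤1+n τ) (rich j ≤-refl))) (∖-unique ws L-unique))
          where
          step₄ : Split (L ∖ ws) τ → Packing b j n P
          step₄ (split tys′ σ₄ le′) = finish {n} size tys σ₁ tD σ₂ leD tE (∖-split L-unique uw ws⊆) tys′ σ₄ le′

-- Where absorbers exist: halving the excluded clique size.

module Descent {N : ℕ} (c : Colouring N) {b d : Fin 2} (b≢d : b ≢ d) {i τ R t l used Λ Q : ℕ}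
  {P : List (Fin N)} (P-unique : Unique P) (P-free : Cliques.NoClique c d (2 + i) P)
  (rich : ∀ s → s ≤ suc i → Cliques.Rich c b s τ P)
  (mono : ∀ {zs} → Unique zs → suc R ≤ length zs →
          (∃[ ys ] Cliques.IsClique c b (suc i) ys × ys ⊆ zs) ⊎ (∃[ ys ] Cliques.IsClique c d (suc i) ys × ys ⊆ zs))
  (cover-room : τ + τ * i ≤ t) (common-room : 1 + suc i * suc t ≤ l)
  (cost : l + τ * (suc i + suc i * (suc l * (suc i + suc i))) ≤ used)
  (Λ-large : 1 + (τ + (l + used)) ≤ Λ)
  where

  open Cliques c
  open Tilings c

  private
    j = suc i

    κ : ℕ
    κ = 6 * (Q * Q)

    -- A d-clique in zs and one among its common d-neighbours in M would form a d-clique of size 2 p.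
    sparse : ∀ {p few S M zs s} → NoClique d (p + p) S →
      (∀ {zs} → Unique zs → zs ⊆ S → few ≤ length zs → ¬ NoClique d p zs) →
      Unique M → M ⊆ S → Unique zs → zs ⊆ S → few ≤ length zs → (∀ {y} → y ∈ zs → length (nbrs b y M) ≤ s) →
      few + p * suc s ≤ length M → ⊥
    sparse {p} {few} {S} {M} {zs} {s} none dense uM M⊆ uz zs⊆ le light size =
      dense uz zs⊆ le λ {ys} q ys⊆ →
      dense (commons-unique b ys uM) (λ v → M⊆ (commons-⊆ b ys M v))
        (commons-large ys uM (λ v → light (ys⊆ v)) (subst (λ z → few + z * suc s ≤ length M) (sym (proj₁ q)) size))
        λ {ys′} q′ ys′⊆ → none (join-cliques q q′ (λ v w → commons-joined (≢-sym b≢d) (ys′⊆ w) v))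
          (++-⊆ (λ v → zs⊆ (ys⊆ v)) λ w → M⊆ (commons-⊆ b ys M (ys′⊆ w)))

    -- Reserve and absorber are found inside `S`, but the tiling that they complete is one of all of
    -- `P`.
    module Step {p few : ℕ} {S : List (Fin N)} (uS : Unique S) (S⊆P : S ⊆ P) (none : NoClique d (p + p) S)
      (dense : ∀ {zs} → Unique zs → zs ⊆ S → few ≤ length zs → ¬ NoClique d p zs)
      (p≤Q : p ≤ Q) (1≤Q : 1 ≤ Q) (Λ≤few : Λ ≤ few) (size : few * κ ≤ length S) where

      -- Dictated by `sparse`, from the inside out. For `bad-few` a neighbourhood needs
      -- `few + p (many + 1)` vertices, at most `Q few + 3 Q few`, hence `deg`. For `low-few` the
      -- set `S` needs `few + p (deg + 1)`, at most `Q² few + 5 Q² few`, hence the factor `6` in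
      -- `κ`.
      many deg : ℕ
      many = few + few
      deg  = 4 * (Q * few)

      few≤Qfew : few ≤ Q * few
      few≤Qfew = ≤-trans (≤-reflexive (sym (*-identityˡ few))) (*-monoˡ-≤ few 1≤Q)

      Qfew≤QQfew : Q * few ≤ Q * (Q * few)
      Qfew≤QQfew = *-monoʳ-≤ Q few≤Qfew

      Λ-few : 1 + (τ + (l + used)) ≤ few
      Λ-few = ≤-trans Λ-large Λ≤few

      size′ : 6 * (Q * (Q * few)) ≤ length S
      size′ = ≤-trans (≤-reflexive (eq Q few)) size
        where
        eq : ∀ Q f → 6 * (Q * (Q * f)) ≡ f * (6 * (Q * Q))
        eq = solve-∀

      6few : 6 * few ≤ length S
      6few = ≤-trans (*-monoʳ-≤ 6 (≤-trans few≤Qfew Qfew≤QQfew)) size′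

      wide : 1 + (few + (few + few) + used) ≤ length S
      wide = ≤-trans (lin (τ + l + few + few) Λ-few (eq few used τ l)) 6few
        where
        eq : ∀ f u τ l → 1 + (f + (f + f) + u) + f + (τ + l + f + f) ≡ 6 * f + (1 + (τ + (l + u)))
        eq = solve-∀

      enough : τ + (few + used) ≤ many
      enough = lin (1 + l) Λ-few (eq few used τ l)
        where
        eq : ∀ f u τ l → τ + (f + u) + f + (1 + l) ≡ f + f + (1 + (τ + (l + u)))
        eq = solve-∀

      deg-enough : τ + used ≤ deg
      deg-enough = ≤-trans (lin (1 + l) Λ-few (eq few used τ l)) (≤-trans few≤Qfew (m≤m+n (Q * few) _))
        where
        eq : ∀ f u τ l → τ + u + f + (1 + l) ≡ f + (1 + (τ + (l + u)))
        eq = solve-∀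

      room : τ + (few + used) ≤ length S
      room = ≤-trans enough (≤-trans (lin (4 * few) (z≤n {0}) (eq few)) 6few)
        where
        eq : ∀ f → f + f + 0 + 4 * f ≡ 6 * f + 0
        eq = solve-∀

      bad-size : few + p * suc many ≤ deg
      bad-size = ≤-trans (few≤Qfew ⊕ *-mono-≤ p≤Q (lin (τ + (l + used)) Λ-few (eq few (τ + (l + used)))))
          (≤-reflexive (eq′ Q few))
        where
        eq : ∀ f x → suc (f + f) + f + x ≡ 3 * f + (1 + x)
        eq = solve-∀
        eq′ : ∀ Q f → Q * f + Q * (3 * f) ≡ 4 * (Q * f)
        eq′ = solve-∀

      low-size : few + p * suc deg ≤ length S
      low-size = ≤-trans (≤-trans few≤Qfew Qfew≤QQfew ⊕ *-mono-≤ p≤Q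
          (lin (τ + (l + used)) (≤-trans Λ-few few≤Qfew) (eq (Q * few) (τ + (l + used)))))
        (≤-trans (≤-reflexive (eq′ Q few)) size′)
        where
        eq : ∀ f x → suc (4 * f) + f + x ≡ 5 * f + (1 + x)
        eq = solve-∀
        eq′ : ∀ Q f → Q * (Q * f) + Q * (5 * (Q * f)) ≡ 6 * (Q * (Q * f))
        eq′ = solve-∀

      module Ab = Absorbers c uS (λ s le → Rich-⊆ S⊆P (rich s le)) {few} {deg} {many} {used} wide enough
          deg-enough room

      low-few : length Ab.Low ≤ few
      low-few = ≮⇒≥ λ lt → sparse none dense uS id (UP.filter⁺ _ uS) (λ v → filter-⊆ _ S v) (<⇒≤ lt)
        (λ v → <⇒≤ (proj₂ (∈-filter⁻ (λ y → length (nbrs b y S) <? deg) {xs = S} v))) low-size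

      bad-few : ∀ {v} → Ab.Good v → length (Ab.Bad v) ≤ few
      bad-few {v} good = ≮⇒≥ λ lt → sparse none dense (nbrs-unique b v uS) (λ w → nbrs-⊆ b v S w)
        (UP.filter⁺ _ uS) (λ w → filter-⊆ _ S w) (<⇒≤ lt)
        (λ w → <⇒≤ (proj₂ (∈-filter⁻ (λ y → length (nbrs b y (nbrs b v S)) <? many) {xs = S} w)))
        (≤-trans bad-size good)

      open Ab.Build low-few bad-few

      L : List (Fin N)
      L = take l (S ∖ Ab.Low)

      L⊆ : L ⊆ S ∖ Ab.Low
      L⊆ v = take-⊆ l v

      L-length : length L ≡ l
      L-length = length-take-≤ l (∖-large Ab.Low uS low-few
        (≤-trans (lin (1 + (τ + used) + 4 * few) Λ-few (eq few l (τ + used) τ used refl)) 6few))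
        where
        eq : ∀ f l x τ u → x ≡ τ + u → l + f + f + (1 + x + 4 * f) ≡ 6 * f + (1 + (τ + (l + u)))
        eq f l _ τ u refl = eq″ f l τ u
          where
          eq″ : ∀ f l τ u → l + f + f + (1 + (τ + u) + 4 * f) ≡ 6 * f + (1 + (τ + (l + u)))
          eq″ = solve-∀

      L-good : ∀ {w} → w ∈ L → Ab.Good w
      L-good v = Ab.∉Low⇒Good (∖-⊆ S Ab.Low (L⊆ v)) (∖-∉ S Ab.Low (L⊆ v))

      absorbing : Absorber L τ
      absorbing = absorb L τ L-good (≤-trans (≤-reflexive (cong₂ (λ x y → x + τ * y) L-length
        (trans group-cost-≡ (cong (λ y → j + j * y) (trans line-cost-≡
            (cong (λ x → suc x * (j + j)) L-length)))))) cost)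

      packed : ∀ {n} → n * j + R ≤ length P → Packing b j n P
      packed {n} size″ = NearTiling.near-tiling c b≢d P-unique P-free rich mono
        (UP.take⁺ l (∖-unique Ab.Low uS)) (λ v → S⊆P (∖-⊆ S Ab.Low (L⊆ v)))
        (Absorber.unique absorbing) (λ v → S⊆P (Absorber.body-⊆ absorbing v)) (Absorber.avoids absorbing)
        (Absorber.accept absorbing) cover-room (subst (1 + j * suc t ≤_) (sym L-length) common-room) {n} size″

  -- Either every large subset of S contains half of the largest d-clique that S could contain,
  -- or some subset does not and takes the place of S.
  descend : ∀ {n} → n * suc i + R ≤ length P → ¬ Packing b (suc i) n P →
            ∀ e {S} → 2 ^ e ≤ Q → Unique S → S ⊆ P → NoClique d (2 ^ e) S → Λ * κ ^ e ≤ length S → ⊥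
  -- A set without cliques of size `2 ^ 0 = 1` is empty, contrary to `Λ ≥ 1`.
  descend {n} size none zero {S} e≤Q uS S⊆ free le = absurd (nonempty (≤-trans (≤-trans (s≤s z≤n) Λ-large)
      (≤-trans (≤-reflexive (sym (*-identityʳ Λ))) le)))
    where
    absurd : ¬ (∃[ x ] x ∈ S)
    absurd (x , x∈) = free {[ x ]} (refl , ([] ∷ [])) (∷-⊆ x∈ []-⊆)
  descend {n} size none (suc e) {S} e≤Q uS S⊆ free le = none (Step.packed {2 ^ e} {Λ * κ ^ e} uS S⊆
      (subst (λ z → NoClique d (2 ^ e + z) S) (+-identityʳ (2 ^ e)) free)
      (λ uz zs⊆ le′ free′ → descend {n} size none e (≤-trans (m≤m+n (2 ^ e) _) e≤Q) uz (λ v → S⊆ (zs⊆ v)) free′ le′)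
      (≤-trans (m≤m+n (2 ^ e) _) e≤Q)
      1≤Q
      (≤-trans (≤-reflexive (sym (*-identityʳ Λ))) (*-monoʳ-≤ Λ (1≤κ^ e)))
      (≤-trans (≤-reflexive (trans (*-assoc Λ (κ ^ e) κ) (cong (Λ *_) (*-comm (κ ^ e) κ)))) le)
      {n} size)
    where
    1≤Q : 1 ≤ Q
    1≤Q = ≤-trans (m^n>0 2 (suc e)) e≤Q
    1≤κ^ : ∀ e → 1 ≤ κ ^ e
    1≤κ^ zero    = ≤-refl
    1≤κ^ (suc e) = *-mono-≤ (*-mono-≤ {1} {6} (s≤s z≤n) (*-mono-≤ 1≤Q 1≤Q)) (1≤κ^ e)

-- The structure of colourings without gadgets.

module Stars {N : ℕ} (c : Colouring N) where

  open Cliques c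
  open Tilings c
  open Gadgets c

  complete-rich : ∀ {b X} s → Complete b X → Rich b s s X
  complete-rich s k {zs} u sub le = take s zs , clique-of s k u sub le , λ v → take-⊆ s v

  nbrs-all : ∀ {b x ys} → Unique ys → (∀ {y} → y ∈ ys → Joined c b x y) → length ys ≤ length (nbrs b x ys)
  nbrs-all u h = unique-⊆-length u λ v → ∈-nbrs v (h v)

  nbrs-mono : ∀ {b x xs ys} → Unique xs → xs ⊆ ys → length (nbrs b x xs) ≤ length (nbrs b x ys)
  nbrs-mono {b} {x} {xs} u sub = unique-⊆-length (nbrs-unique b x u)
    λ v → ∈-nbrs (sub (nbrs-⊆ b x xs v)) (nbrs-joined {b} {x} {xs} v)

  nbrs-complete : ∀ {b x xs} → Complete b xs → Unique xs → x ∈ xs → length xs ≤ 1 + length (nbrs b x xs)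
  nbrs-complete {b} {x} {xs} k u x∈ = unique-⊆-length u sub
    where
    sub : xs ⊆ x ∷ nbrs b x xs
    sub {y} v with x ≟ y
    ... | yes refl = here refl
    ... | no x≢y   = there (∈-nbrs v (k x∈ v x≢y))

  two-stars : ∀ {b s θ as us m} → Rich b s θ as → Unique as → length us ≤ m → ∀ y₁ y₂ →
    θ + (s + m) ≤ length (nbrs b y₁ as) → θ + (s + m) ≤ length (nbrs b y₂ as) →
    Σ[ S ∈ Star b s y₁ as us ] Σ[ T ∈ Star b s y₂ as us ] Disj (leaves S) (leaves T)
  two-stars {b} {s} {θ} {as} {us} {m} r u le y₁ y₂ l₁ l₂ =
    second (star y₁ us r u le (≤-trans (+-monoʳ-≤ θ (m≤n+m m s)) l₁))
    where
    second : Star b s y₁ as us → Σ[ S ∈ Star b s y₁ as us ] Σ[ T ∈ Star b s y₂ as us ] Disj (leaves S) (leaves T)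
    second S = S , weaken (star y₂ (leaves S ++ us) r u
        (≤-trans (≤-reflexive (length-++ (leaves S))) (≤-reflexive (proj₁ (isClique S)) ⊕ le)) l₂)
      where
      weaken : Star b s y₂ as (leaves S ++ us) → Σ[ T ∈ Star b s y₂ as us ] Disj (leaves S) (leaves T)
      weaken T = record { isClique = isClique T ; leaves-⊆ = leaves-⊆ T ; centre = centre T
                        ; avoids = λ v w → avoids T v (∈-++⁺ʳ (leaves S) w) } ,
                 λ v w → avoids T w (∈-++⁺ˡ v)

  to-front : ∀ {b k x ts} → IsClique b (suc k) ts → x ∈ ts → ∃[ rs ] ts ↭ x ∷ rs × IsClique b (suc k) (x ∷ rs)
  to-front {x = x} q x∈ with ∈-∃++ x∈
  ... | as , bs , refl = as ++ bs , shift x as bs , clique-↭ (shift x as bs) q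

  loop-free : ∀ {b x} → ¬ Joined c b x x
  loop-free (x≢x , _) = x≢x refl

  -- Supplies `gadget₃`: two vertices of `Y` become centres of `b`-stars in `as`, two vertices of
  -- `X` centres of `d`-stars in `bs`. Besides `θ`, the thresholds count the first star and
  -- `X ++ Y`, which the second star has to avoid.
  dense-pair : ∀ {b d h θ₁ θ₂ as bs X Y xs} → b ≢ d → Unique as → Unique bs →
    Rich b (1 + h) θ₁ as → Rich d (1 + h) θ₂ bs → IsClique b (2 + h) X → IsClique d (2 + h) Y → Disj X Y →
    (∀ {y} → y ∈ Y → θ₁ + ((1 + h) + ((2 + h) + (2 + h))) ≤ length (nbrs b y as)) →
    (∀ {x} → x ∈ X → θ₂ + ((1 + h) + ((2 + h) + (2 + h))) ≤ length (nbrs d x bs)) →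
    X ⊆ xs → Y ⊆ xs → as ⊆ xs → bs ⊆ xs → Gadget (2 + h) 3 1 xs
  dense-pair {X = X@(x₁ ∷ x₂ ∷ _)} {Y@(y₁ ∷ y₂ ∷ _)} b≢d ua ub ra rb qX qY dis hY hX sX sY sA sB =
    build (two-stars ra ua us≤ y₁ y₂ (hY (here refl)) (hY (there (here refl))))
          (two-stars rb ub us≤ x₁ x₂ (hX (here refl)) (hX (there (here refl))))
    where
    us≤ : length (X ++ Y) ≤ _
    us≤ = ≤-trans (≤-reflexive (length-++ X)) (≤-reflexive (proj₁ qX) ⊕ ≤-reflexive (proj₁ qY))
    build : (Σ[ S ∈ Star _ _ y₁ _ _ ] Σ[ T ∈ Star _ _ y₂ _ _ ] Disj (leaves S) (leaves T)) →
            (Σ[ S ∈ Star _ _ x₁ _ _ ] Σ[ T ∈ Star _ _ x₂ _ _ ] Disj (leaves S) (leaves T)) → Gadget _ 3 1 _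
    build (S₁ , S₂ , dS) (T₁ , T₂ , dT) =
      gadget₃ b≢d qX qY dis ⊆-++ˡ (⊆-++ʳ X) S₁ S₂ dS T₁ T₂ dT sX sY sA sB

module Seed {N : ℕ} (c : Colouring N) {b d : Fin 2} (b≢d : b ≢ d) {h τ t m : ℕ} {xs A B : List (Fin N)}
  (no₂ : ¬ Gadgets.Gadget c (2 + h) 2 1 xs)
  (τ-large : ∀ r s → r + s ≤ 5 * (2 + h) → 2 ^ (r + s) ≤ τ)
  (uA : Unique A) (uB : Unique B) (A⊆ : A ⊆ xs) (B⊆ : B ⊆ xs)
  (A-free : Cliques.NoClique c d (2 + h) A) (B-free : Cliques.NoClique c b (2 + h) B)
  (sparse : ∀ {y} → y ∈ B → length (Cliques.nbrs c b y A) ≤ t)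
  (B-large : τ ≤ length B)
  (A-large : (m * (2 + h) + τ) + (4 * (2 + h)) * suc t ≤ length A)
  where

  open Cliques c
  open Tilings c
  open Gadgets c
  open Stars c

  private
    k j : ℕ
    k = 2 + h
    j = 1 + h

  private
    -- Size `4 * k` because `Core` takes `d`-stars in `Y₀` for `dense-pair`, which asks for
    -- `2 * j + 2 * k` neighbours. Finding such a clique in a set without `b`-cliques of size `k`
    -- takes `2 ^ (5 * k)` vertices, whence the `5` in `τ-large`.
    hub : ∃[ ys ] IsClique d (4 * k) ys × ys ⊆ B
    hub = noClique⇒rich (≢-sym b≢d) B-free (τ-large (4 * k) k (≤-reflexive (+-comm (4 * k) k))) uB id B-large

  Y₀ : List (Fin N)
  Y₀ = proj₁ hub

  Y₀-clique : IsClique d (4 * k) Y₀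
  Y₀-clique = proj₁ (proj₂ hub)

  Y₀⊆B : Y₀ ⊆ B
  Y₀⊆B v = proj₂ (proj₂ hub) v

  Y₀-unique : Unique Y₀
  Y₀-unique = clique-unique Y₀-clique

  Y₀-complete : Complete d Y₀
  Y₀-complete = clique⇒complete (proj₂ Y₀-clique)

  A₁ : List (Fin N)
  A₁ = commons b Y₀ A

  A₁-hub : ∀ {a y} → a ∈ A₁ → y ∈ Y₀ → Joined c d a y
  A₁-hub a∈ y∈ = joined-comm (commons-joined (≢-sym b≢d) a∈ y∈)

  A₁⊆A : A₁ ⊆ A
  A₁⊆A = commons-⊆ b Y₀ A

  A₁⊆ : A₁ ⊆ xs
  A₁⊆ v = A⊆ (A₁⊆A v)

  A₁-large : m * k + τ ≤ length A₁
  A₁-large = commons-large Y₀ uA (λ v → sparse (Y₀⊆B v))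
    (subst (λ l → (m * k + τ) + l * suc t ≤ length A) (sym (proj₁ Y₀-clique)) A-large)

  -- A `d`-edge from `x` to `x′` would extend through `Y₀` to a `d`-clique. With the two tiles and a
  -- second `d`-clique, formed by another vertex `a` of the first tile and further vertices of `Y₀`,
  -- this is `gadget₂`: each of `x`, `x′` and `a` is used in both colours.
  tile-pair : ∀ {ts ts′ x x′} → IsClique b k ts → IsClique b k ts′ → Disj ts ts′ → ts ⊆ A₁ → ts′ ⊆ A₁ →
              x ∈ ts → x′ ∈ ts′ → Joined c b x x′
  tile-pair {ts} {ts′} {x} {x′} q q′ dis sub sub′ x∈ x′∈ =
    other-colour b≢d (λ { refl → dis x∈ x′∈ }) λ blue → no₂ (build blue (to-front q x∈) (to-front q′ x′∈))
    where
    build : Joined c d x x′ → (∃[ rs ] ts ↭ x ∷ rs × IsClique b k (x ∷ rs)) →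
            (∃[ rs ] ts′ ↭ x′ ∷ rs × IsClique b k (x′ ∷ rs)) → Gadget k 2 1 xs
    build blue (a ∷ rs , σ , qx@(_ , ((x≢a , _) ∷ _) ∷ _)) (ss , ρ , qx′) =
      gadget₂ (≢-sym b≢d)
        (∷-clique (∷-clique y₁-clique (λ v → A₁-hub x′∈A₁ (y₁⊆ v)))
          λ { (here refl) → blue ; (there v) → A₁-hub x∈A₁ (y₁⊆ v) })
        qx qx′ (∷-clique y₂-clique (λ v → A₁-hub a∈A₁ (y₂⊆ v)))
        (disj-∷ˡ (λ { (here e) → x≢a e ; (there v) → loop-free (A₁-hub x∈A₁ (y₂⊆ v)) })
          (disj-∷ˡ (λ { (here refl) → dis a∈ x′∈ ; (there v) → loop-free (A₁-hub x′∈A₁ (y₂⊆ v)) })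
            λ v → λ { (here refl) → loop-free (A₁-hub a∈A₁ (y₁⊆ v)) ; (there w) → disjoint v (take-⊆ j w) }))
        (disj-⊆ (λ v → ∈-resp-↭ (↭-sym σ) v) (λ v → ∈-resp-↭ (↭-sym ρ) v) dis)
        (∷-⊆ (A₁⊆ x∈A₁) (∷-⊆ (A₁⊆ x′∈A₁) λ v → B⊆ (Y₀⊆B (y₁⊆ v))))
        (λ v → A₁⊆ (sub (∈-resp-↭ (↭-sym σ) (there v))))
        (λ v → A₁⊆ (sub′ (∈-resp-↭ (↭-sym ρ) (there v))))
        (λ v → B⊆ (Y₀⊆B (y₂⊆ v)))
      where
      a∈ = ∈-resp-↭ (↭-sym σ) (there (here refl))
      a∈A₁ = sub a∈
      x∈A₁ = sub x∈
      x′∈A₁ = sub′ x′∈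
      Y₁ Y₂ : List (Fin N)
      Y₁ = take h Y₀
      Y₂ = take j (drop h Y₀)
      y₁⊆ : Y₁ ⊆ Y₀
      y₁⊆ = take-⊆ h
      y₂⊆ : Y₂ ⊆ Y₀
      y₂⊆ v = drop-⊆ h (take-⊆ j v)
      disjoint : Disj Y₁ (drop h Y₀)
      disjoint = proj₂ (proj₂ (unique-++⁻ Y₁ (subst Unique (sym (take++drop≡id h Y₀)) Y₀-unique)))
      y₁-clique : IsClique d h Y₁
      y₁-clique = take-clique h (≤-trans (m≤n+m h 2) (m≤m+n k _)) Y₀-clique
      y₂-clique : IsClique d j Y₂
      y₂-clique = clique-of j Y₀-complete (UP.drop⁺ h Y₀-unique) (drop-⊆ h) (≤-trans
        (lin (7 + 2 * h) (z≤n {0}) (eq h)) (≤-reflexive (sym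
            (trans (length-drop h Y₀) (trans (cong (_∸ h) (trans (proj₁ Y₀-clique) (eq′ h)))
                (m+n∸m≡n h (3 * h + 8)))))))
        where
        eq : ∀ h → 1 + h + 0 + (7 + 2 * h) ≡ 3 * h + 8 + 0
        eq = solve-∀
        eq′ : ∀ h → 4 * (2 + h) ≡ h + (3 * h + 8)
        eq′ = solve-∀

  private
    X-packing : Packing b k m A₁
    X-packing = pack-greedy {n = m} (noClique⇒rich b≢d (NoClique-⊆ A₁⊆A A-free)
        (τ-large k k (lin (3 * k) (z≤n {0}) (eq k))))
                  (commons-unique b Y₀ uA) A₁-large
      where
      eq : ∀ k → k + k + 0 + 3 * k ≡ 5 * k + 0
      eq = solve-∀

  X : List (Fin N)
  X = tiles X-packing

  X-unique : Unique X
  X-unique = unique X-packing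

  X⊆A₁ : X ⊆ A₁
  X⊆A₁ v = inside X-packing v

  X⊆ : X ⊆ xs
  X⊆ v = A₁⊆ (X⊆A₁ v)

  X-length : length X ≡ m * k
  X-length = size X-packing

  -- The tiles are `b`-cliques, and `tile-pair` settles the edges between different ones; so a mere
  -- packing turns out to be one large clique.
  X-complete : Complete b X
  X-complete = from-tiled (tiled X-packing) X-unique X⊆A₁
    where
    tiles-complete : ∀ tss → All (IsClique b k) tss → Unique (concat tss) → concat tss ⊆ A₁ → Complete b (concat tss)
    tiles-complete (ts ∷ tss) (q ∷ qs) u sub {x} {y} x∈ y∈ x≢y = cases (∈-++⁻ ts x∈) (∈-++⁻ ts y∈)
      where
      parts = unique-++⁻ ts u
      cross : ∀ {x y} → x ∈ ts → y ∈ concat tss → Joined c b x y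
      cross x∈ y∈ with ∈-concat⁻′ tss y∈
      ... | ts′ , y∈′ , ts′∈ = tile-pair q (All.lookup qs ts′∈)
        (λ v w → proj₂ (proj₂ parts) v (∈-concat⁺′ w ts′∈))
        (λ v → sub (∈-++⁺ˡ v)) (λ v → sub (∈-++⁺ʳ ts (∈-concat⁺′ v ts′∈))) x∈ y∈′
      cases : x ∈ ts ⊎ x ∈ concat tss → y ∈ ts ⊎ y ∈ concat tss → Joined c b x y
      cases (inj₁ p) (inj₁ r) = clique⇒complete (proj₂ q) p r x≢y
      cases (inj₁ p) (inj₂ r) = cross p r
      cases (inj₂ p) (inj₁ r) = joined-comm (cross r p)
      cases (inj₂ p) (inj₂ r) = tiles-complete tss qs (proj₁ (proj₂ parts)) (λ v → sub (∈-++⁺ʳ ts v)) p r x≢y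
    from-tiled : Tiled b k X → Unique X → X ⊆ A₁ → Complete b X
    from-tiled (tss , qs , σ) u sub x∈ y∈ =
      tiles-complete tss qs (Unique-resp-↭ (↭-sym σ) u) (λ v → sub (∈-resp-↭ σ v))
        (∈-resp-↭ (↭-sym σ) x∈) (∈-resp-↭ (↭-sym σ) y∈)

  X-hub : ∀ {x y} → x ∈ X → y ∈ Y₀ → Joined c d x y
  X-hub v = A₁-hub (X⊆A₁ v)

  X-sparse : ∀ {y} → y ∈ B → length (nbrs b y X) ≤ t
  X-sparse y∈ = ≤-trans (nbrs-mono X-unique (λ v → A₁⊆A (X⊆A₁ v))) (sparse y∈)


module Core {N : ℕ} (c : Colouring N) {b d : Fin 2} (b≢d : b ≢ d) {h τ t₁ t₂ t₄ : ℕ} {xs B Y₀ X : List (Fin N)}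
  (no₂ : ¬ Gadgets.Gadget c (2 + h) 2 1 xs) (no₃ : ¬ Gadgets.Gadget c (2 + h) 3 1 xs)
  (τ-large : ∀ r s → r + s ≤ 5 * (2 + h) → 2 ^ (r + s) ≤ τ)
  (uxs : Unique xs) (uB : Unique B) (B⊆ : B ⊆ xs) (B-free : Cliques.NoClique c b (2 + h) B)
  (Y₀-clique : Cliques.IsClique c d (4 * (2 + h)) Y₀) (Y₀⊆B : Y₀ ⊆ B)
  (X-unique : Unique X) (X⊆ : X ⊆ xs) (X-complete : Cliques.Complete c b X)
  (X-hub : ∀ {x y} → x ∈ X → y ∈ Y₀ → Joined c d x y)
  (X-sparse : ∀ {y} → y ∈ B → length (Cliques.nbrs c b y X) ≤ t₁)
  (stars-room : (1 + h) + ((1 + h) + (2 + h)) ≤ t₁)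
  (X-room : ((2 + h) + (1 + h)) + (2 * (1 + h)) * suc t₁ ≤ length X)
  (t₄-room : τ + (2 + h) ≤ t₄) (B-room : τ + (1 + h) * suc t₄ ≤ length B) (B-room′ : τ + (1 + h) ≤ length B)
  (t₂-room : τ + ((1 + h) + ((2 + h) + (2 + h))) ≤ t₂)
  where

  open Cliques c
  open Tilings c
  open Gadgets c
  open Stars c

  private
    k j : ℕ
    k = 2 + h
    j = 1 + h

    Y₀-unique : Unique Y₀
    Y₀-unique = clique-unique Y₀-clique

    Y₀-complete : Complete d Y₀
    Y₀-complete = clique⇒complete (proj₂ Y₀-clique)

  inQ? : Decidable (λ v → t₁ ≤ length (nbrs b v X))
  inQ? v = t₁ ≤? length (nbrs b v X)

  Q P : List (Fin N)
  Q = filter inQ? xs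
  P = filter (λ v → ¬? (inQ? v)) xs

  Q⊆ : Q ⊆ xs
  Q⊆ = filter-⊆ inQ? xs

  P⊆ : P ⊆ xs
  P⊆ = filter-⊆ (λ v → ¬? (inQ? v)) xs

  Q-unique : Unique Q
  Q-unique = UP.filter⁺ inQ? uxs

  P-unique : Unique P
  P-unique = UP.filter⁺ (λ v → ¬? (inQ? v)) uxs

  Q-dense : ∀ {v} → v ∈ Q → t₁ ≤ length (nbrs b v X)
  Q-dense v∈ = proj₂ (∈-filter⁻ inQ? {xs = xs} v∈)

  P-sparse : ∀ {v} → v ∈ P → length (nbrs b v X) ≤ t₁
  P-sparse v∈ = <⇒≤ (≰⇒> (proj₂ (∈-filter⁻ (λ v → ¬? (inQ? v)) {xs = xs} v∈)))

  QP-disjoint : Disj Q P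
  QP-disjoint v w = proj₂ (∈-filter⁻ (λ v → ¬? (inQ? v)) {xs = xs} w) (Q-dense v)

  QP-split : length xs ≡ length Q + length P
  QP-split = trans (↭-length (filter-split inQ? xs)) (length-++ Q)

  X⊆Q : X ⊆ Q
  X⊆Q v = ∈-filter⁺ inQ? (X⊆ v) (+-cancelˡ-≤ 1 _ _ (≤-trans
    (≤-trans (lin (4 * h + 4 + t₁ + h * (2 * t₁)) (z≤n {0}) (eq h t₁)) X-room)
    (nbrs-complete X-complete X-unique v)))
    where
    eq : ∀ h t → 1 + t + 0 + (4 * h + 4 + t + h * (2 * t)) ≡ ((2 + h) + (1 + h)) + (2 * (1 + h)) * suc t + 0
    eq = solve-∀

  -- Two vertices `v₁`, `v₂` of a `d`-clique in `Q` would be centres of disjoint `b`-stars in `X`,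
  -- and a leaf `a` of the first would be the centre of a `d`-star in `Y₀`. These four cliques form
  -- `gadget₂` with shared vertices `v₁`, `v₂` and `a`.
  Q-free : NoClique d k Q
  Q-free {vs@(v₁ ∷ v₂ ∷ _)} q sub = build (two-stars (complete-rich j X-complete) X-unique
      (≤-reflexive (proj₁ q)) v₁ v₂
      (≤-trans stars-room (Q-dense (sub (here refl)))) (≤-trans stars-room (Q-dense (sub (there (here refl))))))
    where
    build : (Σ[ S ∈ Star b j v₁ X vs ] Σ[ T ∈ Star b j v₂ X vs ] Disj (leaves S) (leaves T)) → ⊥
    build (S@record { leaves = a ∷ rs } , T , dis) = build′ (star a vs (complete-rich j Y₀-complete) Y₀-unique
        (≤-reflexive (proj₁ q)) (≤-trans (lin (5 + 2 * h) (z≤n {0}) (eq h))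
            (≤-trans (≤-reflexive (sym (proj₁ Y₀-clique)))
          (nbrs-all Y₀-unique λ v → X-hub (leaves-⊆ S (here refl)) v))))
      where
      eq : ∀ h → (1 + h) + (2 + h) + 0 + (5 + 2 * h) ≡ 4 * (2 + h) + 0
      eq = solve-∀
      build′ : Star d j a Y₀ vs → ⊥
      build′ U = no₂ (gadget₂ (≢-sym b≢d) q (centred S) (centred T) (centred U)
        (disj-sym (disj-∷ˡ (avoids S (here refl)) (avoids U)))
        (disj-∷ˡ (λ { (here e) → proj₁ (All.lookup (AllPairs.head (proj₂ q)) (here refl)) e ; (there v) → avoids
            T v (here refl) })
          λ v → λ { (here refl) → avoids S v (there (here refl)) ; (there w) → dis v w })
        (λ v → Q⊆ (sub v)) (λ v → X⊆ (leaves-⊆ S v)) (λ v → X⊆ (leaves-⊆ T v)) (λ v → B⊆ (Y₀⊆B (leaves-⊆ U v))))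

  private
    -- All of `w`, `Y₁` and `Y₂` have few `b`-neighbours in `X`, so a `b`-clique in `X` outside `ws`
    -- is joined to them entirely in `d`. Two of its vertices complete `w ∷ Y₁` and `Y₂` to
    -- `d`-cliques of size `k`; these two and `w` are the shared vertices of `gadget₂`.
    two-hubs : ∀ {w ws Y₁ Y₂} → IsClique b k (w ∷ ws) → IsClique d j (w ∷ Y₁) → IsClique d j Y₂ →
               length (nbrs b w X) ≤ t₁ → w ∉ Y₂ → Disj Y₁ Y₂ → w ∷ ws ⊆ xs → Y₁ ⊆ B → Y₂ ⊆ B → ⊥
    two-hubs {w} {ws} {Y₁} {Y₂} qw q₁ q₂ light w∉ dis ws⊆ s₁ s₂ =
      build (clique-of k (λ v w → X-complete (pool-⊆ v) (pool-⊆ w)) (∖-unique ws (commons-unique b Y X-unique))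
          id pool-large)
      where
      Y pool : List (Fin N)
      Y = (w ∷ Y₁) ++ Y₂
      pool = commons b Y X ∖ ws
      pool-⊆ : pool ⊆ X
      pool-⊆ v = commons-⊆ b Y X (∖-⊆ (commons b Y X) ws v)
      pool-hub : ∀ {x y} → x ∈ pool → y ∈ Y → Joined c d x y
      pool-hub x∈ y∈ = joined-comm (commons-joined (≢-sym b≢d) (∖-⊆ (commons b Y X) ws x∈) y∈)
      pool-large : k ≤ length pool
      pool-large = ∖-large ws (commons-unique b Y X-unique) (≤-reflexive (suc-injective (proj₁ qw)))
        (commons-large Y X-unique
          (λ { (here refl) → light ; (there v) → [ (λ p → X-sparse (s₁ p)) , (λ p → X-sparse (s₂ p)) ]′
              (∈-++⁻ Y₁ v) })
          (subst (λ l → (k + j) + l * suc t₁ ≤ length X) (sym Y-length) X-room))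
        where
        Y-length : length Y ≡ 2 * j
        Y-length = trans (length-++ (w ∷ Y₁)) (trans (cong₂ _+_ (proj₁ q₁) (proj₁ q₂))
            (cong (j +_) (sym (+-identityʳ j))))
      go : ∀ {as} → IsClique b k as → as ⊆ pool → ⊥
      go {a₁ ∷ a₂ ∷ as} qa sub = no₂ (gadget₂ b≢d qa
        (∷-clique q₁ λ v → pool-hub (sub (here refl)) (∈-++⁺ˡ v))
        (∷-clique q₂ λ v → pool-hub (sub (there (here refl))) (∈-++⁺ʳ (w ∷ Y₁) v))
        qw
        (λ v → λ { (here refl) → loop-free (pool-hub (sub v) (here refl)) ; (there r) → ∖-∉ (commons b Y X) ws
            (sub v) r })
        (disj-∷ˡ (λ { (here e) → proj₁ (All.lookup (AllPairs.head (proj₂ qa)) (here refl)) e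
                    ; (there v) → loop-free (pool-hub (sub (here refl)) (∈-++⁺ʳ (w ∷ Y₁) v)) })
          (disj-∷ˡ (λ { (here refl) → loop-free (pool-hub (sub (there (here refl))) (here refl)) ; (there v) → w∉ v })
            λ v → λ { (here refl) → loop-free (pool-hub (sub (there (here refl))) (there (∈-++⁺ˡ v))) ;
                (there r) → dis v r }))
        (λ v → X⊆ (pool-⊆ (sub v))) (∷-⊆ (ws⊆ (here refl)) λ v → B⊆ (s₁ v)) (λ v → B⊆ (s₂ v)) (λ v → ws⊆ (there v)))
      build : IsClique b k (take k pool) → ⊥
      build qa = go qa (take-⊆ k)

    B-rich : ∀ s → s ≤ k → Rich d s τ B
    B-rich s s≤ = noClique⇒rich (≢-sym b≢d) B-free (τ-large s k
        (≤-trans (+-monoˡ-≤ k s≤) (lin (3 * k) (z≤n {0}) (eq k))))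
      where
      eq : ∀ k → k + k + 0 + 3 * k ≡ 5 * k + 0
      eq = solve-∀

    second-hub : ∀ {w ws Y₁} → IsClique b k (w ∷ ws) → IsClique d j (w ∷ Y₁) → length (nbrs b w X) ≤ t₁ →
                 w ∷ ws ⊆ xs → Y₁ ⊆ B → ⊥
    second-hub {w} {ws} {Y₁} qw q₁ light ws⊆ s₁ =
      go (grab (B-rich j (n≤1+n j)) uB (w ∷ Y₁) (≤-reflexive (proj₁ q₁)) B-room′)
      where
      go : (∃[ ys ] IsClique d j ys × ys ⊆ B × Disj ys (w ∷ Y₁)) → ⊥
      go (ys , q , sub , dis) = two-hubs qw q₁ q light (λ v → dis v (here refl)) (λ v w → dis w (there v)) ws⊆ s₁ sub

  -- By `second-hub` it suffices to find a `b`-clique with a vertex that has few `b`-neighbours in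
  -- `X` and completes a `d`-clique of size `j` with vertices of `B`. A vertex of `ws` with many
  -- `d`-neighbours in `B` is such a vertex. If there is none, `B` contains a `d`-clique joined in
  -- `b` to all of `qs`, and one of its vertices replaces `w₀`.
  P-free : NoClique b k P
  P-free {ws@(w₀ ∷ qs)} q sub = common
      (B-rich j (n≤1+n j) (commons-unique d qs uB) (commons-⊆ d qs B)
        (commons-large qs uB (λ v → light (there v)) (subst (λ l → τ + l * suc t₄ ≤ length B)
            (sym (suc-injective (proj₁ q))) B-room)))
    where
    heavy : ∀ {w} → w ∈ ws → ¬ (t₄ ≤ length (nbrs d w B))
    heavy {w} w∈ le = go (to-front q w∈) (star w [] (B-rich h (≤-trans (n≤1+n h) (n≤1+n j))) uB z≤n
        (≤-trans (+-monoʳ-≤ τ z≤n) (≤-trans t₄-room le)))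
      where
      go : (∃[ rs ] ws ↭ w ∷ rs × IsClique b k (w ∷ rs)) → Star d h w B [] → ⊥
      go (rs , σ , qw) S = second-hub qw (centred S) (P-sparse (sub w∈)) (λ v → P⊆ (sub (∈-resp-↭ (↭-sym σ) v)))
          (leaves-⊆ S)
    light : ∀ {w} → w ∈ ws → length (nbrs d w B) ≤ t₄
    light v = <⇒≤ (≰⇒> (heavy v))
    common : (∃[ ys ] IsClique d j ys × ys ⊆ commons d qs B) → ⊥
    common (y ∷ ys , qy , ys⊆) = second-hub
      (∷-clique (suc-injective (proj₁ q) , AllPairs.tail (proj₂ q))
          (λ v → joined-comm (commons-joined b≢d (ys⊆ (here refl)) v)))
      qy (X-sparse y∈B) (∷-⊆ (B⊆ y∈B) λ v → P⊆ (sub (there v))) (λ v → commons-⊆ d qs B (ys⊆ (there v)))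
      where
      y∈B = commons-⊆ d qs B (ys⊆ (here refl))

  bad? : Decidable (λ p → t₂ ≤ length (nbrs b p Q))
  bad? p = t₂ ≤? length (nbrs b p Q)

  P-bad : List (Fin N)
  P-bad = filter bad? P

  -- Otherwise `P-bad` contains a `d`-clique. Its vertices have `b`-stars in `Q`, and those of a
  -- `b`-clique in `X` have `d`-stars in `Y₀`, so that `dense-pair` yields a gadget.
  P-bad-few : length P-bad ≤ τ
  P-bad-few = <⇒≤ (≰⇒> λ le → absurd (noClique⇒rich (≢-sym b≢d) P-free
      (τ-large k k (lin (3 * k) (z≤n {0}) (eq k))) (UP.filter⁺ bad? P-unique) (filter-⊆ bad? P) le))
    where
    eq : ∀ k → k + k + 0 + 3 * k ≡ 5 * k + 0
    eq = solve-∀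
    absurd : ¬ (∃[ ys ] IsClique d k ys × ys ⊆ P-bad)
    absurd (ys , q , sub) = no₃ (dense-pair b≢d Q-unique Y₀-unique
      (noClique⇒rich b≢d Q-free (τ-large j k (lin (3 * h + 7) (z≤n {0}) (eq₁ h)))) (complete-rich j Y₀-complete)
      (clique-of k X-complete X-unique id k≤X) q
      (λ v w → QP-disjoint (X⊆Q (take-⊆ k v)) (filter-⊆ bad? P (sub w)))
      (λ v → ≤-trans t₂-room (proj₂ (∈-filter⁻ bad? {xs = P} (sub v))))
      (λ v → ≤-trans (lin 2 (z≤n {0}) (eq₂ h)) (≤-trans (≤-reflexive (sym (proj₁ Y₀-clique)))
        (nbrs-all Y₀-unique λ w → X-hub (take-⊆ k v) w)))
      (λ v → X⊆ (take-⊆ k v)) (λ v → P⊆ (filter-⊆ bad? P (sub v))) Q⊆ (λ v → B⊆ (Y₀⊆B v)))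
      where
      eq₁ : ∀ h → (1 + h) + (2 + h) + 0 + (3 * h + 7) ≡ 5 * (2 + h) + 0
      eq₁ = solve-∀
      eq₂ : ∀ h → (1 + h) + ((1 + h) + ((2 + h) + (2 + h))) + 0 + 2 ≡ 4 * (2 + h) + 0
      eq₂ = solve-∀
      k≤X : k ≤ length X
      k≤X = ≤-trans (≤-trans (m≤m+n k _) (m≤m+n (k + j) _)) X-room

-- Apexes for the cliques in `P`, and the final count.

module Matching {N : ℕ} (c : Colouring N) {b d : Fin 2} (b≢d : b ≢ d) {j s : ℕ} {Z : List (Fin N)}
    (Z-unique : Unique Z) where

  open Cliques c
  open Tilings c

  record Match (tss : List (List (Fin N))) (used : List (Fin N)) : Set where
    constructor match
    field
      {apexes} : List (Fin N)
      unique   : Unique apexes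
      inside   : apexes ⊆ Z
      avoids   : Disj apexes used
      tiling   : Tiled d (suc j) (concat tss ++ apexes)
      number   : length apexes ≡ length tss

  match-all : ∀ tss used → All (IsClique d j) tss → (∀ {x} → x ∈ concat tss → length (nbrs b x Z) ≤ s) →
              length used + length tss + j * suc s ≤ length Z → Match tss used
  match-all [] used [] h le = match [] []-⊆ (λ ()) tiled-[] refl
  match-all (ts ∷ tss) used (q ∷ qs) h le = first (nonempty (∖-large used (commons-unique b ts Z-unique) ≤-refl
      (commons-large ts {m = 1 + length used} Z-unique (λ v → h (∈-++⁺ˡ v))
        (≤-trans (lin (length tss) (z≤n {0}) (eq (length used) (length tss) (proj₁ q))) le))))
    where
    eq′ : ∀ u l x → 1 + u + x + 0 + l ≡ u + suc l + x + 0
    eq′ = solve-∀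
    eq : ∀ u l {x} → x ≡ j → 1 + u + x * suc s + 0 + l ≡ u + suc l + j * suc s + 0
    eq u l refl = eq′ u l (j * suc s)
    first : (∃[ z ] z ∈ commons b ts Z ∖ used) → Match (ts ∷ tss) used
    first (z , z∈) = more (match-all tss (z ∷ used) qs (λ v → h (∈-++⁺ʳ ts v))
        (≤-trans (≤-reflexive (cong (_+ j * suc s) (sym (+-suc (length used) (length tss))))) le))
      where
      z∈′ = ∖-⊆ (commons b ts Z) used z∈
      more : Match tss (z ∷ used) → Match (ts ∷ tss) used
      more (match {as} u sub av t num) = match
        (∷-unique (λ v → av v (here refl)) u)
        (∷-⊆ (commons-⊆ b ts Z z∈′) sub)
        (disj-∷ˡ (∖-∉ (commons b ts Z) used z∈) λ v w → av v (there w))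
        (tiled-↭ σ (tiled-++ (tiled-clique (∷-clique q λ v → joined-comm (commons-joined (≢-sym b≢d) z∈′ v))) t))
        (cong suc num)
        where
        σ : (z ∷ ts) ++ (concat tss ++ as) ↭ (ts ++ concat tss) ++ (z ∷ as)
        σ = ↭-trans (↭-reflexive (cong (z ∷_) (sym (++-assoc ts (concat tss) as))))
            (↭-sym (shift z (ts ++ concat tss) as))

module _ {A : Set} where

  concat-filter : ∀ {P : List A → Set} (P? : Decidable P) tss →
                  concat tss ↭ concat (filter P? tss) ++ concat (filter (λ ts → ¬? (P? ts)) tss)
  concat-filter P? [] = ↭-refl
  concat-filter P? (ts ∷ tss) with P? ts
  ... | yes _ = ↭-trans (↭-++⁺ˡ ts (concat-filter P? tss)) (↭-reflexive (sym (++-assoc ts _ _)))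
  ... | no _  = ↭-trans (↭-++⁺ˡ ts (concat-filter P? tss)) (shifts ts (concat (filter P? tss)))

  -- Serves to show that at most as many disjoint tiles meet the exceptional set as it has vertices.
  representatives : ∀ tss {bs : List A} → Unique (concat tss) → (∀ {ts} → ts ∈ tss → ∃[ x ] x ∈ ts × x ∈ bs) →
                    ∃[ ps ] length ps ≡ length tss × Unique ps × ps ⊆ bs × ps ⊆ concat tss
  representatives [] u h = [] , refl , [] , []-⊆ , []-⊆
  representatives (ts ∷ tss) {bs} u h =
    extend (h (here refl)) (representatives tss (proj₁ (proj₂ (unique-++⁻ ts u))) (λ v → h (there v)))
    where
    extend : (∃[ x ] x ∈ ts × x ∈ bs) → (∃[ ps ] length ps ≡ length tss × Unique ps × ps ⊆ bs × ps ⊆ concat tss) →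
             ∃[ ps ] length ps ≡ suc (length tss) × Unique ps × ps ⊆ bs × ps ⊆ ts ++ concat tss
    extend (x , p , q) (ps , l , ups , sub , sub′) = x ∷ ps , cong suc l ,
      ∷-unique (λ v → proj₂ (proj₂ (unique-++⁻ ts u)) p (sub′ v)) ups ,
      ∷-⊆ q sub , ∷-⊆ (∈-++⁺ˡ p) (λ v → ∈-++⁺ʳ ts (sub′ v))

module Endgame {N : ℕ} (c : Colouring N) {b d : Fin 2} (b≢d : b ≢ d) {h τ t₁ t₂ n R : ℕ}
    {xs X Q P bads : List (Fin N)}
  (τ-large : ∀ r s → r + s ≤ 5 * (2 + h) → 2 ^ (r + s) ≤ τ)
  (uxs : Unique xs) (X-unique : Unique X) (Q-unique : Unique Q) (P-unique : Unique P)
  (X⊆Q : X ⊆ Q) (Q⊆ : Q ⊆ xs) (P⊆ : P ⊆ xs) (QP-disjoint : Disj Q P) (split : length xs ≡ length Q + length P)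
  (X-complete : Cliques.Complete c b X) (Q-free : Cliques.NoClique c d (2 + h) Q)
      (P-free : Cliques.NoClique c b (2 + h) P)
  (Q-dense : ∀ {v} → v ∈ Q → t₁ ≤ length (Cliques.nbrs c b v X))
  (P-sparse : ∀ {v} → v ∈ P → length (Cliques.nbrs c b v X) ≤ t₁)
  (P-sparse′ : ∀ {v} → v ∈ P → v ∉ bads → length (Cliques.nbrs c b v Q) ≤ t₂) (bads-few : length bads ≤ τ)
  (tiling : n * (1 + h) + R ≤ length P → ¬ ¬ Tilings.Packing c d (1 + h) n P)
  (no-b : ¬ Tilings.Packing c b (2 + h) n xs) (no-d : ¬ Tilings.Packing c d (2 + h) n xs)
  (total : n * (2 + h) + n * (1 + h) + R ≤ length xs + 1)
  (cover-room : (1 + h) + τ * (1 + h) ≤ t₁) (X-room : τ + (1 + h) * suc t₁ ≤ length X)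
  where

  open Cliques c
  open Tilings c
  open Gadgets c
  open Stars c

  private
    -- `W` is the excess of `|Q|` over the number of tiles that `apexes` requires: `X` is set aside
    -- for the tiles that meet a bad vertex, and any other tile may rule out up to `j * suc t₂`
    -- vertices.
    k j W : ℕ
    k = 2 + h
    j = 1 + h
    W = length X + j * suc t₂

    rich-Q : Rich b k τ Q
    rich-Q = noClique⇒rich b≢d Q-free (τ-large k k (lin (3 * k) (z≤n {0}) (eq k)))
      where
      eq : ∀ k → k + k + 0 + 3 * k ≡ 5 * k + 0
      eq = solve-∀

    rich-P : ∀ s → s ≤ k → Rich d s τ P
    rich-P s s≤ = noClique⇒rich (≢-sym b≢d) P-free (τ-large s k
        (≤-trans (+-monoˡ-≤ k s≤) (lin (3 * k) (z≤n {0}) (eq k))))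
      where
      eq : ∀ k → k + k + 0 + 3 * k ≡ 5 * k + 0
      eq = solve-∀

  -- X is a clique, so it completes the vertices left over by a greedy tiling and is tiled up to a remainder.
  pack-Q : n * k ≤ length Q → Packing b k n Q
  pack-Q le = step₁ (greedy (Rich-mono (n≤1+n τ) (Rich-⊆ (∖-⊆ Q X) rich-Q)) (∖-unique X Q-unique))
    where
    step₁ : (∃[ ys ] ∃[ us ] Tiled b k ys × Q ∖ X ↭ ys ++ us × length us ≤ τ) → Packing b k n Q
    step₁ (ys , us , tys , σ , us≤) = step₂ (C.cover-all us []
        (λ v → Q-dense (∖-⊆ Q X (∈-resp-↭ (↭-sym σ) (∈-++⁺ʳ ys v))))
        (≤-trans (+-monoʳ-≤ j (*-monoˡ-≤ j us≤)) cover-room))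
      where
      module C = Covering c {t = t₁} X-unique (complete-rich j X-complete)
      step₂ : C.Cover us [] → Packing b k n Q
      step₂ (C.cover {ws} uw ws⊆ _ tus) = step₃ (greedy (complete-rich k λ v w → X-complete (∖-⊆ X ws v)
          (∖-⊆ X ws w)) (∖-unique ws X-unique))
        where
        step₃ : (∃[ ys ] ∃[ us ] Tiled b k ys × X ∖ ws ↭ ys ++ us × length us ≤ j) → Packing b k n Q
        step₃ (ys′ , rs , tys′ , ρ , rs≤) = pack-from {ys = T} tT
            (proj₁ (unique-++⁻ T (Unique-resp-↭ π Q-unique))) (λ v → ∈-resp-↭ (↭-sym π) (∈-++⁺ˡ v))
            (tiled-whole {n = n} tT (≤-trans le (≤-trans (≤-reflexive (trans (↭-length π) (length-++ T)))
                (+-monoʳ-≤ (length T) rs≤))))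
          where
          T : List (Fin N)
          T = (us ++ ws) ++ (ys ++ ys′)
          tT : Tiled b k T
          tT = tiled-++ tus (tiled-++ tys tys′)
          tidy : ∀ (ws ys′ rs ys us : List (Fin N)) → (ws ++ (ys′ ++ rs)) ++ (ys ++ us) ↭
              ((us ++ ws) ++ (ys ++ ys′)) ++ rs
          tidy = perm 5 (λ ws ys′ rs ys us → ((ws ⊎⁺ (ys′ ⊎⁺ rs)) ⊎⁺ (ys ⊎⁺ us)) ⊜
              (((us ⊎⁺ ws) ⊎⁺ (ys ⊎⁺ ys′)) ⊎⁺ rs)) ↭-refl
            where open PermSolver
          π : Q ↭ T ++ rs
          π = ↭-trans (∖-split Q-unique X-unique X⊆Q)
            (↭-trans (↭-++⁺ (↭-trans (∖-split X-unique uw ws⊆) (↭-++⁺ˡ ws ρ)) σ) (tidy ws ys′ rs ys us))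

  Q-small : suc (length Q) ≤ n * k
  Q-small = ≰⇒> λ le → no-b (pack-⊆ Q⊆ (pack-Q le))

  -- Tiles meeting a bad vertex receive their apex in X, all others outside X.
  apexes : ∀ {m P′} → P′ ⊆ P → Packing d j m P′ → m + W ≤ length Q → ∀ {zs} → P′ ⊆ zs → Q ⊆ zs → Packing d k m zs
  apexes {m} {P′} P′⊆ (packing {ys} (tss , qs , σ) u sub l) le {zs} P′⊆zs Q⊆zs =
    conclude (MX.match-all Bs [] (AllP.filter⁺ bad? qs) (λ v → P-sparse (inP (filter-concat bad? v))) X-enough)
             (MQ.match-all Gs [] (AllP.filter⁺ (λ ts → ¬? (bad? ts)) qs) good-sparse Q-enough)
    where
    open DecMembership (_≟_ {N}) using (_∈?_)
    module MX = Matching c b≢d {j} {t₁} X-unique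
    module MQ = Matching c b≢d {j} {t₂} (∖-unique X Q-unique)
    bad? : Decidable (λ ts → Any (_∈ bads) ts)
    bad? = Any.any? (_∈? bads)
    Bs Gs : List (List (Fin N))
    Bs = filter bad? tss
    Gs = filter (λ ts → ¬? (bad? ts)) tss
    u′ : Unique (concat tss)
    u′ = Unique-resp-↭ (↭-sym σ) u
    number : length tss ≡ m
    number = *-cancelʳ-≡ (length tss) m j (trans (sym (concat-length tss qs)) (trans (↭-length σ) l))
    inP : ∀ {x} → x ∈ concat tss → x ∈ P
    inP v = P′⊆ (sub (∈-resp-↭ σ v))
    filter-concat : ∀ {R : List (Fin N) → Set} (R? : Decidable R) {x} → x ∈ concat (filter R? tss) → x ∈ concat tss
    filter-concat R? v with ∈-concat⁻′ (filter R? tss) v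
    ... | ts , p , q = ∈-concat⁺′ p (filter-⊆ R? tss q)
    parts = unique-++⁻ (concat Bs) (Unique-resp-↭ (concat-filter bad? tss) u′)
    Bs-few : length Bs ≤ τ
    Bs-few = few (representatives Bs (proj₁ parts) λ {ts} v → find (proj₂ (∈-filter⁻ bad? {xs = tss} v)))
      where
      few : (∃[ ps ] length ps ≡ length Bs × Unique ps × ps ⊆ bads × ps ⊆ concat Bs) → length Bs ≤ τ
      few (ps , l , ups , ps⊆ , _) = ≤-trans (≤-reflexive (sym l)) (≤-trans (unique-⊆-length ups ps⊆) bads-few)
    X-enough : length Bs + j * suc t₁ ≤ length X
    X-enough = ≤-trans (+-monoˡ-≤ (j * suc t₁) Bs-few) X-room
    good-sparse : ∀ {x} → x ∈ concat Gs → length (nbrs b x (Q ∖ X)) ≤ t₂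
    good-sparse {x} v = ≤-trans (nbrs-mono (∖-unique X Q-unique) (∖-⊆ Q X))
        (P-sparse′ (inP (filter-concat _ v)) not-bad)
      where
      not-bad : x ∉ bads
      not-bad w with ∈-concat⁻′ Gs v
      ... | ts , p , q = proj₂ (∈-filter⁻ (λ ts → ¬? (bad? ts)) {xs = tss} q) (lose p w)
    split-number : length Bs + length Gs ≡ m
    split-number = trans (sym (trans (↭-length (filter-split bad? tss)) (length-++ Bs))) number
    Q-enough : length Gs + j * suc t₂ ≤ length (Q ∖ X)
    Q-enough = +-cancelˡ-≤ (length X) _ _ (≤-trans (lin (length Bs)
        (≤-trans (≤-reflexive (cong (_+ W) split-number)) le)
        (eq (length X) (length Gs) (length Bs) (j * suc t₂) (length Q))) (∖-length X Q-unique))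
      where
      eq : ∀ x g b w q → x + (g + w) + q + b ≡ q + (b + g + (x + w))
      eq = solve-∀
    conclude : MX.Match Bs [] → MQ.Match Gs [] → Packing d k m zs
    conclude (MX.match {as} ua as⊆ _ ta na) (MQ.match {es} ue es⊆ _ te ne) = packing
      (tiled-↭ π (tiled-++ ta te))
      (++-unique u (++-unique ua ue λ v w → ∖-∉ Q X (es⊆ w) (as⊆ v))
        λ v w → QP-disjoint ([ (λ p → X⊆Q (as⊆ p)) , (λ p → ∖-⊆ Q X (es⊆ p)) ]′ (∈-++⁻ as w)) (P′⊆ (sub v)))
      (++-⊆ (λ v → P′⊆zs (sub v)) (++-⊆ (λ v → Q⊆zs (X⊆Q (as⊆ v))) (λ v → Q⊆zs (∖-⊆ Q X (es⊆ v)))))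
      (trans (length-++ ys) (trans (cong₂ _+_ l (trans (length-++ as) (trans (cong₂ _+_ na ne) split-number)))
        (trans (+-comm (m * j) m) (sym (*-suc m j)))))
      where
      π : (concat Bs ++ as) ++ (concat Gs ++ es) ↭ ys ++ (as ++ es)
      π = ↭-trans (↭-interchange (concat Bs) as (concat Gs) es)
            (↭-++⁺ʳ (as ++ es) (↭-trans (↭-sym (concat-filter bad? tss)) σ))

  -- If Q cannot supply n apexes, then P is so large that S₀ whole k-cliques can be cut out of it first.
  impossible : 2 * W + 3 * τ ≤ n → ⊥
  impossible n-large with n + W ≤? length Q
  ... | yes le = tiling P-large λ p → no-d (apexes id p le P⊆ Q⊆)
    where
    -- The 1 that is missing in `total` is returned by the strict inequality `|Q| < n k`; the slack
    -- is 0.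
    P-large : n * j + R ≤ length P
    P-large = lin 0 (Q-small ⊕ total ⊕ ≤-reflexive split) (eq (n * j) (n * k) R (length xs) (length Q) (length P))
      where
      eq : ∀ nj nk R x q p → nj + R + (nk + (x + 1 + (q + p))) + 0 ≡ p + (suc q + (nk + nj + R + x))
      eq = solve-∀
  ... | no Q≱ = no-d (fallback (pack-greedy {n = S₀} (rich-P k ≤-refl) P-unique S₀-room))
    where
    -- Since `P` has fewer than `n k + τ` vertices, `|Q| ≥ n j + R − τ ≥ n − τ`. With `S₀ = W + τ`
    -- the demand `n′ + W` on `Q` is exactly `n − τ`.
    S₀ n′ : ℕ
    S₀ = W + τ
    n′ = n ∸ S₀
    n-split : S₀ + n′ ≡ n
    n-split = m+[n∸m]≡n {S₀} {n} (lin (W + 2 * τ) n-large (eq W τ n))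
      where
      eq : ∀ w t n → w + t + n + (w + 2 * t) ≡ n + (2 * w + 3 * t)
      eq = solve-∀
    n≤nj : n ≤ n * j
    n≤nj = ≤-trans (≤-reflexive (sym (*-identityʳ n))) (*-monoʳ-≤ n (s≤s z≤n))
    P-bounded : suc (length P) ≤ n * k + τ
    P-bounded = ≰⇒> λ le → no-d (pack-⊆ P⊆ (pack-greedy {n = n} (rich-P k ≤-refl) P-unique le))
    n-parts : n * j ≡ S₀ * j + n′ * j
    n-parts = trans (cong (_* j) (sym n-split)) (*-distribʳ-+ j S₀ n′)
    -- From `|Q| < n + W` follows `|P| ≥ 2 n j + R − W`. The left side equals
    -- `n j + S₀ + τ = n j + W + 2 τ`, and `n j ≥ 2 W + 3 τ`.
    room : (n′ * j + τ) + S₀ * k ≤ length P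
    room = ≤-trans (≤-reflexive (trans (cong (n′ * j + τ +_) (*-suc S₀ j))
        (trans (eq′ (n′ * j) τ S₀ (S₀ * j)) (cong (λ z → z + (S₀ + τ)) (sym n-parts)))))
      (lin (R + τ) (total ⊕ ≰⇒> Q≱ ⊕ n≤nj ⊕ n-large ⊕ ≤-reflexive split)
        (trans (eq n (n * j) W τ R (length xs) (length Q) (length P))
            (cong (λ z → length P + (z + n * j + R + (suc (length Q) + (n + (2 * W + 3 * τ + length xs)))))
                (sym (*-suc n j)))))
      where
      eq′ : ∀ a t s b → a + t + (s + b) ≡ (b + a) + (s + t)
      eq′ = solve-∀
      eq : ∀ n nj w t R x q p → nj + ((w + t) + t) + (x + 1 + ((n + w) + (nj + (n + (q + p))))) + (R + t) ≡
                                p + ((n + nj) + nj + R + (suc q + (n + (2 * w + 3 * t + x))))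
      eq = solve-∀
    S₀-room : S₀ * k + τ ≤ length P
    S₀-room = ≤-trans (lin (n′ * j) (z≤n {0}) (eq (S₀ * k) τ (n′ * j))) room
      where
      eq : ∀ a t b → a + t + 0 + b ≡ b + t + a + 0
      eq = solve-∀
    Q-enough : n′ + W ≤ length Q
    Q-enough = +-cancelʳ-≤ τ _ _ (≤-trans (≤-reflexive (trans (eq n′ W τ) n-split))
      (lin R (total ⊕ P-bounded ⊕ n≤nj ⊕ ≤-reflexive split) (eq′ n (n * j) (n * k) τ R (length xs) (length Q)
          (length P))))
      where
      eq : ∀ a w t → a + w + t ≡ w + t + a
      eq = solve-∀
      eq′ : ∀ n nj nk t R x q p → n + (x + 1 + ((nk + t) + (nj + (q + p)))) + R ≡ q + t +
          (nk + nj + R + (suc p + (n + x)))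
      eq′ = solve-∀
    fallback : Packing d k S₀ P → Packing d k n xs
    fallback S = subst (λ z → Packing d k z xs) n-split
      (pack-join {m = S₀} {n = n′} (λ v → P⊆ (inside S v)) (packing (tiled S) (unique S) id (size S))
        (apexes {n′} (∖-⊆ P (tiles S))
          (pack-greedy {n = n′} (Rich-⊆ (∖-⊆ P (tiles S)) (rich-P j (n≤1+n j))) (∖-unique (tiles S) P-unique)
              (∖-large (tiles S) P-unique (≤-reflexive (size S)) room))
          Q-enough
          (λ v → ∈-∖ (tiles S) (P⊆ (∖-⊆ P (tiles S) v)) (∖-∉ P (tiles S) v))
          (λ v → ∈-∖ (tiles S) (Q⊆ v) λ w → QP-disjoint v (inside S w))))

-- Colourings without gadgets are contradictory; induction on the missing surplus.

-- `τ` is the Ramsey threshold for clique sizes of sum at most `5 k`; `t₁` separates `Q` from `P` by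
-- the number of neighbours in `X`; `t₂` bounds the rare colour between `A` and `B` and defines the
-- bad vertices of `P`; `t₄` is a degree into `B`; `X` consists of `m` tiles. The second half is for
-- `Descent`: a leftover vertex is heavy with `t` neighbours in the reserve of `l` vertices, and `e`
-- counts the halvings.
record Constants (h n : ℕ) : Set where
  field
    τ t₁ t₂ t₄ m : ℕ
    τ-large     : ∀ r s → r + s ≤ 5 * (2 + h) → 2 ^ (r + s) ≤ τ
    t₂≤t₁       : t₂ ≤ t₁
    stars-room  : (1 + h) + ((1 + h) + (2 + h)) ≤ t₁
    cover-room  : (1 + h) + τ * (1 + h) ≤ t₁
    X-room      : ((2 + h) + (1 + h)) + (2 * (1 + h)) * suc t₁ ≤ m * (2 + h)
    X-room′     : τ + (1 + h) * suc t₁ ≤ m * (2 + h)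
    t₄-room     : τ + (2 + h) ≤ t₄
    t₂-room     : τ + ((1 + h) + ((2 + h) + (2 + h))) ≤ t₂
    size₁       : ((m * (2 + h) + τ) + (4 * (2 + h)) * suc t₂) + τ + τ + 1 ≤ n
    size₂       : (τ + (1 + h) * suc t₄) + τ + τ + 1 ≤ n
    size₃       : 2 * (m * (2 + h) + (1 + h) * suc t₂) + 3 * τ ≤ n
    t l used Λ e Q : ℕ
    cover-room′ : τ + τ * h ≤ t
    common-room : 1 + (1 + h) * suc t ≤ l
    cost        : l + τ * ((1 + h) + (1 + h) * (suc l * ((1 + h) + (1 + h)))) ≤ used
    Λ-large     : 1 + (τ + (l + used)) ≤ Λ
    k≤2^e       : (2 + h) ≤ 2 ^ e
    2^e≤Q       : 2 ^ e ≤ Q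
    size₄       : Λ * (6 * (Q * Q)) ^ e ≤ n

module Gainless {N : ℕ} (c : Colouring N) {h n R : ℕ} (C : Constants h n) {xs : List (Fin N)} (uxs : Unique xs)
  (no₂ : ¬ Gadgets.Gadget c (2 + h) 2 1 xs) (no₃ : ¬ Gadgets.Gadget c (2 + h) 3 1 xs)
  (no-pack : ∀ b → ¬ Tilings.Packing c b (2 + h) n xs)
  (mono : ∀ {b d} → b ≢ d → ∀ {zs} → Unique zs → suc R ≤ length zs →
          (∃[ ys ] Cliques.IsClique c b (1 + h) ys × ys ⊆ zs) ⊎ (∃[ ys ] Cliques.IsClique c d (1 + h) ys × ys ⊆ zs))
  (total : n * (2 + h) + n * (1 + h) + R ≤ length xs + 1)
  where

  open Cliques c
  open Tilings c
  open Gadgets c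
  open Stars c
  open Constants C

  private
    k j : ℕ
    k = 2 + h
    j = 1 + h

  NoClique-mono : ∀ {b r s ys} → r ≤ s → NoClique b r ys → NoClique b s ys
  NoClique-mono {r = r} le none q sub = none (take-clique r le q) λ v → sub (take-⊆ r v)

  module Hubs {b d : Fin 2} (b≢d : b ≢ d) {B Y₀ X : List (Fin N)}
    (uB : Unique B) (B⊆ : B ⊆ xs) (B-free : NoClique b k B)
    (Y₀-clique : IsClique d (4 * k) Y₀) (Y₀⊆B : Y₀ ⊆ B)
    (X-unique : Unique X) (X⊆ : X ⊆ xs) (X-length : length X ≡ m * k) (X-complete : Complete b X)
    (X-hub : ∀ {x y} → x ∈ X → y ∈ Y₀ → Joined c d x y)
    (X-sparse : ∀ {y} → y ∈ B → length (nbrs b y X) ≤ t₁)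
    (B-room : τ + j * suc t₄ ≤ length B) where

    B-room′ : τ + j ≤ length B
    B-room′ = ≤-trans (+-monoʳ-≤ τ (≤-trans (≤-reflexive (sym (*-identityʳ j))) (*-monoʳ-≤ j (s≤s z≤n)))) B-room

    private
      module Co = Core c b≢d {h} {τ} {t₁} {t₂} {t₄} no₂ no₃ τ-large uxs uB B⊆ B-free Y₀-clique Y₀⊆B X-unique X⊆
          X-complete X-hub X-sparse
        stars-room (≤-trans X-room (≤-reflexive (sym X-length))) t₄-room B-room B-room′ t₂-room

    -- The colours change roles here: the tiles have colour `d`, and the clique whose size is halved
    -- has colour `b`. The double negation comes from `descend`, which only refutes the absence of a
    -- packing.
    tiling : n * j + R ≤ length Co.P → ¬ ¬ Packing d j n Co.P
    tiling size none = Descent.descend c (≢-sym b≢d) {h} {τ} {R} {t} {l} {used} {Λ} {Q} Co.P-unique Co.P-free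
      (λ s s≤ → noClique⇒rich (≢-sym b≢d) Co.P-free (τ-large s k
          (≤-trans (+-monoˡ-≤ k s≤) (lin (7 + 3 * h) (z≤n {0}) (eq h)))))
      (mono (≢-sym b≢d)) cover-room′ common-room cost Λ-large {n} size none e 2^e≤Q Co.P-unique id
      (NoClique-mono k≤2^e Co.P-free)
      (≤-trans size₄ (≤-trans (≤-trans (≤-reflexive (sym (*-identityʳ n))) (*-monoʳ-≤ n (s≤s z≤n)))
          (≤-trans (m≤m+n (n * j) R) size)))
      where
      eq : ∀ h → 1 + h + (2 + h) + 0 + (7 + 3 * h) ≡ 5 * (2 + h) + 0
      eq = solve-∀

    impossible : ⊥
    impossible = Endgame.impossible c b≢d {h} {τ} {t₁} {t₂} {n} {R} {xs} {X} {Co.Q} {Co.P} {Co.P-bad}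
      τ-large uxs X-unique Co.Q-unique Co.P-unique Co.X⊆Q Co.Q⊆ Co.P⊆ Co.QP-disjoint Co.QP-split
      X-complete Co.Q-free Co.P-free Co.Q-dense Co.P-sparse
      (λ v w → <⇒≤ (≰⇒> λ le → w (∈-filter⁺ Co.bad? v le))) Co.P-bad-few tiling (no-pack b) (no-pack d) total
      cover-room (≤-trans X-room′ (≤-reflexive (sym X-length)))
      (subst (λ z → 2 * (z + j * suc t₂) + 3 * τ ≤ n) (sym X-length) size₃)

  one-sided : ∀ {b d} → b ≢ d → ∀ {A B} → Unique A → Unique B → A ⊆ xs → B ⊆ xs → NoClique d k A → NoClique b k B →
              (∀ {y} → y ∈ B → length (nbrs b y A) ≤ t₂) →
              (m * k + τ) + (4 * k) * suc t₂ ≤ length A → τ + j * suc t₄ ≤ length B → ⊥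
  one-sided b≢d {A} {B} uA uB A⊆ B⊆ A-free B-free sparse A-large B-large =
    Hubs.impossible b≢d uB B⊆ B-free S.Y₀-clique S.Y₀⊆B S.X-unique S.X⊆ S.X-length S.X-complete S.X-hub
      (λ v → ≤-trans (S.X-sparse v) t₂≤t₁) B-large
    where
    module S = Seed c b≢d {h} {τ} {t₂} {m} no₂ τ-large uA uB A⊆ B⊆ A-free B-free sparse
        (≤-trans (m≤m+n τ _) B-large) A-large

  -- If `A` had many vertices with many `d`-neighbours in `B`, and `B` many with many `b`-neighbours
  -- in `A`, then a `b`-clique among the former and a `d`-clique among the latter would satisfy
  -- `dense-pair`. So one exceptional set is small, and without it one of the two colours is rare;
  -- the two cases differ by exchanging `A` with `B` and `b` with `d`.
  two-sided : ∀ {b d} → b ≢ d → ∀ {A B} → Unique A → Unique B → A ⊆ xs → B ⊆ xs → Disj A B → NoClique d k A →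
      NoClique b k B →
              ((m * k + τ) + (4 * k) * suc t₂) + τ ≤ length A → (τ + j * suc t₄) + τ ≤ length A →
              ((m * k + τ) + (4 * k) * suc t₂) + τ ≤ length B → (τ + j * suc t₄) + τ ≤ length B → ⊥
  two-sided {b} {d} b≢d {A} {B} uA uB A⊆ B⊆ dis A-free B-free A₁ A₂ B₁ B₂ = cases (τ ≤? length Br) (τ ≤? length Ad)
    where
    heavyA? : Decidable (λ a → t₂ ≤ length (nbrs d a B))
    heavyA? a = t₂ ≤? length (nbrs d a B)
    heavyB? : Decidable (λ y → t₂ ≤ length (nbrs b y A))
    heavyB? y = t₂ ≤? length (nbrs b y A)
    Ad Br : List (Fin N)
    Ad = filter heavyA? A
    Br = filter heavyB? B
    rich-A : ∀ s → s ≤ k → Rich b s τ A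
    rich-A s s≤ = noClique⇒rich b≢d A-free (τ-large s k (≤-trans (+-monoˡ-≤ k s≤) (lin (3 * k) (z≤n {0}) (eq k))))
      where
      eq : ∀ k → k + k + 0 + 3 * k ≡ 5 * k + 0
      eq = solve-∀
    rich-B : ∀ s → s ≤ k → Rich d s τ B
    rich-B s s≤ = noClique⇒rich (≢-sym b≢d) B-free (τ-large s k
        (≤-trans (+-monoˡ-≤ k s≤) (lin (3 * k) (z≤n {0}) (eq k))))
      where
      eq : ∀ k → k + k + 0 + 3 * k ≡ 5 * k + 0
      eq = solve-∀
    cases : Dec (τ ≤ length Br) → Dec (τ ≤ length Ad) → ⊥
    cases (no few) _ = one-sided b≢d uA (∖-unique Br uB) A⊆ (λ v → B⊆ (∖-⊆ B Br v)) A-free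
        (NoClique-⊆ (∖-⊆ B Br) B-free)
      (λ v → <⇒≤ (≰⇒> λ le → ∖-∉ B Br v (∈-filter⁺ heavyB? (∖-⊆ B Br v) le)))
      (≤-trans (m≤m+n _ τ) A₁) (∖-large Br uB (<⇒≤ (≰⇒> few)) B₂)
    cases (yes _) (no few) = one-sided (≢-sym b≢d) uB (∖-unique Ad uA) B⊆ (λ v → A⊆ (∖-⊆ A Ad v)) B-free
        (NoClique-⊆ (∖-⊆ A Ad) A-free)
      (λ v → <⇒≤ (≰⇒> λ le → ∖-∉ A Ad v (∈-filter⁺ heavyA? (∖-⊆ A Ad v) le)))
      (≤-trans (m≤m+n _ τ) B₁) (∖-large Ad uA (<⇒≤ (≰⇒> few)) A₂)
    cases (yes many) (yes many′) = build (rich-A k ≤-refl (UP.filter⁺ heavyA? uA) (filter-⊆ heavyA? A) many′)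
                                         (rich-B k ≤-refl (UP.filter⁺ heavyB? uB) (filter-⊆ heavyB? B) many)
      where
      build : (∃[ ys ] IsClique b k ys × ys ⊆ Ad) → (∃[ ys ] IsClique d k ys × ys ⊆ Br) → ⊥
      build (X , qX , X⊆) (Y , qY , Y⊆) = no₃ (dense-pair b≢d uA uB (rich-A j (n≤1+n j)) (rich-B j (n≤1+n j)) qX qY
        (λ v w → dis (filter-⊆ heavyA? A (X⊆ v)) (filter-⊆ heavyB? B (Y⊆ w)))
        (λ v → ≤-trans t₂-room (proj₂ (∈-filter⁻ heavyB? {xs = B} (Y⊆ v))))
        (λ v → ≤-trans t₂-room (proj₂ (∈-filter⁻ heavyA? {xs = A} (X⊆ v))))
        (λ v → A⊆ (filter-⊆ heavyA? A (X⊆ v))) (λ v → B⊆ (filter-⊆ heavyB? B (Y⊆ v))) A⊆ B⊆)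

  contradictory : ⊥
  contradictory = extract (suc zero) n uxs (no-pack (suc zero)) λ {A} uA A⊆ A-free A-size →
    extract zero n uxs (no-pack zero) λ {B} uB B⊆ B-free B-size → finish uA A⊆ A-free A-size uB B⊆ B-free B-size
    where
    0≢1 : zero ≢ suc {1} zero
    0≢1 ()
    module _ {A B : List (Fin N)} (uA : Unique A) (A⊆ : A ⊆ xs) (A-free : NoClique (suc zero) k A)
        (A-size : length xs ≤ length A + n * k)
             (uB : Unique B) (B⊆ : B ⊆ xs) (B-free : NoClique zero k B) (B-size : length xs ≤ length B + n * k) where
      open DecMembership (_≟_ {N}) using (_∈?_)
      -- The intersection of `A` and `B` contains no `k`-clique of either colour and is therefore
      -- small; it is cut out of `B` to make the two sets disjoint.
      I : List (Fin N)
      I = filter (_∈? A) B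
      I-few : length I ≤ τ
      I-few = <⇒≤ (≰⇒> λ le → absurd (noClique⇒rich 0≢1 {xs = A} A-free (τ-large k k (lin (3 * k) (z≤n {0}) (eq k)))
          (UP.filter⁺ (_∈? A) uB) (λ v → proj₂ (∈-filter⁻ (_∈? A) {xs = B} v)) le))
        where
        eq : ∀ k → k + k + 0 + 3 * k ≡ 5 * k + 0
        eq = solve-∀
        absurd : ¬ (∃[ ys ] IsClique zero k ys × ys ⊆ I)
        absurd (ys , q , sub) = B-free q λ v → filter-⊆ (_∈? A) B (sub v)
      large : ∀ {Z s} → length xs ≤ length Z + n * k → s + 1 ≤ n → s ≤ length Z
      large {Z} {s} le s≤ = lin (R + n * h) (le ⊕ s≤ ⊕ total) (
        (eq s (length Z) (n * k) n (length xs) R h))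
        where
        eq : ∀ s z nk n x R h → s + (z + nk + (n + (x + 1))) + (R + n * h) ≡ z +
            (x + (s + 1 + (nk + n * (1 + h) + R)))
        eq = solve-∀
      finish : ⊥
      finish = two-sided 0≢1 uA (∖-unique I uB) A⊆ (λ v → B⊆ (∖-⊆ B I v))
        (λ v w → ∖-∉ B I w (∈-filter⁺ (_∈? A) (∖-⊆ B I w) v)) A-free (NoClique-⊆ (∖-⊆ B I) B-free)
        (≤-trans (m≤m+n _ τ) (large {A} A-size size₁)) (≤-trans (m≤m+n _ τ) (large {A} A-size size₂))
        (∖-large I uB I-few (large {B} B-size size₁)) (∖-large I uB I-few (large {B} B-size size₂))

module Induction {N : ℕ} (c : Colouring N) {h R τ c₀ n₀ : ℕ}
  (τ-large : ∀ r s → r + s ≤ 5 * (2 + h) → 2 ^ (r + s) ≤ τ)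
  (c₀-large : τ + (2 + h) * suc τ + 1 ≤ c₀)
  (constants : ∀ n → n₀ ≤ n → Constants h n) (1≤n₀ : 1 ≤ n₀)
  (mono : ∀ {b d} → b ≢ d → ∀ {zs} → Unique zs → suc R ≤ length zs →
          (∃[ ys ] Cliques.IsClique c b (1 + h) ys × ys ⊆ zs) ⊎ (∃[ ys ] Cliques.IsClique c d (1 + h) ys × ys ⊆ zs))
  where

  open Cliques c
  open Tilings c
  open Gadgets c
  open Stars c

  private
    k j : ℕ
    k = 2 + h
    j = 1 + h

  -- Let `X` be a `b`-clique in `A`. A vertex of `X` with many `d`-neighbours in `B` is the centre
  -- of a `d`-star there, which makes a bowtie. Otherwise some `d`-clique in `B` is joined to all of
  -- `X` in `b`, and one of its vertices replaces a vertex of `X` and becomes the shared one.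
  find-bowtie : ∀ {b d xs A B} → b ≢ d → Unique A → Unique B → A ⊆ xs → B ⊆ xs → NoClique d k A → NoClique b k B →
                τ + k * suc τ ≤ length A → τ + k * suc τ ≤ length B → ¬ Gadget k 1 0 xs → ⊥
  find-bowtie {b} {d} {xs} {A} {B} b≢d uA uB A⊆ B⊆ A-free B-free A-large B-large none =
    from-X (noClique⇒rich b≢d A-free (τ-large k k (lin (3 * k) (z≤n {0}) (eq k))) uA id (≤-trans (m≤m+n τ _) A-large))
    where
    eq : ∀ k → k + k + 0 + 3 * k ≡ 5 * k + 0
    eq = solve-∀
    rich-B : ∀ s → s ≤ k → Rich d s τ B
    rich-B s s≤ = noClique⇒rich (≢-sym b≢d) B-free (τ-large s k
        (≤-trans (+-monoˡ-≤ k s≤) (lin (3 * k) (z≤n {0}) (eq k))))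
    from-X : (∃[ X ] IsClique b k X × X ⊆ A) → ⊥
    from-X (X@(x₀ ∷ X′) , q , X⊆) = from-Y (rich-B k ≤-refl (commons-unique d X uB) (commons-⊆ d X B)
        (commons-large X uB light (subst (λ z → τ + z * suc τ ≤ length B) (sym (proj₁ q)) B-large)))
      where
      heavy : ∀ {x} → x ∈ X → ¬ (τ ≤ length (nbrs d x B))
      heavy {x} x∈ le = at-x (to-front q x∈) (star x [] (rich-B j (n≤1+n j)) uB z≤n
          (≤-trans (≤-reflexive (+-identityʳ τ)) le))
        where
        at-x : (∃[ rs ] X ↭ x ∷ rs × IsClique b k (x ∷ rs)) → Star d j x B [] → ⊥
        at-x (rs , σ , qx) S = none (bowtie b≢d qx (centred S)
          (λ v → A⊆ (X⊆ (∈-resp-↭ (↭-sym σ) v))) (λ v → B⊆ (leaves-⊆ S v)))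
      light : ∀ {x} → x ∈ X → length (nbrs d x B) ≤ τ
      light v = <⇒≤ (≰⇒> (heavy v))
      from-Y : (∃[ Y ] IsClique d k Y × Y ⊆ commons d X B) → ⊥
      from-Y (y ∷ Y , q′ , Y⊆) = none (bowtie b≢d
        (∷-clique (suc-injective (proj₁ q) , AllPairs.tail (proj₂ q))
            (λ v → joined-comm (commons-joined b≢d (Y⊆ (here refl)) (there v))))
        q′ (∷-⊆ (B⊆ (commons-⊆ d X B (Y⊆ (here refl)))) λ v → A⊆ (X⊆ (there v)))
        (λ v → B⊆ (commons-⊆ d X B (Y⊆ (there v)))))

  without : ∀ {s g n xs} → Unique xs → (G : Gadget k s g xs) → (∀ b → ¬ Packing b k (s + n) xs) →
            ∀ b → ¬ Packing b k n (xs ∖ Gadget.support G)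
  without u G none b p = none b (pack-join (Gadget.support-⊆ G) (Gadget.packs G b) p)

  -- `e` is the surplus over `(2 k − 1)` times the number of copies. By `economy` the vertex set
  -- shrinks by at most `(2 k − 1) s − g`, so the surplus rises by `g`.
  remaining : ∀ {s g n xs e w} → Unique xs → (G : Gadget k s g xs) → (s + n) * k + (s + n) * j + e ≤ length xs + w →
              n * k + n * j + e + g ≤ length (xs ∖ Gadget.support G) + w
  remaining {s} {g} {n} {xs} {e} {w} u G le = lin 0 (le ⊕ ∖-length (Gadget.support G) u ⊕ Gadget.economy G)
    (eq s n h e g (length xs) (length (Gadget.support G)) (length (xs ∖ Gadget.support G)) w)
    where
    eq : ∀ s n h e g x a y w →
      n * (2 + h) + n * (1 + h) + e + g + (x + w + (a + y + 2 * (2 + h) * s)) + 0 ≡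
      y + w + ((s + n) * (2 + h) + (s + n) * (1 + h) + e + (x + (a + (g + s))))
    eq = solve-∀

  -- A bowtie preserves the surplus `c₀`, which is enough to find the next bowtie, down to `n = 0`.
  crude : ∀ n {xs} → Unique xs → n * k + n * j + c₀ ≤ length xs + 1 → (∀ b → ¬ Packing b k n xs) → ⊥
  crude zero u le none = none zero pack-0
  crude (suc n) {xs} u le none =
    extract (suc zero) (suc n) u (none (suc zero)) λ {A} uA A⊆ A-free A-size →
    extract zero (suc n) u (none zero) λ {B} uB B⊆ B-free B-size →
    find-bowtie 0≢1 uA uB A⊆ B⊆ A-free B-free (large {A} A-size) (large {B} B-size) λ G →
    crude n (∖-unique (Gadget.support G) u)
      (≤-trans (≤-reflexive (sym (+-identityʳ _))) (remaining {1} {0} {n} {xs} {c₀} {1} u G le))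
          (without {1} {0} {n} u G none)
    where
    0≢1 : zero ≢ suc {1} zero
    0≢1 ()
    large : ∀ {Z} → length xs ≤ length Z + suc n * k → τ + k * suc τ ≤ length Z
    large {Z} size = lin (suc n * j) (c₀-large ⊕ le ⊕ size) (eq (τ + k * suc τ) c₀ (suc n * k) (suc n * j)
        (length xs) (length Z))
      where
      eq : ∀ a c nk nj x z → a + (c + (x + 1 + (z + nk))) + nj ≡ z + (a + 1 + (nk + nj + c + x))
      eq = solve-∀

  -- `e` is the surplus still missing for `crude`. A gadget lowers it by one at the price of at most
  -- 3 copies, whence `n₀ + 3 * e ≤ n`. If there is no gadget, `suc e ≤ c₀` gives back the exact
  -- bound that `Gainless` needs.
  main : ∀ e n {xs} → e ≤ c₀ → Unique xs → n₀ + 3 * e ≤ n → n * k + n * j + (R + c₀) ≤ length xs + (1 + e) →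
         (∀ b → ¬ Packing b k n xs) → ⊥
  main zero n e≤ u n-large le none = crude n u (≤-trans (+-monoʳ-≤ (n * k + n * j) (m≤n+m c₀ R)) le) none
  main (suc e) n {xs} e≤ u n-large le none = Gainless.contradictory c
    (constants n (≤-trans (m≤m+n n₀ _) n-large)) u (no-gadget 2 (s≤s (s≤s z≤n))) (no-gadget 3 ≤-refl) none mono
    (lin 0 (le ⊕ e≤) (eq (n * k + n * j) R c₀ (length xs) e))
    where
    eq : ∀ a r c x e → a + r + (x + (1 + suc e) + c) + 0 ≡ x + 1 + (a + (r + c) + suc e)
    eq = solve-∀
    no-gadget : ∀ s → s ≤ 3 → ¬ Gadget k s 1 xs
    no-gadget s s≤3 G = main e (n ∸ s) (≤-trans (n≤1+n e) e≤) (∖-unique (Gadget.support G) u)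
        (+-cancelˡ-≤ s _ _ (≤-trans (lin 0 (s≤3 ⊕ n-large) (eq₁ s n₀ e n)) (≤-reflexive (sym n-split))))
        (lin 0 (remaining {s} {1} {n ∸ s} {xs} {R + c₀} {1 + suc e} u G
            (subst (λ z → z * k + z * j + (R + c₀) ≤ length xs + (1 + suc e)) (sym n-split) le))
          (eq₂ ((n ∸ s) * k + (n ∸ s) * j) (R + c₀) (length (xs ∖ Gadget.support G)) e))
        (without {s} {1} {n ∸ s} u G (subst (λ z → ∀ b → ¬ Packing b k z xs) (sym n-split) none))
      where
      n-split : s + (n ∸ s) ≡ n
      n-split = m+[n∸m]≡n (≤-trans s≤3 (≤-trans (≤-trans (*-monoʳ-≤ 3 {1} {suc e} (s≤s z≤n))
          (m≤n+m (3 * suc e) n₀)) n-large))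
      eq₁ : ∀ s a e n → s + (a + 3 * e) + (3 + n) + 0 ≡ n + (s + (a + 3 * suc e))
      eq₁ = solve-∀
      eq₂ : ∀ a r y e → a + r + (y + (1 + suc e)) + 0 ≡ y + (1 + e) + (a + r + 1)
      eq₂ = solve-∀

-- Choice of the constants.

n<2^n : ∀ n → suc n ≤ 2 ^ n
n<2^n zero    = ≤-refl
n<2^n (suc n) = lin n (n<2^n n ⊕ n<2^n n) (eq n (2 ^ n))
  where
  eq : ∀ n x → suc (suc n) + (x + x) + n ≡ 2 * x + (suc n + suc n)
  eq = solve-∀

n²≤2*2^n : ∀ n → n * n ≤ 2 * 2 ^ n
n²≤2*2^n zero    = z≤n
n²≤2*2^n (suc n) = lin 1 (n²≤2*2^n n ⊕ *-monoʳ-≤ 2 (n<2^n n)) (eq n (2 ^ n))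
  where
  eq : ∀ n x → suc n * suc n + (2 * x + 2 * x) + 1 ≡ 2 * (2 * x) + (n * n + 2 * suc n)
  eq = solve-∀

2n≤2^n : ∀ n → 2 * (2 + n) ≤ 2 ^ (2 + n)
2n≤2^n zero    = ≤-refl
2n≤2^n (suc n) = lin (2 + 2 * n) (2n≤2^n n ⊕ 2n≤2^n n) (eq n (2 ^ (2 + n)))
  where
  eq : ∀ n x → 2 * (3 + n) + (x + x) + (2 + 2 * n) ≡ 2 * x + (2 * (2 + n) + 2 * (2 + n))
  eq = solve-∀

-- The halving has to start at a power of two not below `k`; the upper bound keeps `6 Q²` polynomial
-- in `k`.
power-between : ∀ k → ∃[ e ] suc k ≤ 2 ^ e × 2 ^ e ≤ 2 * suc k
power-between zero = 0 , ≤-refl , s≤s z≤n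
power-between (suc k) with power-between k
... | e , lo , hi with suc (suc k) ≤? 2 ^ e
...   | yes le = e , le , ≤-trans hi (*-monoʳ-≤ 2 (n≤1+n (suc k)))
...   | no gt  = suc e ,
  lin k (*-monoʳ-≤ 2 lo) (eq k (2 ^ e)) ,
  *-monoʳ-≤ 2 (≤-trans (≤-reflexive refl) (≤-trans (s≤s⁻¹ (≰⇒> gt)) (n≤1+n (suc k))))
  where
  eq : ∀ k x → suc (suc k) + 2 * x + k ≡ 2 * x + 2 * suc k
  eq = solve-∀

powers : ∀ k a → 2 ^ (a * k) ≡ (2 ^ k) ^ a
powers k a = trans (cong (2 ^_) (*-comm a k)) (sym (^-*-assoc 2 k a))

-- Halving a clique number at most log k times costs a factor polynomial in k each time, 2^O(k) in total.
descent-bound : ∀ k e → 2 ^ e ≤ 2 * k → (6 * (2 ^ e * 2 ^ e)) ^ e ≤ (2 ^ k) ^ 14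
descent-bound k e le = begin
  (6 * (2 ^ e * 2 ^ e)) ^ e      ≤⟨ ^-monoˡ-≤ e (*-monoˡ-≤ (2 ^ e * 2 ^ e) {6} {8} (m≤m+n 6 2)) ⟩
  (2 ^ 3 * (2 ^ e * 2 ^ e)) ^ e  ≡⟨ cong (λ z → (2 ^ 3 * z) ^ e) (^-distribˡ-+-* 2 e e) ⟨
  (2 ^ 3 * 2 ^ (e + e)) ^ e      ≡⟨ cong (_^ e) (^-distribˡ-+-* 2 3 (e + e)) ⟨
  (2 ^ (3 + (e + e))) ^ e        ≡⟨ ^-*-assoc 2 (3 + (e + e)) e ⟩
  2 ^ ((3 + (e + e)) * e)        ≤⟨ ^-monoʳ-≤ 2 exponent ⟩
  2 ^ (14 * k)                   ≡⟨ powers k 14 ⟩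
  (2 ^ k) ^ 14                   ∎
  where
  open ≤-Reasoning
  -- `3 e + 2 e²` is at most `3 * 2 ^ e + 4 * 2 ^ e = 7 * 2 ^ e`, and `2 ^ e ≤ 2 k`.
  exponent : (3 + (e + e)) * e ≤ 14 * k
  exponent = lin 3 (*-monoʳ-≤ 3 (n<2^n e) ⊕ *-monoʳ-≤ 2 (n²≤2*2^n e) ⊕ *-monoʳ-≤ 7 le) (eq e k (2 ^ e))
    where
    eq : ∀ e k x → (3 + (e + e)) * e + (3 * x + (2 * (2 * x) + 7 * (2 * k))) + 3 ≡ 14 * k +
        (3 * suc e + (2 * (e * e) + 7 * x))
    eq = solve-∀

module Numerics {h E : ℕ} (4≤E : 4 ≤ E) (k≤E : 2 + h ≤ E)
  (τ-large : ∀ r s → r + s ≤ 5 * (2 + h) → 2 ^ (r + s) ≤ E ^ 5)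
  (descent-bound : ∀ e → 2 ^ e ≤ 2 * (2 + h) → (6 * (2 ^ e * 2 ^ e)) ^ e ≤ E ^ 14) where

  private
    k j : ℕ
    k = 2 + h
    j = 1 + h

  abstract

    -- All constants are powers of `E`, which will be `2 ^ k`. A factor 4 or `k` is paid for by
    -- raising the exponent by one, through `quad` and `scale`.
    p : ℕ → ℕ
    p a = E ^ a

    p-≡ : ∀ a → p a ≡ E ^ a
    p-≡ a = refl

    quad : ∀ a → 4 * p a ≤ p (suc a)
    quad a = *-monoˡ-≤ (E ^ a) 4≤E

    scale : ∀ a → k * p a ≤ p (suc a)
    scale a = *-monoˡ-≤ (E ^ a) k≤E

    up : ∀ {a b} → a ≤ b → p a ≤ p b
    up = ^-monoʳ-≤ E
      where instance
        E≢0 : NonZero E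
        E≢0 = >-nonZero (≤-trans (s≤s z≤n) 4≤E)

    one : ∀ a → 1 ≤ p a
    one a = up {0} {a} z≤n

    k≤ : ∀ a → k ≤ p (suc a)
    k≤ a = ≤-trans k≤E (≤-trans (≤-reflexive (sym (*-identityʳ E))) (up {1} {suc a} (s≤s z≤n)))

    p-+ : ∀ a b → p (a + b) ≡ p a * p b
    p-+ = ^-distribˡ-+-* E

  t₂-room : p 5 + (j + (k + k)) ≤ p 6
  t₂-room = lin 1 (quad 5 ⊕ k≤ 4 ⊕ k≤ 4 ⊕ k≤ 4) (eq h (p 5) (p 6))
    where
    eq : ∀ h x y → x + ((1 + h) + ((2 + h) + (2 + h))) + (y + (x + (x + x))) + 1 ≡ y +
        (4 * x + ((2 + h) + ((2 + h) + (2 + h))))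
    eq = solve-∀

  t₄-room : p 5 + k ≤ p 6
  t₄-room = ≤-trans (+-monoʳ-≤ (p 5) (≤-trans (m≤m+n k k) (m≤n+m (k + k) j))) t₂-room

  stars-room : j + (j + k) ≤ p 7
  stars-room = lin (p 6 + 2) (quad 6 ⊕ k≤ 5 ⊕ k≤ 5 ⊕ k≤ 5) (eq h (p 6) (p 7))
    where
    eq : ∀ h x y → (1 + h) + ((1 + h) + (2 + h)) + (y + (x + (x + x))) + (x + 2) ≡ y +
        (4 * x + ((2 + h) + ((2 + h) + (2 + h))))
    eq = solve-∀

  cover-room : j + p 5 * j ≤ p 7
  cover-room = lin (p 5 + 1 + 2 * p 6) (scale 5 ⊕ k≤ 5 ⊕ quad 6) (eq h (p 5) (p 6) (p 7))
    where
    eq : ∀ h x y z → (1 + h) + x * (1 + h) + (y + (y + z)) + (x + 1 + 2 * y) ≡ z + ((2 + h) * x + ((2 + h) + 4 * y))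
    eq = solve-∀

  m≤mk : ∀ x → x ≤ x * k
  m≤mk x = ≤-trans (≤-reflexive (sym (*-identityʳ x))) (*-monoʳ-≤ x (s≤s z≤n))

  X-room : (k + j) + (2 * j) * suc (p 7) ≤ p 10 * k
  X-room = ≤-trans (lin (2 * p 7 + 3 + 2 * p 8 + 2 * p 9)
      (*-monoʳ-≤ 2 (scale 7) ⊕ *-monoʳ-≤ 4 (k≤ 7) ⊕ *-monoʳ-≤ 2 (quad 8) ⊕ quad 9)
      (eq h (p 7) (p 8) (p 9) (p 10))) (m≤mk (p 10))
    where
    eq : ∀ h x y z w → ((2 + h) + (1 + h)) + (2 * (1 + h)) * suc x + (2 * y + (4 * y + (2 * z + w))) +
        (2 * x + 3 + 2 * y + 2 * z) ≡
                       w + (2 * ((2 + h) * x) + (4 * (2 + h) + (2 * (4 * y) + 4 * z)))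
    eq = solve-∀

  X-room′ : p 5 + j * suc (p 7) ≤ p 10 * k
  X-room′ = ≤-trans (≤-trans (+-monoˡ-≤ (j * suc (p 7)) (≤-trans
      (up {5} {7} (s≤s (s≤s (s≤s (s≤s (s≤s z≤n)))))) ≤-refl))
      (lin (k + 2 * j + h * p 7) (z≤n {0}) (eq h (p 7)))) X-room
    where
    eq : ∀ h x → x + (1 + h) * suc x + 0 + ((2 + h) + 2 * (1 + h) + h * x) ≡ ((2 + h) + (1 + h)) +
        (2 * (1 + h)) * suc x + 0
    eq = solve-∀

  -- Every term of the three size conditions is at most E¹¹, and there are at most 16 of them.
  m-bound : p 10 * k ≤ p 11
  m-bound = ≤-trans (≤-reflexive (*-comm (p 10) k)) (scale 10)

  kg-bound : k * p 6 ≤ p 11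
  kg-bound = ≤-trans (scale 6) (up {7} {11} (m≤m+n 7 4))

  τ-bound : p 5 ≤ p 11
  τ-bound = up (m≤m+n 5 6)

  sixteen : ∀ {n} → p 13 ≤ n → 16 * p 11 ≤ n
  sixteen = ≤-trans (≤-trans (≤-reflexive (*-assoc 4 4 (p 11))) (≤-trans (*-monoʳ-≤ 4 (quad 11)) (quad 12)))

  size₁ : ∀ {n} → p 13 ≤ n → ((p 10 * k + p 5) + (4 * k) * suc (p 6)) + p 5 + p 5 + 1 ≤ n
  size₁ le = ≤-trans (lin (3 * p 11) (m-bound ⊕ *-monoʳ-≤ 3 τ-bound ⊕ *-monoʳ-≤ 4 kg-bound ⊕ *-monoʳ-≤ 4
      (k≤ 10) ⊕ one 11)
      (eq h (p 10 * k) (p 5) (p 6) (p 11))) (sixteen le)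
    where
    eq : ∀ h m t g v → ((m + t) + (4 * (2 + h)) * suc g) + t + t + 1 + (v + (3 * v + (4 * v + (4 * v + v)))) + 3 * v ≡
                       16 * v + (m + (3 * t + (4 * ((2 + h) * g) + (4 * (2 + h) + 1))))
    eq = solve-∀

  size₂ : ∀ {n} → p 13 ≤ n → (p 5 + j * suc (p 6)) + p 5 + p 5 + 1 ≤ n
  size₂ le = ≤-trans (lin (p 6 + 1 + 10 * p 11) (*-monoʳ-≤ 3 τ-bound ⊕ kg-bound ⊕ k≤ 10 ⊕ one 11)
      (eq h (p 5) (p 6) (p 11))) (sixteen le)
    where
    eq : ∀ h t g v → (t + (1 + h) * suc g) + t + t + 1 + (3 * v + (v + (v + v))) + (g + 1 + 10 * v) ≡
                     16 * v + (3 * t + ((2 + h) * g + ((2 + h) + 1)))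
    eq = solve-∀

  size₃ : ∀ {n} → p 13 ≤ n → 2 * (p 10 * k + j * suc (p 6)) + 3 * p 5 ≤ n
  size₃ le = ≤-trans (lin (2 * (p 6 + 1) + 7 * p 11) (*-monoʳ-≤ 2 (m-bound ⊕ kg-bound ⊕ k≤ 10) ⊕ *-monoʳ-≤ 3 τ-bound)
      (eq h (p 10 * k) (p 5) (p 6) (p 11))) (sixteen le)
    where
    eq : ∀ h m t g v → 2 * (m + (1 + h) * suc g) + 3 * t + (2 * (v + (v + v)) + 3 * v) + (2 * (g + 1) + 7 * v) ≡
                       16 * v + (2 * (m + ((2 + h) * g + (2 + h))) + 3 * t)
    eq = solve-∀

  cover-room′ : p 5 + p 5 * h ≤ p 6
  cover-room′ = lin (p 5) (scale 5) (eq h (p 5) (p 6))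
    where
    eq : ∀ h x y → x + x * h + y + x ≡ y + (2 + h) * x
    eq = solve-∀

  common-room : 1 + j * suc (p 6) ≤ p 8
  common-room = lin (p 6 + 2 * p 7) (scale 6 ⊕ k≤ 6 ⊕ quad 7) (eq h (p 6) (p 7) (p 8))
    where
    eq : ∀ h x y z → 1 + (1 + h) * suc x + (y + (y + z)) + (x + 2 * y) ≡ z + ((2 + h) * x + ((2 + h) + 4 * y))
    eq = solve-∀

  line-room : suc (p 8) * (j + j) ≤ p 10
  line-room = lin (2 + 2 * p 8) (*-monoʳ-≤ 2 (scale 8) ⊕ *-monoʳ-≤ 2 (k≤ 8) ⊕ quad 9) (eq h (p 8) (p 9) (p 10))
    where
    eq : ∀ h x y z → suc x * ((1 + h) + (1 + h)) + (2 * y + (2 * y + z)) + (2 + 2 * x) ≡ z +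
        (2 * ((2 + h) * x) + (2 * (2 + h) + 4 * y))
    eq = solve-∀

  group-room : j + j * (suc (p 8) * (j + j)) ≤ p 12
  group-room = lin (1 + 2 * p 11) (*-monoˡ-≤ (suc (p 8) * (j + j)) (n≤1+n j) ⊕ *-monoʳ-≤ k line-room ⊕ scale
      10 ⊕ k≤ 10 ⊕ quad 11)
      (eq h (suc (p 8) * (j + j)) (p 10) (p 11) (p 12))
    where
    eq : ∀ h g x y z → (1 + h) + (1 + h) * g + ((2 + h) * g + ((2 + h) * x + (y + (y + z)))) + (1 + 2 * y) ≡
                       z + ((1 + h) * g + ((2 + h) * g + ((2 + h) * x + ((2 + h) + 4 * y))))
    eq = solve-∀

  cost : p 8 + p 5 * (j + j * (suc (p 8) * (j + j))) ≤ p 18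
  cost = lin (2 * p 17) (up {8} {17} (m≤m+n 8 9) ⊕ *-monoʳ-≤ (p 5) group-room ⊕ ≤-reflexive (sym (p-+ 5 12)) ⊕
      quad 17)
      (eq (p 8) (p 5 * (j + j * (suc (p 8) * (j + j)))) (p 5 * p 12) (p 17) (p 18))
    where
    eq : ∀ x a b y z → x + a + (y + (b + (y + z))) + 2 * y ≡ z + (x + (a + (b + 4 * y)))
    eq = solve-∀

  Λ-large : 1 + (p 5 + (p 8 + p 18)) ≤ p 19
  Λ-large = lin 0 (one 18 ⊕ up {5} {18} (m≤m+n 5 13) ⊕ up {8} {18} (m≤m+n 8 10) ⊕ quad 18)
      (eq (p 5) (p 8) (p 18) (p 19))
    where
    eq : ∀ a b x y → 1 + (a + (b + x)) + (x + (x + (x + y))) + 0 ≡ y + (1 + (a + (b + 4 * x)))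
    eq = solve-∀

  -- 19 is the exponent of `Λ`, and 14 that of the whole descent; no other lower bound on `n` in
  -- `Constants` needs an exponent beyond 13.
  descent-room : ∀ e → 2 ^ e ≤ 2 * k → p 19 * (6 * (2 ^ e * 2 ^ e)) ^ e ≤ p 33
  descent-room e le = ≤-trans (*-monoʳ-≤ (p 19) (≤-trans (descent-bound e le) (≤-reflexive (sym (p-≡ 14)))))
    (≤-reflexive (sym (p-+ 19 14)))

  constants : ∀ {n} → p 33 ≤ n → Constants h n
  constants {n} le = build (power-between j)
    where
    le′ : p 13 ≤ n
    le′ = ≤-trans (up {13} {33} (m≤m+n 13 20)) le
    build : (∃[ e ] k ≤ 2 ^ e × 2 ^ e ≤ 2 * k) → Constants h n
    build (e , lo , hi) = record
      { τ = p 5 ; t₁ = p 7 ; t₂ = p 6 ; t₄ = p 6 ; m = p 10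
      ; τ-large = λ r s le → ≤-trans (τ-large r s le) (≤-reflexive (sym (p-≡ 5)))
      ; t₂≤t₁ = up {6} {7} (n≤1+n 6) ; stars-room = stars-room ; cover-room = cover-room ; X-room = X-room ;
          X-room′ = X-room′
      ; t₄-room = t₄-room ; t₂-room = t₂-room ; size₁ = size₁ le′ ; size₂ = size₂ le′ ; size₃ = size₃ le′
      ; t = p 6 ; l = p 8 ; used = p 18 ; Λ = p 19 ; e = e ; Q = 2 ^ e
      ; cover-room′ = cover-room′ ; common-room = common-room ; cost = cost ; Λ-large = Λ-large
      ; k≤2^e = lo ; 2^e≤Q = ≤-refl ; size₄ = ≤-trans (descent-room e hi) le }

  crude-room : p 5 + k * suc (p 5) + 1 ≤ p 7
  crude-room = lin 0 (up {5} {6} (n≤1+n 5) ⊕ scale 5 ⊕ k≤ 5 ⊕ one 6 ⊕ quad 6) (eq h (p 5) (p 6) (p 7))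
    where
    eq : ∀ h x y z → x + (2 + h) * suc x + 1 + (y + (y + (y + (y + z)))) + 0 ≡ z +
        (x + ((2 + h) * x + ((2 + h) + (1 + 4 * y))))
    eq = solve-∀

  -- The origin of `C = 34`: `p 33` is the `n₀` of the induction and `p 7` its `c₀`, and each of at
  -- most `p 7` gadget removals uses up at most 3 copies.
  total-room : p 33 + 3 * p 7 ≤ p 34
  total-room = ≤-trans (+-monoʳ-≤ (p 33) (*-monoʳ-≤ 3 (up {7} {33} (m≤m+n 7 26)))) (quad 33)

-- From packings to monochromatic copies; the upper bound.

two-colours : ∀ {b d : Fin 2} → b ≢ d → ∀ e → e ≡ b ⊎ e ≡ d
two-colours {zero}     {zero}     b≢d _          = contradiction refl b≢d
two-colours {suc zero} {suc zero} b≢d _          = contradiction refl b≢d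
two-colours {zero}     {suc zero} _   zero       = inj₁ refl
two-colours {zero}     {suc zero} _   (suc zero) = inj₂ refl
two-colours {suc zero} {zero}     _   zero       = inj₂ refl
two-colours {suc zero} {zero}     _   (suc zero) = inj₁ refl

module Copies {N : ℕ} (c : Colouring N) where

  open Cliques c
  open Tilings c

  -- `Arrows` is applied to the colouring induced on the first `r` entries of `zs`.
  mono-clique : ∀ {s r} → Arrows r (K s) → ∀ {b d} → b ≢ d → ∀ {zs} → Unique zs → r ≤ length zs →
                (∃[ ys ] IsClique b s ys × ys ⊆ zs) ⊎ (∃[ ys ] IsClique d s ys × ys ⊆ zs)
  mono-clique {s} {r} arr {b} {d} b≢d {zs} u le = result (two-colours b≢d hue)
    where
    at : Fin r → Fin N
    at i = lookup zs (inject≤ i le)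
    at-distinct : ∀ {i j} → i ≢ j → at i ≢ at j
    at-distinct {i} {j} i≢j = distinct u λ e → i≢j (inject≤-injective le le i j e)
      where
      distinct : ∀ {ws : List (Fin N)} → Unique ws → ∀ {i j} → i ≢ j → lookup ws i ≢ lookup ws j
      distinct (p ∷ w) {zero} {zero} n = contradiction refl n
      distinct {_ ∷ ws} (p ∷ w) {zero} {suc j} n = All.lookup p (∈-lookup {xs = ws} j)
      distinct {_ ∷ ws} (p ∷ w) {suc i} {zero} n = ≢-sym (All.lookup p (∈-lookup {xs = ws} i))
      distinct (p ∷ w) {suc i} {suc j} n = distinct w λ e → n (cong suc e)
    restricted : Colouring r
    restricted = record { colour = λ x y → colour c (at x) (at y) ; symmetric = λ x y → symmetric c (at x) (at y) }
    copy : MonochromaticCopy (K s) restricted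
    copy = arr restricted
    open MonochromaticCopy copy
    copied : List (Fin N)
    copied = tabulate (λ i → at (embed i))
    clique : IsClique hue s copied
    clique = length-tabulate (λ i → at (embed i)) ,
      APP.tabulate⁺ λ {i} {j} i≢j → at-distinct (λ e → i≢j (injective e)) , monochromatic i≢j
    clique-⊆ : copied ⊆ zs
    clique-⊆ v with ∈-tabulate⁻ v
    ... | i , refl = ∈-lookup (inject≤ (embed i) le)
    result : hue ≡ b ⊎ hue ≡ d → (∃[ ys ] IsClique b s ys × ys ⊆ zs) ⊎ (∃[ ys ] IsClique d s ys × ys ⊆ zs)
    result (inj₁ e) = inj₁ (copied , subst (λ z → IsClique z s copied) e clique , λ v → clique-⊆ v)
    result (inj₂ e) = inj₂ (copied , subst (λ z → IsClique z s copied) e clique , λ v → clique-⊆ v)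

  private
    at : ∀ {b k ts} → IsClique b k ts → Fin k → Fin N
    at {ts = ts} (refl , _) i = lookup ts i

    at-∈ : ∀ {b k ts} (q : IsClique b k ts) i → at q i ∈ ts
    at-∈ (refl , _) i = ∈-lookup i

    at-joined : ∀ {b k ts} (q : IsClique b k ts) {i i′} → i ≢ i′ → Joined c b (at q i) (at q i′)
    at-joined (refl , js) = joined-lookup c js

    tile : ∀ {b k tss} → All (IsClique b k) tss → ∀ q → IsClique b k (lookup tss q)
    tile (p ∷ ps) zero    = p
    tile (p ∷ ps) (suc q) = tile ps q

    same-tile : ∀ (tss : List (List (Fin N))) → Unique (concat tss) → ∀ q q′ {x} → x ∈ lookup tss q → x ∈ lookup
        tss q′ → q ≡ q′
    same-tile (ts ∷ tss) u zero zero v w = refl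
    same-tile (ts ∷ tss) u zero (suc q′) v w = contradiction (∈-concat⁺′ w (∈-lookup {xs = tss} q′))
        (proj₂ (proj₂ (unique-++⁻ ts u)) v)
    same-tile (ts ∷ tss) u (suc q) zero v w = contradiction (∈-concat⁺′ v (∈-lookup {xs = tss} q))
        (proj₂ (proj₂ (unique-++⁻ ts u)) w)
    same-tile (ts ∷ tss) u (suc q) (suc q′) v w = cong suc (same-tile tss (proj₁ (proj₂ (unique-++⁻ ts u))) q q′ v w)

    tiles⇒copy : ∀ {b k} tss → All (IsClique b k) tss → Unique (concat tss) → MonochromaticCopy (length tss · K k) c
    tiles⇒copy {b} {k} tss qs u = record
      { embed         = λ x → place (quotient k x) (remainder {length tss} k x)
      ; injective     = λ {x} {y} e → trans (sym (combine-remQuot {length tss} k x))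
          (trans (same (place-injective e)) (combine-remQuot {length tss} k y))
      ; hue           = b
      ; monochromatic = λ (e , n) → in-tile e n
      }
      where
      place : Fin (length tss) → Fin k → Fin N
      place q i = at (tile qs q) i
      in-tile : ∀ {q q′ i i′} → q ≡ q′ → i ≢ i′ → colour c (place q i) (place q′ i′) ≡ b
      in-tile {q} refl n = proj₂ (at-joined (tile qs q) n)
      place-injective : ∀ {q q′ i i′} → place q i ≡ place q′ i′ → q ≡ q′ × i ≡ i′
      place-injective {q} {q′} {i} {i′} e = conclude (same-tile tss u q q′ (at-∈ (tile qs q) i)
          (subst (_∈ lookup tss q′) (sym e) (at-∈ (tile qs q′) i′))) e
        where
        conclude : ∀ {q q′} → q ≡ q′ → place q i ≡ place q′ i′ → q ≡ q′ × i ≡ i′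
        conclude {q} refl e with i ≟ i′
        ... | yes p = refl , p
        ... | no n  = contradiction e (proj₁ (at-joined (tile qs q) n))
      same : ∀ {q q′ i i′} → q ≡ q′ × i ≡ i′ → combine q i ≡ combine {length tss} q′ i′
      same (refl , refl) = refl

  packing⇒copy : ∀ {b i n xs} → Packing b (suc i) n xs → MonochromaticCopy (n · K (suc i)) c
  packing⇒copy {b} {i} {n} (packing (tss , qs , σ) u _ l) = subst (λ z → MonochromaticCopy (z · K (suc i)) c) number
    (tiles⇒copy tss qs (Unique-resp-↭ (↭-sym σ) u))
    where
    number : length tss ≡ n
    number = *-cancelʳ-≡ (length tss) n (suc i) (trans (sym (concat-length tss qs)) (trans (↭-length σ) l))

upper-bound : ∀ k h {r n N} → k ≡ 2 + h → Arrows (suc r) (K (1 + h)) → 2 ^ (34 * k) ≤ n →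
              n * (2 + h) + n * (1 + h) + r ≤ N + 1 → Arrows N (n · K (2 + h))
-- The induction ends in a contradiction only; this suffices because the existence of a copy is
-- decidable.
upper-bound k h {r} {n} {N} refl arr n-large size c = decidable-stable (copy? (n · K (2 + h)) c) λ none →
  Induction.main c {h} {r} {E ^ 5} {p 7} {p 33} τ-large
    (≤-trans (≤-reflexive (cong (λ z → z + (2 + h) * suc z + 1) (sym (p-≡ 5)))) crude-room)
    -- Starting with `e = c₀ = p 7` means starting from the exact bound, the whole surplus still
    -- missing.
    (λ n → constants {n}) (one 33) (mono-clique arr) (p 7) n {allFin N} ≤-refl (UP.allFin⁺ N)
    (≤-trans total-room (≤-trans (≤-reflexive (trans (p-≡ 34) (sym (powers k 34)))) n-large))
    (lin 0 size
      (eq (n * (2 + h) + n * (1 + h)) r (p 7) N (length-tabulate id)))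
    λ b p → none (packing⇒copy p)
  where
  open Copies c
  E : ℕ
  E = 2 ^ k
  τ-large : ∀ s t → s + t ≤ 5 * k → 2 ^ (s + t) ≤ E ^ 5
  τ-large s t le = ≤-trans (^-monoʳ-≤ 2 le) (≤-reflexive (powers k 5))
  4≤E : 4 ≤ E
  4≤E = ≤-trans (*-monoʳ-≤ 2 (s≤s (s≤s (z≤n {h})))) (2n≤2^n h)
  open Numerics {h} {E} 4≤E (≤-trans (m≤m+n k (k + 0)) (2n≤2^n h)) τ-large (descent-bound k)
  eq : ∀ a r x N {l} → l ≡ N → a + (r + x) + (N + 1) + 0 ≡ l + (1 + x) + (a + r)
  eq a r x N refl = eq′ a r x N
    where
    eq′ : ∀ a r x N → a + (r + x) + (N + 1) + 0 ≡ N + (1 + x) + (a + r)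
    eq′ = solve-∀

-- The lower bound.

-- The extremal colouring: a red clique on n k − 1 vertices and a blue clique on n (k − 1) − 1 vertices joined in
-- blue, with a colouring d without monochromatic (k − 1)-clique joined to the former in blue and to the latter in red.
module Extremal {h n r M : ℕ} (M≤ : M ≤ (1 + h + n * (2 + h)) + ((h + n * (1 + h)) + r))
  (d : Colouring r) (none : ¬ MonochromaticCopy (K (1 + h)) d) where

  private
    -- Here `n` is one less than the number of copies, so `a` is `suc n * k − 1` and `b` is
    -- `suc n * j − 1`.
    k j a b : ℕ
    k = 2 + h
    j = 1 + h
    a = 1 + h + n * (2 + h)
    b = h + n * (1 + h)

    Zone : Set
    Zone = Fin a ⊎ (Fin b ⊎ Fin r)

    zone : Fin M → Zone
    zone u = map₂ (splitAt b) (splitAt a (inject≤ u M≤))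

    position : Zone → Fin (a + (b + r))
    position z = join a (b + r) (map₂ (join b r) z)

    position-zone : ∀ u → position (zone u) ≡ inject≤ u M≤
    position-zone u = trans (lemma (splitAt a (inject≤ u M≤))) (join-splitAt a (b + r) (inject≤ u M≤))
      where
      lemma : ∀ z → position (map₂ (splitAt b) z) ≡ join a (b + r) z
      lemma (inj₁ x) = refl
      lemma (inj₂ y) = cong (λ z → join a (b + r) (inj₂ z)) (join-splitAt b r y)

    zone-injective : ∀ {u v} → zone u ≡ zone v → u ≡ v
    zone-injective {u} {v} e = inject≤-injective M≤ M≤ u v
      (trans (sym (position-zone u)) (trans (cong position e) (position-zone v)))

    shade : Zone → Zone → Fin 2
    shade (inj₁ _) (inj₁ _)               = zero
    shade (inj₁ _) (inj₂ _)               = suc zero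
    shade (inj₂ _) (inj₁ _)               = suc zero
    shade (inj₂ (inj₁ _)) (inj₂ (inj₁ _)) = suc zero
    shade (inj₂ (inj₁ _)) (inj₂ (inj₂ _)) = zero
    shade (inj₂ (inj₂ _)) (inj₂ (inj₁ _)) = zero
    shade (inj₂ (inj₂ x)) (inj₂ (inj₂ y)) = colour d x y

    shade-sym : ∀ y z → shade y z ≡ shade z y
    shade-sym (inj₁ _) (inj₁ _)               = refl
    shade-sym (inj₁ _) (inj₂ _)               = refl
    shade-sym (inj₂ _) (inj₁ _)               = refl
    shade-sym (inj₂ (inj₁ _)) (inj₂ (inj₁ _)) = refl
    shade-sym (inj₂ (inj₁ _)) (inj₂ (inj₂ _)) = refl
    shade-sym (inj₂ (inj₂ _)) (inj₂ (inj₁ _)) = refl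
    shade-sym (inj₂ (inj₂ x)) (inj₂ (inj₂ y)) = symmetric d x y

  extremal : Colouring M
  extremal = record { colour = λ u v → shade (zone u) (zone v) ; symmetric = λ u v → shade-sym (zone u) (zone v) }

  private
    Mono : ∀ {s} → Fin 2 → (Fin s → Zone) → Set
    Mono e f = ∀ {v w} → v ≢ w → shade (f v) (f w) ≡ e

    Inj : ∀ {s} → (Fin s → Zone) → Set
    Inj f = ∀ {v w} → f v ≡ f w → v ≡ w

    not-in-d : ∀ {e} (f : Fin j → Zone) → Inj f → Mono e f → ¬ (∀ v → ∃[ x ] f v ≡ inj₂ (inj₂ x))
    not-in-d {e} f inj mono at = none record
      { embed         = λ v → proj₁ (at v)
      ; injective     = λ {v} {w} p → inj (trans (proj₂ (at v))
          (trans (cong (λ x → inj₂ (inj₂ x)) p) (sym (proj₂ (at w)))))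
      ; hue           = e
      ; monochromatic = λ {v} {w} v≢w → trans (sym (cong₂ shade (proj₂ (at v)) (proj₂ (at w)))) (mono v≢w)
      }

    pivot : ∀ {S : Zone → Set} → Decidable S → (f : Fin (suc j) → Zone) →
            (∀ {v w} → v ≢ w → S (f v) → ¬ S (f w)) → ∃[ p ] ∀ v → ¬ S (f (punchIn p v))
    pivot S? f once with any? (λ v → S? (f v))
    ... | yes (p , s) = p , λ v → once (≢-sym (punchInᵢ≢i p v)) s
    ... | no ¬s       = zero , λ v s → ¬s (punchIn zero v , s)

    InA InB : Zone → Set
    InA z = ∃[ x ] z ≡ inj₁ x
    InB z = ∃[ y ] z ≡ inj₂ (inj₁ y)

    inA? : Decidable InA
    inA? (inj₁ x) = yes (x , refl)
    inA? (inj₂ _) = no λ ()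

    inB? : Decidable InB
    inB? (inj₁ _)        = no λ ()
    inB? (inj₂ (inj₁ y)) = yes (y , refl)
    inB? (inj₂ (inj₂ _)) = no λ ()

    -- Edges leaving the first zone are blue, so a red clique with one vertex outside lies entirely
    -- outside. The second zone is blue inside and holds at most one of its vertices, which leaves
    -- `k − 1` vertices for a red clique in `d`.
    red-in-A : (f : Fin k → Zone) → Inj f → Mono zero f → ∀ v → InA (f v)
    red-in-A f inj mono v with f v in e
    ... | inj₁ x = x , refl
    ... | inj₂ z = ⊥-elim (conclude (pivot inB? f λ {v} {w} v≢w (y , p) (y′ , q) →
            contradiction (trans (sym (cong₂ shade p q)) (mono v≢w)) λ ()))
      where
      outside : ∀ w → ¬ InA (f w)
      outside w (x , p) with v ≟ w
      ... | yes refl = contradiction (trans (sym e) p) λ ()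
      ... | no v≢w   = contradiction (trans (sym (cong₂ shade e p)) (mono v≢w)) λ ()
      conclude : ¬ (∃[ p ] ∀ w → ¬ InB (f (punchIn p w)))
      conclude (p , ¬B) = not-in-d (λ w → f (punchIn p w)) (λ q → punchIn-injective p _ _ (inj q))
          (λ v≢w → mono λ q → v≢w (punchIn-injective p _ _ q)) λ w → third (f (punchIn p w))
              (outside (punchIn p w)) (¬B w)
        where
        third : ∀ z → ¬ InA z → ¬ InB z → ∃[ x ] z ≡ inj₂ (inj₂ x)
        third (inj₁ x) n _        = contradiction (x , refl) n
        third (inj₂ (inj₁ y)) _ n = contradiction (y , refl) n
        third (inj₂ (inj₂ x)) _ _ = x , refl

    -- The first zone is red inside and holds at most one vertex, number `p`, of a blue clique. The
    -- edges between the other two zones are red, so the remaining `k − 1` vertices share a zone,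
    -- and `d` contains no such clique.
    blue-in-B : (f : Fin k → Zone) → Inj f → Mono (suc zero) f → ∃[ p ] ∀ v → InB (f (punchIn p v))
    blue-in-B f inj mono with pivot inA? f (λ {v} {w} v≢w (x , p) (x′ , q) →
            contradiction (trans (sym (cong₂ shade p q)) (mono v≢w)) λ ())
    ... | p , ¬A = p , at
      where
      g : Fin j → Zone
      g v = f (punchIn p v)
      mono′ : Mono (suc zero) g
      mono′ v≢w = mono λ q → v≢w (punchIn-injective p _ _ q)
      at : ∀ v → InB (g v)
      at v with g v in e
      ... | inj₁ x        = contradiction (x , e) (¬A v)
      ... | inj₂ (inj₁ y) = y , refl
      ... | inj₂ (inj₂ x) = ⊥-elim (not-in-d g (λ q → punchIn-injective p _ _ (inj q)) mono′ λ w → third w)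
        where
        third : ∀ w → ∃[ x ] g w ≡ inj₂ (inj₂ x)
        third w with g w in e′
        ... | inj₁ x        = contradiction (x , e′) (¬A w)
        ... | inj₂ (inj₂ x) = x , refl
        ... | inj₂ (inj₁ y) with v ≟ w
        ...   | yes refl = contradiction (trans (sym e) e′) λ ()
        ...   | no v≢w   = contradiction (trans (sym (cong₂ shade e e′)) (mono′ v≢w)) λ ()

  no-copy : ¬ MonochromaticCopy (suc n · K k) extremal
  no-copy m = cases hue refl
    where
    open MonochromaticCopy m
    f : Fin (suc n) → Fin k → Zone
    f i v = zone (embed (combine i v))
    f-injective : ∀ {i i′ v v′} → f i v ≡ f i′ v′ → i ≡ i′ × v ≡ v′
    f-injective {i} {i′} {v} {v′} e = combine-injective i v i′ v′ (injective (zone-injective e))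
    f-mono : ∀ i → Mono hue (f i)
    f-mono i {v} {w} v≢w = monochromatic
      ( trans (cong proj₁ (remQuot-combine {suc n} i v)) (sym (cong proj₁ (remQuot-combine {suc n} i w)))
      , λ e → v≢w (trans (sym (cong proj₂ (remQuot-combine {suc n} i v)))
          (trans e (cong proj₂ (remQuot-combine {suc n} i w)))) )
    too-many : ∀ {s t} (g : Fin (suc n) → Fin s → Fin t) → (∀ {i i′ v v′} → g i v ≡ g i′ v′ → i ≡ i′ × v ≡ v′) →
        suc n * s ≤ t
    too-many {s} {t} g inj = injective⇒≤ {f = λ x → g (quotient s x) (remainder {suc n} s x)} λ {x} {y} e →
      trans (sym (combine-remQuot {suc n} s x)) (trans (same (inj e)) (combine-remQuot {suc n} s y))
      where
      same : ∀ {q q′ : Fin (suc n)} {i i′ : Fin s} → q ≡ q′ × i ≡ i′ → combine q i ≡ combine q′ i′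
      same (refl , refl) = refl
    cases : ∀ e → hue ≡ e → ⊥
    cases zero p = 1+n≰n (too-many (λ i v → proj₁ (at i v)) λ {i} {i′} {v} {v′} e →
        f-injective (trans (proj₂ (at i v)) (trans (cong inj₁ e) (sym (proj₂ (at i′ v′))))))
      where
      at : ∀ i v → InA (f i v)
      at i = red-in-A (f i) (λ e → proj₂ (f-injective {i} {i} e)) (λ v≢w → trans (f-mono i v≢w) p)
    cases (suc zero) p = 1+n≰n (too-many (λ i v → proj₁ (proj₂ (at i) v)) λ {i} {i′} {v} {v′} e →
        back i i′ (f-injective (trans (proj₂ (proj₂ (at i) v))
            (trans (cong (λ y → inj₂ (inj₁ y)) e) (sym (proj₂ (proj₂ (at i′) v′)))))))
      where
      at : ∀ i → ∃[ q ] ∀ v → InB (f i (punchIn q v))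
      at i = blue-in-B (f i) (λ e → proj₂ (f-injective {i} {i} e)) (λ v≢w → trans (f-mono i v≢w) p)
      back : ∀ i i′ {v v′} → i ≡ i′ × punchIn (proj₁ (at i)) v ≡ punchIn (proj₁ (at i′)) v′ → i ≡ i′ × v ≡ v′
      back i .i (refl , e) = refl , punchIn-injective (proj₁ (at i)) _ _ e

-- Both bounds combined.

lower-bound : ∀ h n {r M} → ¬ Arrows r (K (1 + h)) → M + 2 ≤ suc n * (2 + h) + suc n * (1 + h) + r →
              ¬ Arrows M (suc n · K (2 + h))
-- The negation of `Arrows` does not exhibit a colouring. Instead every `d` is shown to contain a
-- clique, since one without would make `extremal` contradict `arr`.
lower-bound h n {r} {M} fails size arr = fails λ d → decidable-stable (copy? (K (1 + h)) d) λ none →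
  Extremal.no-copy M≤ d none (arr (Extremal.extremal M≤ d none))
  where
  M≤ : M ≤ (1 + h + n * (2 + h)) + ((h + n * (1 + h)) + r)
  M≤ = lin 0 size (eq h n r M)
    where
    eq : ∀ h n r M → M + (suc n * (2 + h) + suc n * (1 + h) + r) + 0 ≡ (1 + h + n * (2 + h)) +
        ((h + n * (1 + h)) + r) + (M + 2)
    eq = solve-∀

-- Shifting the Ramsey number of `K (1 + h)` and `N` by one each absorbs the `− 2` of the formula,
-- so that no subtraction occurs.
ramsey-of-copies : ∀ h n {r N} → IsRamseyNumber (K (1 + h)) (suc r) → 2 ^ (34 * (2 + h)) ≤ suc n →
                   N + 1 ≡ suc n * (2 + h) + suc n * (1 + h) + r → IsRamseyNumber (suc n · K (2 + h)) N
ramsey-of-copies h n {r} {N} ram n-large size = record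
  { arrows  = upper-bound (2 + h) h refl arrows n-large (≤-reflexive (sym size))
  ; minimal = λ {M} arr → ≮⇒≥ λ M<N → lower-bound h n (λ fails → 1+n≰n (minimal fails))
      (≤-trans (≤-trans (≤-reflexive (+-suc M 1)) (+-monoˡ-≤ 1 M<N)) (≤-reflexive size)) arr
  }
  where open IsRamseyNumber ram

theorem3 : ∃[ C ] 0 < C × (∀ (k n : ℕ) → 2 ≤ k → 2 ^ (C * k) ≤ n →
    r (n · K k) ≡ (2 * k ∸ 1) * n + r (K (k ∸ 1)) ∸ 2)
theorem3 = 34 , s≤s z≤n , exact
  where
  exact : ∀ k n → 2 ≤ k → 2 ^ (34 * k) ≤ n → r (n · K k) ≡ (2 * k ∸ 1) * n + r (K (k ∸ 1)) ∸ 2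
  exact (suc zero) _ (s≤s ()) _
  exact (suc (suc h)) zero _ le = contradiction (≤-trans (m^n>0 2 (34 * (2 + h))) le) λ ()
  exact (suc (suc h)) (suc n) _ le = conclude (r (K (1 + h))) (r-isRamseyNumber (K (1 + h)))
    where
    conclude : ∀ s → IsRamseyNumber (K (1 + h)) s → r (suc n · K (2 + h)) ≡ (2 * (2 + h) ∸ 1) * suc n + s ∸ 2
    -- The Ramsey number is not 0, as the colouring of the empty set has no room for a vertex of
    -- `K (1 + h)`.
    conclude zero ram with MonochromaticCopy.embed (IsRamseyNumber.arrows ram record
        { colour = λ () ; symmetric = λ () }) zero
    ... | ()
    conclude (suc s) ram = isRamseyNumber-unique (r-isRamseyNumber _) (ramsey-of-copies h n ram le (eq h n s))
      where
      eq : ∀ h n s → (2 * (2 + h) ∸ 1) * suc n + suc s ∸ 2 + 1 ≡ suc n * (2 + h) + suc n * (1 + h) + s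
      eq h n s = trans (cong (λ z → z ∸ 1 + 1) (+-suc (n + (h + (2 + h + 0)) * suc n) s)) (eq′ h n s)
        where
        eq′ : ∀ h n s → n + (h + (2 + h + 0)) * suc n + s + 1 ≡ suc n * (2 + h) + suc n * (1 + h) + s
        eq′ = solve-∀
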